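{- Let $q$ be a prime power, let $n\geq 1$, let ${\mathsf m}:[n]\to[n]$ be a Hessenberg function, and let $T:\mathbb{F}_q^n\to\mathbb{F}_q^n$ be any $\mathbb{F}_q$-linear operator. Then the number of $\mathbb{F}_q$-rational points of the Hessenberg variety $\mathscr{H}({\mathsf m},T)$ is $$|\mathscr{H}({\mathsf m},T)|=\langle F_T(x),\ \omega X_{G({\mathsf m})}(x;q)\rangle .$$
   Context: $[n]=\{1,\dots,n\}$. A Hessenberg function is a weakly increasing ${\mathsf m}:[n]\to[n]$ with ${\mathsf m}(i)\geq i$ for all $i$. For a field $F$ and linear $T:F^n\to F^n$, the Hessenberg variety $\mathscr{H}({\mathsf m},T)$ is the set of complete flags $V_1\subseteq V_2\subseteq\cdots\subseteq V_n=F^n$ ($\dim V_i=i$) with $TV_i\subseteq V_{{\mathsf m}(i)}$ for all $i\in[n]$. The indifference graph $G({\mathsf m})$ has vertex set $[n]$ and edges $\{i,j\}$ with $i<j\leq {\mathsf m}(i)$. For a graph $G$ on $[n]$, its chromatic quasisymmetric function is $X_G(x;t)=\sum_\kappa t^{\mathrm{asc}(\kappa)}x_{\kappa(1)}\cdots x_{\kappa(n)}$, summed over proper colorings $\kappa:[n]\to\{1,2,\dots\}$, where $\mathrm{asc}(\kappa)$ is the number of edges $\{i,j\}$ with $i<j$ and $\kappa(i)<\kappa(j)$; for $G=G({\mathsf m})$ this is a symmetric function, and $X_{G({\mathsf m})}(x;q)$ denotes its specialization at $t=q$. $\omega$ is the involution on symmetric functions with $\omega s_\lambda=s_{\lambda'}$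 ($\lambda'$ the conjugate partition), and $\langle\cdot,\cdot\rangle$ is the Hall scalar product, for which $\{h_\lambda\}$ and $\{m_\lambda\}$ are dual bases. For a partition $\lambda=(\lambda_1,\dots,\lambda_\ell)$ of $n$, let $\mathrm{fl}_\lambda(T)$ be the number of chains $(0)=W_0\subseteq W_1\subseteq\cdots\subseteq W_\ell$ of $T$-invariant subspaces of $\mathbb{F}_q^n$ with $\dim W_i/W_{i-1}=\lambda_i$ for $1\le i\le \ell$. The invariant flag generating function of $T$ is $F_T(x)=\sum_{\lambda\vdash n}\mathrm{fl}_\lambda(T)\,m_\lambda$, where $m_\lambda$ is the monomial symmetric function. -}

module Defs where

open import Level using (0ℓ)
open import Data.Bool using (Bool; true; false; _∧_; _∨_; not; if_then_else_)
open import Data.Nat as ℕ using (ℕ; zero; suc; _∸_; _^_)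
open import Data.Nat.Properties using (_≤?_; _<?_)
import Data.Nat.Properties as ℕP
open import Data.Fin as Fin using (Fin; toℕ)
open import Data.Integer as ℤ using (ℤ)
open import Data.List as List using (List; []; _∷_; length; map; concatMap; filter; upTo; allFin; foldr; zip)
open import Data.Bool.ListAction using (and; or; all; any)
open import Data.Nat.ListAction using (sum)
open import Data.List.Relation.Unary.Any using (Any)
open import Data.List.Relation.Unary.AllPairs using (AllPairs)
open import Data.Vec as Vec using (Vec; []; _∷_; lookup)
open import Data.Product using (∃; _×_; _,_; proj₁; proj₂)
open import Algebra.Bundles using (CommutativeRing)
open import Relation.Binary.Definitions using (Decidable)
open import Relation.Nullary using (¬_)
open import Relation.Nullary.Decidable using (⌊_⌋)

count : {A : Set} → (A → Bool) → List A → ℕ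
count p xs = length (filter (λ x → Data.Bool._≟_ (p x) true) xs)
  where import Data.Bool

vecsOf : {A : Set} → List A → (k : ℕ) → List (Vec A k)
vecsOf xs zero    = [] ∷ []
vecsOf xs (suc k) = concatMap (λ x → map (x ∷_) (vecsOf xs k)) xs

-- Finite fields.  A field is a commutative ring with 0 ≠ 1 in which every
-- nonzero element has an inverse.  It is finite with q elements: 'elems'
-- lists every element exactly once (up to the field equality ≈), and
-- q = length elems.  (Every finite field has prime-power order, and every
-- prime power q is the order of the field F_q, unique up to isomorphism.)

record FiniteField : Set₁ where
  field
    commutativeRing : CommutativeRing 0ℓ 0ℓ
  open CommutativeRing commutativeRing public
  field
    _≟_      : Decidable _≈_
    0≉1      : ¬ (0# ≈ 1#)
    inverse  : ∀ x → ¬ (x ≈ 0#) → ∃ λ y → x * y ≈ 1#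
    elems    : List Carrier
    complete : ∀ x → Any (x ≈_) elems
    distinct : AllPairs (λ a b → ¬ (a ≈ b)) elems

  q : ℕ
  q = length elems

  _≈b_ : Carrier → Carrier → Bool
  a ≈b b = ⌊ a ≟ b ⌋

  _≈ᵥ_ : ∀ {n} → Vec Carrier n → Vec Carrier n → Bool
  [] ≈ᵥ [] = true
  (a ∷ u) ≈ᵥ (b ∷ v) = (a ≈b b) ∧ (u ≈ᵥ v)

  zeroV : ∀ n → Vec Carrier n
  zeroV n = Vec.replicate n 0#

  _+ᵥ_ : ∀ {n} → Vec Carrier n → Vec Carrier n → Vec Carrier n
  u +ᵥ v = Vec.zipWith _+_ u v

  _·ᵥ_ : ∀ {n} → Carrier → Vec Carrier n → Vec Carrier n
  c ·ᵥ v = Vec.map (c *_) v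

  dot : ∀ {n} → Vec Carrier n → Vec Carrier n → Carrier
  dot u v = Vec.foldr _ _+_ 0# (Vec.zipWith _*_ u v)

  lincomb : ∀ {n d} → Vec Carrier d → Vec (Vec Carrier n) d → Vec Carrier n
  lincomb {n} [] [] = zeroV n
  lincomb (c ∷ cs) (b ∷ bs) = (c ·ᵥ b) +ᵥ lincomb cs bs

  Matrix : ℕ → Set
  Matrix n = Vec (Vec Carrier n) n

  apply : ∀ {n} → Matrix n → Vec Carrier n → Vec Carrier n
  apply T v = Vec.map (λ row → dot row v) T

  allVecs : (n : ℕ) → List (Vec Carrier n)
  allVecs n = vecsOf elems n

  -- A subset of F^n: a Bool flag for each entry of allVecs n
  record Subset (n : ℕ) : Set where
    constructor mkSub
    field flags : List Bool

  elemsOf : ∀ {n} → Subset n → List (Vec Carrier n)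
  elemsOf {n} S = List.map proj₁ (filter (λ p → Data.Bool._≟_ (proj₂ p) true) (zip (allVecs n) (Subset.flags S)))
    where import Data.Bool

  _∈ₛ_ : ∀ {n} → Vec Carrier n → Subset n → Bool
  v ∈ₛ S = any (v ≈ᵥ_) (elemsOf S)

  _⊆ₛ_ : ∀ {n} → Subset n → Subset n → Bool
  S ⊆ₛ S' = all (_∈ₛ S') (elemsOf S)

  isSubspace : ∀ {n} → Subset n → Bool
  isSubspace {n} S =
    (zeroV n ∈ₛ S)
    ∧ all (λ u → all (λ v → (u +ᵥ v) ∈ₛ S) (elemsOf S)) (elemsOf S)
    ∧ all (λ u → all (λ c → (c ·ᵥ u) ∈ₛ S) elems) (elemsOf S)

  allSubsets : (n : ℕ) → List (Subset n)
  allSubsets n = List.map (λ bs → mkSub (Vec.toList bs)) (vecsOf (true ∷ false ∷ []) (length (allVecs n)))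

  subspaces : (n : ℕ) → List (Subset n)
  subspaces n = filter (λ S → Data.Bool._≟_ (isSubspace S) true) (allSubsets n)
    where import Data.Bool

  isBasisOf : ∀ {n d} → Vec (Vec Carrier n) d → Subset n → Bool
  isBasisOf {n} {d} b S =
    all (_∈ₛ S) (Vec.toList b)
    ∧ all (λ c → not (lincomb c b ≈ᵥ zeroV n) ∨ (c ≈ᵥ Vec.replicate d 0#)) (vecsOf elems d)
    ∧ all (λ w → any (λ c → lincomb c b ≈ᵥ w) (vecsOf elems d)) (elemsOf S)

  hasDim : ∀ {n} → Subset n → ℕ → Bool
  hasDim {n} S d = any (λ b → isBasisOf b S) (vecsOf (allVecs n) d)

  mapsInto : ∀ {n} → Matrix n → Subset n → Subset n → Bool
  mapsInto T V W = all (λ v → apply T v ∈ₛ W) (elemsOf V)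

  zeroSub : (n : ℕ) → Subset n
  zeroSub n = mkSub (List.map (λ v → v ≈ᵥ zeroV n) (allVecs n))

  -- |H(m,T)|: number of complete flags V_1 ⊆ ... ⊆ V_n = F^n, dim V_i = i,
  -- with T V_i ⊆ V_{m(i)}.  0-indexed: the tuple entry k : Fin n is V_{k+1},
  -- and m : Fin n → Fin n is the 0-indexed Hessenberg function.
  isHessFlag : ∀ {n} → (Fin n → Fin n) → Matrix n → Vec (Subset n) n → Bool
  isHessFlag {n} m T V =
    all (λ k → hasDim (lookup V k) (suc (toℕ k))) (allFin n)
    ∧ all (λ k → all (λ l → not ⌊ toℕ k <? toℕ l ⌋ ∨ (lookup V k ⊆ₛ lookup V l)) (allFin n)) (allFin n)
    ∧ all (λ k → mapsInto T (lookup V k) (lookup V (m k))) (allFin n)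

  hessCount : ∀ {n} → (Fin n → Fin n) → Matrix n → ℕ
  hessCount {n} m T = count (isHessFlag m T) (vecsOf (subspaces n) n)

  -- fl_λ(T): number of chains (0) = W_0 ⊆ W_1 ⊆ ... ⊆ W_ℓ of T-invariant
  -- subspaces with dim W_i / W_{i-1} = λ_i, i.e. dim W_i = dim W_{i-1} + λ_i.
  -- chainsFrom λ W d counts the continuations of a chain ending in W, dim W = d.
  chainsFrom : ∀ {n} → Matrix n → List ℕ → Subset n → ℕ → ℕ
  chainsFrom T [] W d = 1
  chainsFrom {n} T (k ∷ λs) W d =
    sum (List.map (λ W' → if mapsInto T W' W' ∧ (W ⊆ₛ W') ∧ hasDim W' (d ℕ.+ k)
                          then chainsFrom T λs W' (d ℕ.+ k) else 0)
                  (subspaces n))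

  fl : ∀ {n} → Matrix n → List ℕ → ℕ
  fl {n} T λs = chainsFrom T λs (zeroSub n) 0

IsHessenberg : ∀ {n} → (Fin n → Fin n) → Set
IsHessenberg {n} m = (∀ i → i Fin.≤ m i) × (∀ i j → i Fin.≤ j → m i Fin.≤ m j)

isEdge : ∀ {n} → (Fin n → Fin n) → Fin n → Fin n → Bool
isEdge m i j = ⌊ toℕ i <? toℕ j ⌋ ∧ ⌊ toℕ j ≤? toℕ (m i) ⌋

isPartitionOf : ℕ → List ℕ → Bool
isPartitionOf n μ = ⌊ sum μ ℕ.≟ n ⌋ ∧ all (λ k → ⌊ 1 ≤? k ⌋) μ ∧ decr μ
  where
  decr : List ℕ → Bool
  decr [] = true
  decr (a ∷ []) = true
  decr (a ∷ b ∷ xs) = ⌊ b ≤? a ⌋ ∧ decr (b ∷ xs)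

partitions : ℕ → List (List ℕ)
partitions n =
  filter (λ μ → Data.Bool._≟_ (isPartitionOf n μ) true)
    (concatMap (λ ℓ → List.map Vec.toList (vecsOf (upTo (suc n)) ℓ)) (upTo (suc n)))
  where import Data.Bool

sumPartitions : ℕ → (List ℕ → ℤ) → ℤ
sumPartitions n f = foldr (λ μ acc → f μ ℤ.+ acc) (ℤ.+ 0) (partitions n)

-- Symmetric functions of degree n are recorded by their coefficients in the
-- monomial basis: the coefficient of m_μ equals the coefficient of the
-- monomial x^μ = x_1^{μ_1} ... x_ℓ^{μ_ℓ}.

occ : ∀ {n} → Vec ℕ n → ℕ → ℕ
occ κ j = count (λ c → ⌊ c ℕ.≟ j ⌋) (Vec.toList κ)

-- coefficient of x^μ in X_{G(m)}(x; q):  Σ over proper colourings κ with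
-- colour content μ (colour j+1 used μ_{j+1} times; colours ℕ 0-indexed)
-- of q^{asc κ}
Xcoef : ∀ {n} → ℕ → (Fin n → Fin n) → List ℕ → ℤ
Xcoef {n} q m μ = ℤ.+ sum (List.map weight (vecsOf (upTo (length μ)) n))
  where
  edges : List (Fin n × Fin n)
  edges = filter (λ e → Data.Bool._≟_ (isEdge m (proj₁ e) (proj₂ e)) true)
                 (concatMap (λ i → List.map (i ,_) (allFin n)) (allFin n))
    where import Data.Bool
  proper : Vec ℕ n → Bool
  proper κ = all (λ e → not ⌊ lookup κ (proj₁ e) ℕ.≟ lookup κ (proj₂ e) ⌋) edges
  content : Vec ℕ n → Bool
  content κ = and (List.zipWith (λ j μj → ⌊ occ κ j ℕ.≟ μj ⌋) (upTo (length μ)) μ)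
  asc : Vec ℕ n → ℕ
  asc κ = count (λ e → ⌊ lookup κ (proj₁ e) <? lookup κ (proj₂ e) ⌋) edges
  weight : Vec ℕ n → ℕ
  weight κ = if proper κ ∧ content κ then q ^ asc κ else 0

-- coefficient of x^α in e_λ = e_{λ_1} e_{λ_2} ⋯ , where
-- e_k = Σ_{i_1 < ... < i_k} x_{i_1} ⋯ x_{i_k}.  Each factor e_k contributes a
-- 0/1 exponent vector of weight k (only the variables of α can occur).
ecoefAux : List ℕ → List ℕ → ℕ
ecoefAux [] α = if all (λ a → ⌊ a ℕ.≟ 0 ⌋) α then 1 else 0
ecoefAux (k ∷ λs) α =
  sum (List.map (λ v → if ⌊ sum v ℕ.≟ k ⌋ ∧ and (List.zipWith (λ a b → ⌊ a ≤? b ⌋) v α)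
                       then ecoefAux λs (List.zipWith _∸_ α v) else 0)
                (List.map Vec.toList (vecsOf (0 ∷ 1 ∷ []) (length α))))

ecoef : List ℕ → List ℕ → ℤ
ecoef λs μ = ℤ.+ ecoefAux λs μ

{-# OPTIONS --safe #-}
module Submission where

-- Both sides satisfy the modular law of Abreu and Nigro, (1 + q) f(h₁) = q f(h₀) + f(h₂) whenever the
-- Hessenberg function h₁ lies halfway between h₀ and h₂: on the flag side, a single subspace of the
-- flag varies among the q + 1 subspaces between its neighbours, all of which (or exactly one of
-- which) satisfy the condition at stake; on the colouring side, the colours of two adjacent vertices
-- with the same remaining neighbours are exchanged.  A function satisfying the law is determined by
-- its values at the disjoint unions of cliques of sizes λ₁, λ₂, …, and these values do not depend on
-- the order of the λᵢ.  There X = Π [λᵢ]! e_λ and |H(m,T)| = Π [λᵢ]! fl_λ(T).  Hence if b is the linear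
-- functional on symmetric functions with b(e_λ) = fl_λ(T), then |H(m,T)| - b(X) satisfies the law and
-- vanishes at all unions of cliques, so that |H(m,T)| = b(X) = Σ c_λ fl_λ(T).

-- The law relates only neighbouring functions, whereas a general Hessenberg function is far from
-- any union of cliques. The gap is bridged by `corner`: along a chain of moves the differences form
-- a geometric progression, so two chains with the same start and the same first step can be
-- compared at their far ends, with q-integers as coefficients. Cancelling these requires q ≠ 0 and
-- values in ℤ. Independence of the order of the cliques is drawn from the law alone, for any
-- function that satisfies it. It matters because b is controlled only at partitions, while the
-- reduction produces cliques of sizes in any order. The functional b exists because the e_λ are
-- unitriangular against the monomials whose exponents are conjugate partitions. It is an explicit
-- combination of coefficient extractions, so the law for each coefficient of X passes to b(X). The
-- c_λ are never computed: b is linear and is applied to the given expansion of X.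

-- Finite sums and products over lists and vectors

module Sums where

  open import Data.Nat
  open import Data.Nat.Properties
  open import Data.Nat.Tactic.RingSolver using (solve-∀)
  open import Data.Nat.ListAction using (sum; product)
  open import Data.Bool as Bool using (Bool; true; false; if_then_else_)
  open import Data.List using (List; []; _∷_; map; _++_; concatMap; filter; upTo; allFin; length)
  open import Data.List.Properties using (map-∘; map-upTo; map-tabulate)
  open import Data.List.Relation.Unary.Any using (here; there)
  open import Data.List.Membership.Propositional using (_∈_)
  open import Data.Fin as Fin using (Fin)
  open import Data.Vec as Vec using (Vec; []; _∷_)
  open import Function using (_∘_)
  open import Relation.Binary.PropositionalEquality hiding ([_])
  open import Relation.Nullary using (¬_; Dec)
  open import Relation.Nullary.Decidable using (⌊_⌋; isYes≗does; dec-true; dec-false)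
  open import Defs using (vecsOf; count)

  private variable
    A B : Set

  ∑ : List A → (A → ℕ) → ℕ
  ∑ xs f = sum (map f xs)

  𝟙 : Bool → ℕ
  𝟙 b = if b then 1 else 0

  ∑-cong∈ : ∀ (xs : List A) {f g : A → ℕ} → (∀ {x} → x ∈ xs → f x ≡ g x) → ∑ xs f ≡ ∑ xs g
  ∑-cong∈ []       _  = refl
  ∑-cong∈ (x ∷ xs) eq = cong₂ _+_ (eq (here refl)) (∑-cong∈ xs (eq ∘ there))

  ∑-cong : ∀ (xs : List A) {f g : A → ℕ} → (∀ x → f x ≡ g x) → ∑ xs f ≡ ∑ xs g
  ∑-cong xs eq = ∑-cong∈ xs (λ {x} _ → eq x)

  ∑-+ : ∀ (xs : List A) f g → ∑ xs (λ x → f x + g x) ≡ ∑ xs f + ∑ xs g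
  ∑-+ []       f g = refl
  ∑-+ (x ∷ xs) f g = trans (cong (f x + g x +_) (∑-+ xs f g)) (interchange (f x) (g x) _ _)
    where
    interchange : ∀ a b c d → a + b + (c + d) ≡ a + c + (b + d)
    interchange = solve-∀

  ∑-*ˡ : ∀ (xs : List A) c f → ∑ xs (λ x → c * f x) ≡ c * ∑ xs f
  ∑-*ˡ []       c f = sym (*-zeroʳ c)
  ∑-*ˡ (x ∷ xs) c f = trans (cong (c * f x +_) (∑-*ˡ xs c f)) (sym (*-distribˡ-+ c (f x) _))

  ∑-*ʳ : ∀ (xs : List A) c f → ∑ xs (λ x → f x * c) ≡ ∑ xs f * c
  ∑-*ʳ xs c f = trans (∑-cong xs (λ x → *-comm (f x) c)) (trans (∑-*ˡ xs c f) (*-comm c _))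

  ∑-0 : ∀ (xs : List A) {f : A → ℕ} → (∀ {x} → x ∈ xs → f x ≡ 0) → ∑ xs f ≡ 0
  ∑-0 xs eq = trans (∑-cong∈ xs eq) (const xs)
    where
    const : ∀ xs → ∑ xs (λ _ → 0) ≡ 0
    const []       = refl
    const (_ ∷ xs) = const xs

  ∑-1 : ∀ (xs : List A) → ∑ xs (λ _ → 1) ≡ length xs
  ∑-1 []       = refl
  ∑-1 (_ ∷ xs) = cong suc (∑-1 xs)

  ∑-swap : ∀ (xs : List A) (ys : List B) (f : A → B → ℕ) →
    ∑ xs (λ x → ∑ ys (f x)) ≡ ∑ ys (λ y → ∑ xs (λ x → f x y))
  ∑-swap []       ys f = sym (∑-0 ys (λ _ → refl))
  ∑-swap (x ∷ xs) ys f = trans (cong (∑ ys (f x) +_) (∑-swap xs ys f)) (sym (∑-+ ys (f x) _))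

  ∑-map : ∀ (g : A → B) xs f → ∑ (map g xs) f ≡ ∑ xs (f ∘ g)
  ∑-map g xs f = cong sum (sym (map-∘ xs))

  ∑-++ : ∀ (xs ys : List A) f → ∑ (xs ++ ys) f ≡ ∑ xs f + ∑ ys f
  ∑-++ []       ys f = refl
  ∑-++ (x ∷ xs) ys f = trans (cong (f x +_) (∑-++ xs ys f)) (sym (+-assoc (f x) _ _))

  ∑-concatMap : ∀ (g : A → List B) xs f → ∑ (concatMap g xs) f ≡ ∑ xs (λ x → ∑ (g x) f)
  ∑-concatMap g []       f = refl
  ∑-concatMap g (x ∷ xs) f = trans (∑-++ (g x) _ f) (cong (∑ (g x) f +_) (∑-concatMap g xs f))

  ∑-filter : ∀ (p : A → Bool) xs f →
    ∑ (filter (λ x → p x Bool.≟ true) xs) f ≡ ∑ xs (λ x → if p x then f x else 0)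
  ∑-filter p []       f = refl
  ∑-filter p (x ∷ xs) f with p x
  ... | true  = cong (f x +_) (∑-filter p xs f)
  ... | false = ∑-filter p xs f

  count≡∑ : ∀ (p : A → Bool) xs → count p xs ≡ ∑ xs (𝟙 ∘ p)
  count≡∑ p xs = trans (sym (∑-1 (filter (λ x → p x Bool.≟ true) xs))) (∑-filter p xs (λ _ → 1))

  ∑-upTo : ∀ n f → ∑ (upTo (suc n)) f ≡ f 0 + ∑ (upTo n) (f ∘ suc)
  ∑-upTo n f = cong (f 0 +_) (trans (cong (λ xs → ∑ xs f) (sym (map-upTo suc n))) (∑-map suc (upTo n) f))

  ∑-vecs : ∀ (xs : List A) k f → ∑ (vecsOf xs (suc k)) f ≡ ∑ xs (λ x → ∑ (vecsOf xs k) (λ v → f (x ∷ v)))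
  ∑-vecs xs k f = trans (∑-concatMap _ xs f) (∑-cong xs (λ x → ∑-map (x ∷_) (vecsOf xs k) f))

  ∑-vecs-++ : ∀ (xs : List A) j k (f : Vec A (j + k) → ℕ) →
    ∑ (vecsOf xs (j + k)) f ≡ ∑ (vecsOf xs j) (λ u → ∑ (vecsOf xs k) (λ v → f (u Vec.++ v)))
  ∑-vecs-++ xs zero    k f = sym (+-identityʳ _)
  ∑-vecs-++ xs (suc j) k f = begin
    ∑ (vecsOf xs (suc j + k)) f                                                    ≡⟨ ∑-vecs xs (j + k) f ⟩
    ∑ xs (λ x → ∑ (vecsOf xs (j + k)) (λ w → f (x ∷ w)))                           ≡⟨ ∑-cong xs (λ x → ∑-vecs-++ xs j k _) ⟩
    ∑ xs (λ x → ∑ (vecsOf xs j) (λ u → ∑ (vecsOf xs k) (λ v → f (x ∷ u Vec.++ v)))) ≡⟨ ∑-vecs xs j _ ⟨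
    ∑ (vecsOf xs (suc j)) (λ u → ∑ (vecsOf xs k) (λ v → f (u Vec.++ v)))            ∎
    where open ≡-Reasoning

  ∏ : List A → (A → ℕ) → ℕ
  ∏ xs f = product (map f xs)

  ∏-cong : ∀ (xs : List A) {f g : A → ℕ} → (∀ x → f x ≡ g x) → ∏ xs f ≡ ∏ xs g
  ∏-cong []       eq = refl
  ∏-cong (x ∷ xs) eq = cong₂ _*_ (eq x) (∏-cong xs eq)

  ∏-1 : ∀ (xs : List A) → ∏ xs (λ _ → 1) ≡ 1
  ∏-1 []       = refl
  ∏-1 (_ ∷ xs) = trans (*-identityˡ _) (∏-1 xs)

  ∏-map : ∀ (g : A → B) xs f → ∏ (map g xs) f ≡ ∏ xs (f ∘ g)
  ∏-map g xs f = cong product (sym (map-∘ xs))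

  ∏-++ : ∀ (xs ys : List A) f → ∏ (xs ++ ys) f ≡ ∏ xs f * ∏ ys f
  ∏-++ []       ys f = sym (*-identityˡ _)
  ∏-++ (x ∷ xs) ys f = trans (cong (f x *_) (∏-++ xs ys f)) (sym (*-assoc (f x) _ _))

  ∏-concatMap : ∀ (g : A → List B) xs f → ∏ (concatMap g xs) f ≡ ∏ xs (λ x → ∏ (g x) f)
  ∏-concatMap g []       f = refl
  ∏-concatMap g (x ∷ xs) f = trans (∏-++ (g x) _ f) (cong (∏ (g x) f *_) (∏-concatMap g xs f))

  ∏-filter : ∀ (p : A → Bool) xs f →
    ∏ (filter (λ x → p x Bool.≟ true) xs) f ≡ ∏ xs (λ x → if p x then f x else 1)
  ∏-filter p []       f = refl
  ∏-filter p (x ∷ xs) f with p x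
  ... | true  = cong (f x *_) (∏-filter p xs f)
  ... | false = trans (∏-filter p xs f) (sym (*-identityˡ _))

  ∏-allFin : ∀ n (f : Fin (suc n) → ℕ) → ∏ (allFin (suc n)) f ≡ f Fin.zero * ∏ (allFin n) (f ∘ Fin.suc)
  ∏-allFin n f = cong (f Fin.zero *_)
    (trans (cong (λ xs → ∏ xs f) (sym (map-tabulate (λ i → i) Fin.suc))) (∏-map Fin.suc (allFin n) f))

  swapAt : ∀ {n} → ℕ → Vec A n → Vec A n
  swapAt zero    (x ∷ y ∷ v) = y ∷ x ∷ v
  swapAt (suc p) (x ∷ v)     = x ∷ swapAt p v
  swapAt _       v           = v

  -- Exchanging two neighbouring entries permutes the vectors; it amounts to `∑-swap` for two
  -- summation variables. This allows a colouring to be averaged with its exchanged version.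
  ∑-swapAt : ∀ (xs : List A) n p (f : Vec A n → ℕ) → ∑ (vecsOf xs n) (f ∘ swapAt p) ≡ ∑ (vecsOf xs n) f
  ∑-swapAt xs zero          zero    f = refl
  ∑-swapAt xs zero          (suc p) f = refl
  ∑-swapAt xs (suc zero)    zero    f = ∑-cong (vecsOf xs 1) (λ { (x ∷ []) → refl })
  ∑-swapAt xs (suc (suc n)) zero    f = begin
    ∑ (vecsOf xs (2 + n)) (f ∘ swapAt 0)                        ≡⟨ two (f ∘ swapAt 0) ⟩
    ∑ xs (λ x → ∑ xs (λ y → ∑ (vecsOf xs n) (λ v → f (y ∷ x ∷ v)))) ≡⟨ ∑-swap xs xs _ ⟩
    ∑ xs (λ y → ∑ xs (λ x → ∑ (vecsOf xs n) (λ v → f (y ∷ x ∷ v)))) ≡⟨ two f ⟨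
    ∑ (vecsOf xs (2 + n)) f                                     ∎
    where
    open ≡-Reasoning
    two : ∀ g → ∑ (vecsOf xs (2 + n)) g ≡ ∑ xs (λ x → ∑ xs (λ y → ∑ (vecsOf xs n) (λ v → g (x ∷ y ∷ v))))
    two g = trans (∑-vecs xs (suc n) g) (∑-cong xs (λ x → ∑-vecs xs n _))
  ∑-swapAt xs (suc n) (suc p) f = begin
    ∑ (vecsOf xs (suc n)) (f ∘ swapAt (suc p))           ≡⟨ ∑-vecs xs n _ ⟩
    ∑ xs (λ x → ∑ (vecsOf xs n) (λ v → f (x ∷ swapAt p v))) ≡⟨ ∑-cong xs (λ x → ∑-swapAt xs n p (λ v → f (x ∷ v))) ⟩
    ∑ xs (λ x → ∑ (vecsOf xs n) (λ v → f (x ∷ v)))         ≡⟨ ∑-vecs xs n f ⟨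
    ∑ (vecsOf xs (suc n)) f                              ∎
    where open ≡-Reasoning

  ⌊⌋-true : ∀ {p} {P : Set p} (d : Dec P) → P → ⌊ d ⌋ ≡ true
  ⌊⌋-true d p = trans (isYes≗does d) (dec-true d p)

  ⌊⌋-false : ∀ {p} {P : Set p} (d : Dec P) → ¬ P → ⌊ d ⌋ ≡ false
  ⌊⌋-false d ¬p = trans (isYes≗does d) (dec-false d ¬p)

  count-∷ : ∀ (p : A → Bool) x xs → count p (x ∷ xs) ≡ 𝟙 (p x) + count p xs
  count-∷ p x xs = trans (count≡∑ p (x ∷ xs)) (cong (𝟙 (p x) +_) (sym (count≡∑ p xs)))

-- Functions that satisfy the modular law are determined by unions of cliques

module ModularLaw where

  open import Data.Nat
  open import Data.Nat.Properties
  open import Data.Integer as ℤ using (ℤ; 0ℤ)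
  import Data.Integer.Properties as ℤ
  import Data.Integer.Tactic.RingSolver as ℤSolver
  open import Data.Bool using (true; false; if_then_else_)
  open import Data.Sum using (_⊎_; inj₁; inj₂; [_,_]′)
  open import Data.Product using (_×_; _,_; proj₁; proj₂)
  open import Data.List using (List; []; _∷_; _∷ʳ_)
  open import Data.List.Relation.Unary.All using (All; []; _∷_)
  open import Data.List.Relation.Unary.All.Properties using (∷ʳ⁺)
  open import Data.List.Relation.Binary.Permutation.Propositional as Perm using (_↭_)
  open import Data.Nat.ListAction using (sum)
  open import Data.Nat.ListAction.Properties using (sum-↭; sum-++)
  open import Relation.Nullary using (yes; no; does; contradiction)
  open import Relation.Nullary.Decidable using (_×-dec_; dec-true; dec-false)
  open import Relation.Binary.PropositionalEquality hiding ([_])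
  open import Relation.Binary.Definitions using (tri<; tri≈; tri>)

  -- The q-integer 1 + q + ... + q^(k-1).
  [_]_ : ℕ → ℕ → ℕ
  [ zero  ] q = 0
  [ suc k ] q = [ k ] q + q ^ k

  []-mono-< : ∀ {q} .{{_ : NonZero q}} {r s} → r < s → [ r ] q < [ s ] q
  []-mono-< {q} {r} {suc s} (s≤s r≤s) with m≤n⇒m<n∨m≡n r≤s
  ... | inj₁ r<s  = <-≤-trans ([]-mono-< r<s) (m≤m+n _ _)
  ... | inj₂ refl = m<m+n ([ s ] q) (m^n>0 q s)

  []-nonZero : ∀ {q} .{{_ : NonZero q}} k → [ suc k ] q ≢ 0
  []-nonZero k eq = <⇒≢ ([]-mono-< {r = 0} {suc k} z<s) (sym eq)

  abstract
    -- Sealed, so that all reasoning about changed row ends goes through the position of `k`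
    -- relative to the rows `a`, ..., `b - 1`.
    put : (ℕ → ℕ) → (a b v : ℕ) → ℕ → ℕ
    put h a b v k = if does ((a ≤? k) ×-dec (k <? b)) then v else h k

    put-in : ∀ {h a b v k} → a ≤ k → k < b → put h a b v k ≡ v
    put-in {a = a} {b} {k = k} p r rewrite dec-true ((a ≤? k) ×-dec (k <? b)) (p , r) = refl

    put-below : ∀ {h a b v k} → k < a → put h a b v k ≡ h k
    put-below {a = a} {b} {k = k} p
      rewrite dec-false ((a ≤? k) ×-dec (k <? b)) (λ z → <⇒≱ p (proj₁ z)) = refl

    put-above : ∀ {h a b v k} → b ≤ k → put h a b v k ≡ h k
    put-above {a = a} {b} {k = k} p
      rewrite dec-false ((a ≤? k) ×-dec (k <? b)) (λ z → <⇒≱ (proj₂ z) p) = refl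

    put-≤ : ∀ {h a b v k m} → v ≤ m → h k ≤ m → put h a b v k ≤ m
    put-≤ {a = a} {b} {k = k} v≤ h≤ with does ((a ≤? k) ×-dec (k <? b))
    ... | true  = v≤
    ... | false = h≤

  infix 4 _≗[_]_
  _≗[_]_ : (ℕ → ℕ) → ℕ → (ℕ → ℕ) → Set
  h ≗[ n ] h′ = ∀ k → k < n → h k ≡ h′ k

  -- Row i is adjacent to the columns c with i < c < h i, i.e. h i = m(i) + 1 for
  -- 0-indexed m; in terms of flags the condition is T V_{i+1} ⊆ V_{h i}.
  record IsHess (n : ℕ) (h : ℕ → ℕ) : Set where
    field
      above : ∀ {k} → k < n → k < h k
      bound : ∀ {k} → k < n → h k ≤ n
      mono  : ∀ {j k} → j ≤ k → k < n → h j ≤ h k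

  -- The two configurations of the modular law of Abreu and Nigro: either the end of a single
  -- row i moves from p to p + 2, or column c absorbs the two rows i and i + 1.
  record RowMove (n : ℕ) (h₀ h₁ h₂ : ℕ → ℕ) (i p : ℕ) : Set where
    field
      i<p    : i < p
      p+1<n  : suc p < n
      bound  : ∀ k → k < n → h₀ k ≤ n
      off₁   : ∀ k → k < n → k ≢ i → h₁ k ≡ h₀ k
      off₂   : ∀ k → k < n → k ≢ i → h₂ k ≡ h₀ k
      at₀    : h₀ i ≡ p
      at₁    : h₁ i ≡ suc p
      at₂    : h₂ i ≡ suc (suc p)
      -- With `after`, no row other than `i` ends at `suc p`. Hence V_(p+1) is the target of no
      -- other condition, and by `level` the vertices `p` and `suc p` have the same neighbours apart
      -- from each other and from `i`.
      before : ∀ k → k < i → h₀ k ≤ p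
      after  : ∀ k → i < k → k < n → suc (suc p) ≤ h₀ k
      level  : h₀ p ≡ h₀ (suc p)

  record ColMove (n : ℕ) (h₀ h₁ h₂ : ℕ → ℕ) (i c : ℕ) : Set where
    field
      i+1<c  : suc i < c
      c<n    : c < n
      bound  : ∀ k → k < n → h₀ k ≤ n
      off₁   : ∀ k → k < n → k ≢ i → k ≢ suc i → h₁ k ≡ h₀ k
      off₂   : ∀ k → k < n → k ≢ i → k ≢ suc i → h₂ k ≡ h₀ k
      at₀    : h₀ i ≡ c × h₀ (suc i) ≡ c
      at₁    : h₁ i ≡ c × h₁ (suc i) ≡ suc c
      at₂    : h₂ i ≡ suc c × h₂ (suc i) ≡ suc c
      -- Since no earlier row ends at `suc i`, the subspace V_(i+1) is the target of no condition,
      -- and an earlier vertex is adjacent to both of `i` and `suc i` or to neither.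
      before : ∀ k → k < i → h₀ k ≤ c × h₀ k ≢ suc i
      after  : ∀ k → suc i < k → k < n → suc c ≤ h₀ k

  data Move (n : ℕ) (h₀ h₁ h₂ : ℕ → ℕ) : Set where
    row : ∀ {i p} → RowMove n h₀ h₁ h₂ i p → Move n h₀ h₁ h₂
    col : ∀ {i c} → ColMove n h₀ h₁ h₂ i c → Move n h₀ h₁ h₂

  record Modular (n q : ℕ) (f : (ℕ → ℕ) → ℤ) : Set where
    field
      ext  : ∀ {h h′} → h ≗[ n ] h′ → f h ≡ f h′
      move : ∀ {h₀ h₁ h₂} → Move n h₀ h₁ h₂ → (ℤ.1ℤ ℤ.+ ℤ.+ q) ℤ.* f h₁ ≡ ℤ.+ q ℤ.* f h₀ ℤ.+ f h₂

  -- The law says that the difference of consecutive values is multiplied by q at each step, so the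
  -- total increment is the first one times 1 + q + ... + q^(s-1).
  geometric : ∀ q (F : ℕ → ℤ) s →
    (∀ t → suc (suc t) ≤ s → (ℤ.1ℤ ℤ.+ ℤ.+ q) ℤ.* F (suc t) ≡ ℤ.+ q ℤ.* F t ℤ.+ F (suc (suc t))) →
    F s ℤ.- F 0 ≡ ℤ.+ ([ s ] q) ℤ.* (F 1 ℤ.- F 0)
  geometric q F zero    _   = ℤ.+-inverseʳ (F 0)
  geometric q F (suc s) rec = begin
    F (suc s) ℤ.- F 0                                     ≡⟨ split (F (suc s)) (F s) (F 0) ⟩
    (F s ℤ.- F 0) ℤ.+ (F (suc s) ℤ.- F s)
      ≡⟨ cong₂ ℤ._+_ (geometric q F s (λ t le → rec t (m≤n⇒m≤1+n le))) (ratio s ≤-refl) ⟩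
    ℤ.+ ([ s ] q) ℤ.* δ ℤ.+ ℤ.+ (q ^ s) ℤ.* δ             ≡⟨ ℤ.*-distribʳ-+ δ (ℤ.+ ([ s ] q)) (ℤ.+ (q ^ s)) ⟨
    ℤ.+ ([ suc s ] q) ℤ.* δ                               ∎
    where
    open ≡-Reasoning
    δ = F 1 ℤ.- F 0
    split : ∀ a b c → a ℤ.- c ≡ (b ℤ.- c) ℤ.+ (a ℤ.- b)
    split = ℤSolver.solve-∀
    solveStep : ∀ x a b → (ℤ.1ℤ ℤ.+ x) ℤ.* b ℤ.- (x ℤ.* a) ℤ.- b ≡ x ℤ.* (b ℤ.- a)
    solveStep = ℤSolver.solve-∀
    cancelStep : ∀ y b c → (y ℤ.+ c) ℤ.- y ℤ.- b ≡ c ℤ.- b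
    cancelStep = ℤSolver.solve-∀
    ratio : ∀ t → t ≤ s → F (suc t) ℤ.- F t ≡ ℤ.+ (q ^ t) ℤ.* δ
    ratio zero    _  = sym (ℤ.*-identityˡ δ)
    ratio (suc t) le = begin
      F (suc (suc t)) ℤ.- F (suc t)                                      ≡⟨ cancelStep (ℤ.+ q ℤ.* F t) _ _ ⟨
      (ℤ.+ q ℤ.* F t ℤ.+ F (suc (suc t))) ℤ.- ℤ.+ q ℤ.* F t ℤ.- F (suc t)
        ≡⟨ cong (λ z → z ℤ.- ℤ.+ q ℤ.* F t ℤ.- F (suc t)) (rec t (s≤s le)) ⟨
      (ℤ.1ℤ ℤ.+ ℤ.+ q) ℤ.* F (suc t) ℤ.- ℤ.+ q ℤ.* F t ℤ.- F (suc t)       ≡⟨ solveStep (ℤ.+ q) (F t) (F (suc t)) ⟩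
      ℤ.+ q ℤ.* (F (suc t) ℤ.- F t)                                       ≡⟨ cong (ℤ.+ q ℤ.*_) (ratio t (<⇒≤ le)) ⟩
      ℤ.+ q ℤ.* (ℤ.+ (q ^ t) ℤ.* δ)                                       ≡⟨ ℤ.*-assoc (ℤ.+ q) _ δ ⟨
      (ℤ.+ q ℤ.* ℤ.+ (q ^ t)) ℤ.* δ                                       ≡⟨ cong (ℤ._* δ) (ℤ.pos-* q (q ^ t)) ⟨
      ℤ.+ (q ^ suc t) ℤ.* δ ∎

  put-isHess : ∀ {n h a b v} → IsHess n h → b ≤ v → v ≤ n →
    (∀ k → k < a → h k ≤ v) → (∀ k → b ≤ k → k < n → v ≤ h k) → IsHess n (put h a b v)
  put-isHess {n} {h} {a} {b} {v} H b≤v v≤n lo hi = record { above = above′ ; bound = bound′ ; mono = mono′ }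
    where
    open IsHess H
    data Region (k : ℕ) : Set where
      below  : k < a → put h a b v k ≡ h k → Region k
      inside : a ≤ k → k < b → put h a b v k ≡ v → Region k
      beyond : b ≤ k → put h a b v k ≡ h k → Region k
    region : ∀ k → Region k
    region k with a ≤? k | k <? b
    ... | no  a≰k | _       = below (≰⇒> a≰k) (put-below (≰⇒> a≰k))
    ... | yes a≤k | yes k<b = inside a≤k k<b (put-in a≤k k<b)
    ... | yes a≤k | no  k≮b = beyond (≮⇒≥ k≮b) (put-above (≮⇒≥ k≮b))
    above′ : ∀ {k} → k < n → k < put h a b v k
    above′ {k} k<n with region k
    ... | below  _ eq     = subst (k <_) (sym eq) (above k<n)
    ... | inside _ k<b eq = subst (k <_) (sym eq) (<-≤-trans k<b b≤v)
    ... | beyond _ eq     = subst (k <_) (sym eq) (above k<n)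
    bound′ : ∀ {k} → k < n → put h a b v k ≤ n
    bound′ {k} k<n with region k
    ... | below  _ eq     = subst (_≤ n) (sym eq) (bound k<n)
    ... | inside _ k<b eq = subst (_≤ n) (sym eq) v≤n
    ... | beyond _ eq     = subst (_≤ n) (sym eq) (bound k<n)
    mono′ : ∀ {j k} → j ≤ k → k < n → put h a b v j ≤ put h a b v k
    mono′ {j} {k} j≤k k<n with region j | region k
    ... | below _ e     | below _ e′       = subst₂ _≤_ (sym e) (sym e′) (mono j≤k k<n)
    ... | below j<a e   | inside _ _ e′    = subst₂ _≤_ (sym e) (sym e′) (lo j j<a)
    ... | below _ e     | beyond _ e′      = subst₂ _≤_ (sym e) (sym e′) (mono j≤k k<n)
    ... | inside a≤j _ e | below k<a e′    = contradiction (≤-trans a≤j j≤k) (<⇒≱ k<a)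
    ... | inside _ _ e  | inside _ _ e′    = subst₂ _≤_ (sym e) (sym e′) ≤-refl
    ... | inside _ _ e  | beyond b≤k e′    = subst₂ _≤_ (sym e) (sym e′) (hi k b≤k k<n)
    ... | beyond _ e    | below _ e′       = subst₂ _≤_ (sym e) (sym e′) (mono j≤k k<n)
    ... | beyond b≤j e  | inside _ k<b e′  = contradiction (≤-trans b≤j j≤k) (<⇒≱ k<b)
    ... | beyond _ e    | beyond _ e′      = subst₂ _≤_ (sym e) (sym e′) (mono j≤k k<n)

  -- Consecutive cliques of the given sizes, starting with row u.
  cliques : (ℕ → ℕ) → ℕ → List ℕ → ℕ → ℕ
  cliques h u []      = h
  cliques h u (x ∷ α) = cliques (put h u (u + x) (u + x)) (u + x) α

  -- The invariant under which `cliques` appends a block: the first `u` rows already form a graph of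
  -- their own, without edges to later vertices.
  record Low (h : ℕ → ℕ) (u : ℕ) : Set where
    field
      above : ∀ {k} → k < u → k < h k
      bound : ∀ {k} → k < u → h k ≤ u
      mono  : ∀ {j k} → j ≤ k → k < u → h j ≤ h k

  low-put : ∀ {h u} x → Low h u → Low (put h u (u + x) (u + x)) (u + x)
  low-put {h} {u} x L = record
    { above = λ {k} k<v → [ (λ k<u → subst (k <_) (sym (put-below k<u)) (L.above k<u))
                          , (λ u≤k → subst (k <_) (sym (put-in u≤k k<v)) k<v) ]′ (<-≤-connex k u)
    ; bound = bound′
    ; mono  = λ {j} {k} j≤k k<v →
        [ (λ k<u → subst₂ _≤_ (sym (put-below (≤-<-trans j≤k k<u))) (sym (put-below k<u)) (L.mono j≤k k<u))
        , (λ u≤k → subst (_ ≤_) (sym (put-in u≤k k<v)) (bound′ (≤-<-trans j≤k k<v))) ]′ (<-≤-connex k u) }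
    where
    module L = Low L
    bound′ : ∀ {k} → k < u + x → put h u (u + x) (u + x) k ≤ u + x
    bound′ {k} k<v = [ (λ k<u → subst (_≤ u + x) (sym (put-below k<u)) (≤-trans (L.bound k<u) (m≤m+n u x)))
                     , (λ u≤k → ≤-reflexive (put-in u≤k k<v)) ]′ (<-≤-connex k u)

  low⇒isHess : ∀ {n h} → Low h n → IsHess n h
  low⇒isHess L = record { Low L }

  low-cliques : ∀ {h u} α → Low h u → Low (cliques h u α) (u + sum α)
  low-cliques {u = u} []      L = subst (Low _) (sym (+-identityʳ u)) L
  low-cliques {u = u} (x ∷ α) L = subst (Low _) (+-assoc u x (sum α)) (low-cliques α (low-put x L))

  cliques-below : ∀ {h u} α {k} → k < u → cliques h u α k ≡ h k
  cliques-below []      _   = refl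
  cliques-below (x ∷ α) k<u = trans (cliques-below α (<-≤-trans k<u (m≤m+n _ x))) (put-below k<u)

  cliques-cong : ∀ {h h′ u} α {k} → (k < u → h k ≡ h′ k) → k < u + sum α → cliques h u α k ≡ cliques h′ u α k
  cliques-cong {u = u} []      {k} e k<u = e (subst (k <_) (+-identityʳ u) k<u)
  cliques-cong {h} {h′} {u} (x ∷ α) {k} e k<s = cliques-cong α
    (λ k<v → [ (λ k<u → trans (put-below k<u) (trans (e k<u) (sym (put-below k<u))))
             , (λ u≤k → trans (put-in u≤k k<v) (sym (put-in u≤k k<v))) ]′ (<-≤-connex k u))
    (subst (k <_) (sym (+-assoc u x (sum α))) k<s)

  cliques-∷ʳ : ∀ h u α x → cliques h u (α ∷ʳ x) ≡ put (cliques h u α) (u + sum α) (u + sum α + x) (u + sum α + x)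
  cliques-∷ʳ h u []      x rewrite +-identityʳ u = refl
  cliques-∷ʳ h u (y ∷ α) x rewrite cliques-∷ʳ (put h u (u + y) (u + y)) (u + y) α x | +-assoc u y (sum α) = refl

  -- Unions of cliques are built on `suc`, the Hessenberg function of the edgeless graph.
  low-suc : Low suc 0
  low-suc = record { above = λ () ; bound = λ () ; mono = λ _ () }

  module Reduction {n q : ℕ} .{{q≢0 : NonZero q}} {f : (ℕ → ℕ) → ℤ} (law : Modular n q f) where
    open Modular law

    -- Rows u, …, u + r′ - 1 of h end at d and row r = u + r′ ends at d + s + 1: the row law moves
    -- the end of row r through [d , d + s + 1], the column law lets column d absorb the rows above r.
    corner : ∀ {h} u r′ d s → let r = u + r′ in IsHess n h → r < d → d + suc s ≤ n →
      h r ≡ d + suc s → (∀ k → u ≤ k → k < r → h k ≡ d) →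
      (∀ k → d ≤ k → k < d + suc s → h k ≡ h d) →
      (∀ k → k < u → h k ≤ d × (h k ≤ u ⊎ suc r ≤ h k)) →
      ℤ.+ ([ suc r′ ] q) ℤ.* (f h ℤ.- f (put h r (suc r) d)) ≡
      ℤ.+ ([ suc s ] q) ℤ.* (f (put h u (suc r) (suc d)) ℤ.- f (put h r (suc r) d))
    corner {h} u r′ d s H r<d x≤n hr≡x flat const low = begin
      -- `F` and `G` follow the row law and the column law. They start at the same value and have
      -- the same first increment, which is eliminated from the two geometric sums.
      w ℤ.* (f h ℤ.- f (put h r (suc r) d))  ≡⟨ cong₂ (λ y z → w ℤ.* (y ℤ.- z)) F-end F-zero ⟨
      w ℤ.* (F (suc s) ℤ.- F 0)              ≡⟨ cong (w ℤ.*_) (geometric q F (suc s) rowStep) ⟩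
      w ℤ.* (σ ℤ.* (F 1 ℤ.- F 0))            ≡⟨ shuffle w σ _ ⟩
      σ ℤ.* (w ℤ.* (F 1 ℤ.- F 0))            ≡⟨ cong₂ (λ y z → σ ℤ.* (w ℤ.* (y ℤ.- z))) G-one G-zero ⟨
      σ ℤ.* (w ℤ.* (G 1 ℤ.- G 0))            ≡⟨ cong (σ ℤ.*_) (geometric q G (suc r′) colStep) ⟨
      σ ℤ.* (G (suc r′) ℤ.- G 0)             ≡⟨ cong₂ (λ y z → σ ℤ.* (y ℤ.- z)) G-end (trans G-zero F-zero) ⟩
      σ ℤ.* (f (put h u (suc r) (suc d)) ℤ.- f (put h r (suc r) d)) ∎
      where
      open ≡-Reasoning
      open IsHess H
      r = u + r′
      w = ℤ.+ ([ suc r′ ] q)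
      σ = ℤ.+ ([ suc s ] q)
      u≤r : u ≤ r
      u≤r = m≤m+n u r′
      d<x : d < d + suc s
      d<x = m<m+n d z<s
      r<n : r < n
      r<n = <-≤-trans r<d (≤-trans (<⇒≤ d<x) x≤n)
      shuffle : ∀ a b c → a ℤ.* (b ℤ.* c) ≡ b ℤ.* (a ℤ.* c)
      shuffle = ℤSolver.solve-∀
      fR : ℕ → ℕ → ℕ
      fR t = put h r (suc r) (d + t)
      F : ℕ → ℤ
      F t = f (fR t)
      fC : ℕ → ℕ → ℕ
      fC t = put (fR 0) (suc r ∸ t) (suc r) (suc d)
      G : ℕ → ℤ
      G t = f (fC t)
      fR-r : ∀ {t} → fR t r ≡ d + t
      fR-r = put-in ≤-refl ≤-refl
      fR-other : ∀ {t} k → k ≢ r → fR t k ≡ h k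
      fR-other k k≢r with <-cmp k r
      ... | tri< k<r _ _ = put-below k<r
      ... | tri≈ _ k≡r _ = contradiction k≡r k≢r
      ... | tri> _ _ r<k = put-above r<k
      F-zero : F 0 ≡ f (put h r (suc r) d)
      F-zero = cong (λ z → f (put h r (suc r) z)) (+-identityʳ d)
      F-end : F (suc s) ≡ f h
      F-end = ext λ k _ → lem k
        where
        lem : ∀ k → fR (suc s) k ≡ h k
        lem k with k ≟ r
        ... | yes refl = trans fR-r (sym hr≡x)
        ... | no  k≢r  = fR-other k k≢r
      G-zero : G 0 ≡ F 0
      G-zero = ext λ k _ → lem k
        where
        lem : ∀ k → fC 0 k ≡ fR 0 k
        lem k with k <? suc r
        ... | yes k<r = put-below k<r
        ... | no  k≮r = put-above (≮⇒≥ k≮r)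
      G-one : G 1 ≡ F 1
      G-one = ext λ k _ → lem k
        where
        lem : ∀ k → fC 1 k ≡ fR 1 k
        lem k with <-cmp k r
        ... | tri< k<r k≢r _  = trans (put-below k<r) (trans (fR-other k k≢r) (sym (fR-other k k≢r)))
        ... | tri≈ _ refl _ = trans (put-in ≤-refl ≤-refl) (trans (sym (+-comm d 1)) (sym fR-r))
        ... | tri> _ k≢r r<k  = trans (put-above r<k) (trans (fR-other k k≢r) (sym (fR-other k k≢r)))
      top≡u : suc r ∸ suc r′ ≡ u
      top≡u = m+n∸n≡m u r′
      G-end : G (suc r′) ≡ f (put h u (suc r) (suc d))
      G-end = ext λ k _ → lem k
        where
        lem : ∀ k → fC (suc r′) k ≡ put h u (suc r) (suc d) k
        lem k rewrite top≡u with u ≤? k | k <? suc r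
        ... | yes u≤k | yes k≤r = trans (put-in u≤k k≤r) (sym (put-in u≤k k≤r))
        ... | yes _   | no  k≰r = trans (put-above (≮⇒≥ k≰r)) (trans (fR-other k (λ { refl → k≰r ≤-refl }))
                                    (sym (put-above (≮⇒≥ k≰r))))
        ... | no  u≰k | _       = trans (put-below (≰⇒> u≰k)) (trans (fR-other k (λ { refl → u≰k u≤r }))
                                    (sym (put-below (≰⇒> u≰k))))
      below-r : ∀ k → k < r → h k ≤ d
      below-r k k<r with u ≤? k
      ... | yes u≤k = ≤-reflexive (flat k u≤k k<r)
      ... | no  u≰k = proj₁ (low k (≰⇒> u≰k))
      above-r : ∀ k → r < k → k < n → d + suc s ≤ h k
      above-r k r<k k<n = subst (_≤ h k) hr≡x (mono (<⇒≤ r<k) k<n)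
      rowStep : ∀ t → suc (suc t) ≤ suc s →
        (ℤ.1ℤ ℤ.+ ℤ.+ q) ℤ.* F (suc t) ≡ ℤ.+ q ℤ.* F t ℤ.+ F (suc (suc t))
      rowStep t le = move (row {i = r} {p = d + t} record
        { i<p    = <-≤-trans r<d (m≤m+n d t)
        ; p+1<n  = ≤-trans p+2≤x x≤n
        ; bound  = λ k k<n → put-≤ (≤-trans (≤-trans (n≤1+n _) (n≤1+n _)) (≤-trans p+2≤x x≤n)) (bound k<n)
        ; off₁   = λ k _ k≢r → trans (fR-other k k≢r) (sym (fR-other k k≢r))
        ; off₂   = λ k _ k≢r → trans (fR-other k k≢r) (sym (fR-other k k≢r))
        ; at₀    = fR-r
        ; at₁    = trans fR-r (+-suc d t)
        ; at₂    = trans fR-r (trans (+-suc d (suc t)) (cong suc (+-suc d t)))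
        ; before = λ k k<r → subst (_≤ d + t) (sym (fR-other k (<⇒≢ k<r))) (≤-trans (below-r k k<r) (m≤m+n d t))
        ; after  = λ k r<k k<n → subst (_ ≤_) (sym (fR-other k (>⇒≢ r<k))) (≤-trans p+2≤x (above-r k r<k k<n))
        ; level  = trans (flatAt (d + t) (m≤m+n d t) (<-trans (n<1+n _) p+2≤x))
                         (sym (flatAt (suc (d + t)) (m≤n⇒m≤1+n (m≤m+n d t)) p+2≤x)) })
        where
        p+2≤x : suc (suc (d + t)) ≤ d + suc s
        p+2≤x = subst (_≤ d + suc s) (trans (+-suc d (suc t)) (cong suc (+-suc d t))) (+-monoʳ-≤ d le)
        flatAt : ∀ k → d ≤ k → k < d + suc s → fR t k ≡ h d
        flatAt k d≤k k<x = trans (fR-other k (>⇒≢ (<-≤-trans r<d d≤k))) (const k d≤k k<x)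
      colStep : ∀ t → suc (suc t) ≤ suc r′ →
        (ℤ.1ℤ ℤ.+ ℤ.+ q) ℤ.* G (suc t) ≡ ℤ.+ q ℤ.* G t ℤ.+ G (suc (suc t))
      colStep t (s≤s t<r′) = move (col {i = i} {c = d} record
        { i+1<c  = i+1<d
        ; c<n    = <-≤-trans d<x x≤n
        ; bound  = λ k k<n → put-≤ (≤-trans d<x x≤n)
            (put-≤ (≤-trans (≤-reflexive (+-identityʳ d)) (≤-trans (<⇒≤ d<x) x≤n)) (bound k<n))
        ; off₁   = λ k _ k≢i k≢1+i → off (suc t) (inj₂ (inj₁ refl)) k k≢i k≢1+i
        ; off₂   = λ k _ k≢i k≢1+i → off (suc (suc t)) (inj₂ (inj₂ refl)) k k≢i k≢1+i
        ; at₀    = trans (put-below (subst (i <_) (sym top₀) (m<n⇒m<1+n (n<1+n i)))) (flat0 i u≤i (<⇒≤ i+1≤r))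
                 , trans (put-below (subst (suc i <_) (sym top₀) (n<1+n (suc i)))) (flat0 (suc i) (m≤n⇒m≤1+n u≤i) i+1≤r)
        ; at₁    = trans (put-below (subst (i <_) (sym top₁) (n<1+n i))) (flat0 i u≤i (<⇒≤ i+1≤r))
                 , put-in (≤-reflexive top₁) (s≤s i+1≤r)
        ; at₂    = put-in (≤-reflexive top₂) (s≤s (<⇒≤ i+1≤r))
                 , put-in (subst (_≤ suc i) (sym top₂) (n≤1+n i)) (s≤s i+1≤r)
        ; before = lo
        ; after  = hi })
        where
        -- This move concerns the rows `r - t - 1` and `r - t`: the rows are absorbed one by one,
        -- beginning with row `r` and ending with row `u`.
        i = u + (r′ ∸ suc t)
        u≤i : u ≤ i
        u≤i = m≤m+n u _
        i+t+1≡r : i + suc t ≡ r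
        i+t+1≡r = trans (+-assoc u _ (suc t)) (cong (u +_) (m∸n+n≡m t<r′))
        i+1≤r : suc i ≤ r
        i+1≤r = subst (suc i ≤_) (trans (sym (+-suc i t)) i+t+1≡r) (s≤s (m≤m+n i t))
        i+1<d : suc i < d
        i+1<d = ≤-<-trans i+1≤r r<d
        top₀ : suc r ∸ t ≡ suc (suc i)
        top₀ = trans (cong (λ z → suc z ∸ t) (trans (sym i+t+1≡r) (+-suc i t))) (m+n∸n≡m (suc (suc i)) t)
        top₁ : suc r ∸ suc t ≡ suc i
        top₁ = trans (cong (_∸ t) (trans (sym i+t+1≡r) (+-suc i t))) (m+n∸n≡m (suc i) t)
        top₂ : suc r ∸ suc (suc t) ≡ i
        top₂ = trans (cong (_∸ suc t) (sym i+t+1≡r)) (m+n∸n≡m i (suc t))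
        flat0 : ∀ k → u ≤ k → k ≤ r → fR 0 k ≡ d
        flat0 k u≤k k≤r with m≤n⇒m<n∨m≡n k≤r
        ... | inj₁ k<r = trans (fR-other k (<⇒≢ k<r)) (flat k u≤k k<r)
        ... | inj₂ refl = trans fR-r (+-identityʳ d)
        topOf : ∀ {t′} → t′ ≡ t ⊎ t′ ≡ suc t ⊎ t′ ≡ suc (suc t) → i ≤ suc r ∸ t′ × suc r ∸ t′ ≤ suc (suc i)
        topOf (inj₁ refl)        = subst (i ≤_) (sym top₀) (m≤n⇒m≤1+n (n≤1+n i)) , ≤-reflexive top₀
        topOf (inj₂ (inj₁ refl)) = subst (i ≤_) (sym top₁) (n≤1+n i) , ≤-trans (≤-reflexive top₁) (n≤1+n _)
        topOf (inj₂ (inj₂ refl)) = ≤-reflexive (sym top₂) , ≤-trans (≤-reflexive top₂) (m≤n⇒m≤1+n (n≤1+n i))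
        fC-lo : ∀ t′ → t′ ≡ t ⊎ t′ ≡ suc t ⊎ t′ ≡ suc (suc t) → ∀ k → k < i → fC t′ k ≡ fR 0 k
        fC-lo t′ e k k<i = put-below (<-≤-trans k<i (proj₁ (topOf e)))
        fC-hi : ∀ t′ → t′ ≡ t ⊎ t′ ≡ suc t ⊎ t′ ≡ suc (suc t) → ∀ k → suc i < k →
          (k ≤ r → fC t′ k ≡ suc d) × (r < k → fC t′ k ≡ h k)
        fC-hi t′ e k i+1<k =
          (λ k≤r → put-in (≤-trans (proj₂ (topOf e)) i+1<k) (s≤s k≤r)) ,
          (λ r<k → trans (put-above r<k) (fR-other k (>⇒≢ r<k)))
        off : ∀ t′ → t′ ≡ t ⊎ t′ ≡ suc t ⊎ t′ ≡ suc (suc t) → ∀ k → k ≢ i → k ≢ suc i → fC t′ k ≡ fC t k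
        off t′ e k k≢i k≢1+i with <-cmp k i
        ... | tri< k<i _ _ = trans (fC-lo t′ e k k<i) (sym (fC-lo t (inj₁ refl) k k<i))
        ... | tri≈ _ k≡i _ = contradiction k≡i k≢i
        ... | tri> _ _ i<k with k ≤? r | fC-hi t′ e k (≤∧≢⇒< i<k (≢-sym k≢1+i))
                                      | fC-hi t (inj₁ refl) k (≤∧≢⇒< i<k (≢-sym k≢1+i))
        ... | yes k≤r | a , _ | b , _ = trans (a k≤r) (sym (b k≤r))
        ... | no  k≰r | _ , a | _ , b = trans (a (≰⇒> k≰r)) (sym (b (≰⇒> k≰r)))
        -- Here `suc i` lies strictly between `u` and `suc r`, the range which the ends of the rows
        -- before `u` avoid by the hypothesis `low`.
        lo : ∀ k → k < i → fC t k ≤ d × fC t k ≢ suc i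
        lo k k<i rewrite fC-lo t (inj₁ refl) k k<i
                       | fR-other {0} k (<⇒≢ (<-trans k<i i+1≤r)) with u ≤? k
        ... | yes u≤k rewrite flat k u≤k (<-trans k<i i+1≤r) = ≤-refl , >⇒≢ i+1<d
        ... | no  u≰k with low k (≰⇒> u≰k)
        ... | hk≤d , inj₁ hk≤u = hk≤d , <⇒≢ (s≤s (≤-trans hk≤u u≤i))
        ... | hk≤d , inj₂ r<hk = hk≤d , >⇒≢ (≤-<-trans i+1≤r r<hk)
        hi : ∀ k → suc i < k → k < n → suc d ≤ fC t k
        hi k i+1<k k<n with k ≤? r
        ... | yes k≤r = ≤-reflexive (sym (proj₁ (fC-hi t (inj₁ refl) k i+1<k) k≤r))
        ... | no  k≰r = subst (suc d ≤_) (sym (proj₂ (fC-hi t (inj₁ refl) k i+1<k) (≰⇒> k≰r)))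
                          (≤-trans d<x (above-r k (≰⇒> k≰r) k<n))

    vanish-cancel : ∀ k {z} → ℤ.+ ([ suc k ] q) ℤ.* z ≡ 0ℤ → z ≡ 0ℤ
    vanish-cancel k eq with ℤ.i*j≡0⇒i≡0∨j≡0 (ℤ.+ ([ suc k ] q)) eq
    ... | inj₁ k≡0 = contradiction (ℤ.+-injective k≡0) ([]-nonZero k)
    ... | inj₂ z≡0 = z≡0

    -- The source of the hypothesis `low` of `corner`. It survives the induction, which never
    -- changes the rows before `u`.
    Gap : (ℕ → ℕ) → ℕ → ℕ → Set
    Gap h u e = ∀ k → k < u → h k ≤ u ⊎ e ≤ h k

    Flat : (ℕ → ℕ) → ℕ → ℕ → Set
    Flat h u e = ∀ k → u ≤ k → k < e → h k ≡ h u

    -- A reduction principle: to show that `f` vanishes at `h`, one may assume that the rows `u`,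
    -- ..., `e - 1` have equal ends, at the price of a possibly longer row `u`. The first `suc r′`
    -- of these rows are known to agree. The numbers `a`, `b` and `c` bound what is left of `n - u`,
    -- of `n - h u` and of the rows of the block not yet known to agree.
    Flattens : (a b c u e : ℕ) → Set
    Flattens a b c u e = ∀ r′ {h} → n ≤ u + a → n ≤ h u + b → e ≤ u + suc r′ + c → IsHess n h →
      u < e → e ≤ n → e ≤ h u → Gap h u e → (∀ k → u ≤ k → k < u + suc r′ → h k ≡ h u) →
      (∀ {h′} → IsHess n h′ → (∀ k → k < u → h′ k ≡ h k) → h u ≤ h′ u → Flat h′ u e → f h′ ≡ 0ℤ) →
      f h ≡ 0ℤ

    -- Row `r` is the first of the block to exceed `d = h u`, and it ends at `x`. The block lies
    -- before `d`, so the rows `d`, ..., `x - 1` can be flattened by `deep` without touching it.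
    -- Then `corner` applies and a nonzero multiple of `f h′` is expressed through two functions:
    -- `h₀`, where row `r` is cut down to `d` and the flat part has grown (`later`), and `h₁`, where
    -- the flat part and row `r` end at `suc d` (`raise`).
    advance : ∀ a b c u e → (∀ u′ e′ → Flattens a n n u′ e′) →
      Flattens (suc a) (suc b) c u e → Flattens (suc a) b e u e →
      ∀ r′ {h} → n ≤ u + suc a → n ≤ h u + suc b → e ≤ u + suc r′ + suc c → IsHess n h →
      u < e → e ≤ n → e ≤ h u → Gap h u e → (∀ k → u ≤ k → k < u + suc r′ → h k ≡ h u) →
      (∀ {h′} → IsHess n h′ → (∀ k → k < u → h′ k ≡ h k) → h u ≤ h′ u → Flat h′ u e → f h′ ≡ 0ℤ) →
      u + suc r′ < e → h u < h (u + suc r′) → f h ≡ 0ℤ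
    advance a b c u e deep later raise r′ {h} n≤u+a n≤d+b e≤r+c H u<e e≤n e≤d gap pre goal r<e d<hr =
      deep d x 0
        (≤-trans (subst (n ≤_) (+-suc u a) n≤u+a) (+-monoˡ-≤ a u<d))
        (m≤n+m n (h d)) (≤-trans x≤n (m≤n+m n _)) H
        d<hr x≤n x≤hd gap-d
        (λ k d≤k k<d+1 → cong h (≤-antisym (s≤s⁻¹ (subst (k <_) (+-comm d 1) k<d+1)) d≤k)) step
      where
      d = h u
      r = u + suc r′
      x = h r
      s = x ∸ suc d
      r<d : r < d
      r<d = <-≤-trans r<e e≤d
      u<r : u < r
      u<r = m<m+n u z<s
      r<n : r < n
      r<n = <-≤-trans r<e e≤n
      x≡ : x ≡ d + suc s
      x≡ = trans (sym (m+[n∸m]≡n d<hr)) (sym (+-suc d s))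
      u<d : u < d
      u<d = <-trans u<r r<d
      x≤n : x ≤ n
      x≤n = IsHess.bound H r<n
      x≤hd : x ≤ h d
      x≤hd = IsHess.mono H (<⇒≤ r<d) (<-≤-trans d<hr x≤n)
      gap-d : Gap h d x
      gap-d k k<d with <-≤-connex k r
      ... | inj₁ k<r = inj₁ (below k k<r)
        where
        below : ∀ k → k < r → h k ≤ d
        below k k<r with <-≤-connex k u
        ... | inj₁ k<u = IsHess.mono H (<⇒≤ k<u) (<-trans u<r r<n)
        ... | inj₂ u≤k = ≤-reflexive (pre k u≤k k<r)
      ... | inj₂ r≤k = inj₂ (IsHess.mono H r≤k (<-≤-trans k<d (<⇒≤ (<-≤-trans d<hr x≤n))))
      step : ∀ {h′} → IsHess n h′ → (∀ k → k < d → h′ k ≡ h k) → h d ≤ h′ d → Flat h′ d x → f h′ ≡ 0ℤ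
      step {h′} H′ agree _ flat = vanish-cancel (suc r′) (begin
        w ℤ.* f h′                       ≡⟨ cong (w ℤ.*_) (ℤ.+-identityʳ (f h′)) ⟨
        w ℤ.* (f h′ ℤ.- 0ℤ)              ≡⟨ cong (λ z → w ℤ.* (f h′ ℤ.- z)) F₀≡0 ⟨
        w ℤ.* (f h′ ℤ.- f h₀)
          ≡⟨ corner u (suc r′) d s H′ r<d (subst (_≤ n) x≡ x≤n) (trans (agree r r<d) x≡)
               (λ k u≤k k<r → trans (agree k (<-trans k<r r<d)) (pre k u≤k k<r))
               (λ k d≤k k<x → flat k d≤k (subst (k <_) (sym x≡) k<x)) low ⟩
        σ ℤ.* (f h₁ ℤ.- f h₀)            ≡⟨ cong₂ (λ y z → σ ℤ.* (y ℤ.- z)) F₁≡0 F₀≡0 ⟩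
        σ ℤ.* 0ℤ                         ≡⟨ ℤ.*-zeroʳ σ ⟩
        0ℤ                               ∎)
        where
        open ≡-Reasoning
        w = ℤ.+ ([ suc (suc r′) ] q)
        σ = ℤ.+ ([ suc s ] q)
        h₀ = put h′ r (suc r) d
        h₁ = put h′ u (suc r) (suc d)
        h′u≡d : h′ u ≡ d
        h′u≡d = agree u u<d
        agree-u : ∀ k → k < u → h′ k ≡ h k
        agree-u k k<u = agree k (<-trans k<u u<d)
        gap′ : Gap h′ u e
        gap′ k k<u rewrite agree-u k k<u = gap k k<u
        low-d : ∀ k → k < r → h′ k ≤ d
        low-d k k<r with <-≤-connex k u
        ... | inj₁ k<u = subst (h′ k ≤_) h′u≡d (IsHess.mono H′ (<⇒≤ k<u) (<-trans u<r r<n))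
        ... | inj₂ u≤k = ≤-reflexive (trans (agree k (<-trans k<r r<d)) (pre k u≤k k<r))
        low : ∀ k → k < u → h′ k ≤ d × (h′ k ≤ u ⊎ suc r ≤ h′ k)
        low k k<u = low-d k (<-trans k<u u<r) , [ inj₁ , (λ e≤ → inj₂ (≤-trans r<e e≤)) ]′ (gap′ k k<u)
        high : ∀ k → r < k → k < n → suc d ≤ h′ k
        high k r<k k<n = ≤-trans d<hr (subst (_≤ h′ k) (agree r r<d) (IsHess.mono H′ (<⇒≤ r<k) k<n))
        H₀ : IsHess n h₀
        H₀ = put-isHess H′ r<d (≤-trans (<⇒≤ d<hr) x≤n) low-d
               (λ k r<k k<n → ≤-trans (n≤1+n d) (high k r<k k<n))
        H₁ : IsHess n h₁
        H₁ = put-isHess H′ (≤-trans r<d (n≤1+n d)) (≤-trans d<hr x≤n)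
               (λ k k<u → m≤n⇒m≤1+n (low-d k (<-trans k<u u<r)))
               (λ k r<k k<n → high k r<k k<n)
        h₀u : h₀ u ≡ d
        h₀u = trans (put-below u<r) h′u≡d
        h₁u : h₁ u ≡ suc d
        h₁u = put-in ≤-refl (m<n⇒m<1+n u<r)
        F₀≡0 : f h₀ ≡ 0ℤ
        F₀≡0 = later (suc r′) n≤u+a
          (subst (λ z → n ≤ z + suc b) (sym h₀u) n≤d+b)
          (subst (e ≤_) (trans (+-suc _ c) (cong (_+ c) (sym (+-suc u (suc r′))))) e≤r+c)
          H₀ u<e e≤n (subst (e ≤_) (sym h₀u) e≤d)
          (λ k k<u → subst (λ z → z ≤ u ⊎ e ≤ z) (sym (put-below (<-trans k<u u<r))) (gap′ k k<u))
          pre₀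
          (λ H″ ag d≤ fl → goal H″ (λ k k<u → trans (ag k k<u) (trans (put-below (<-trans k<u u<r)) (agree-u k k<u)))
             (subst (_≤ _) h₀u d≤) fl)
          where
          pre₀ : ∀ k → u ≤ k → k < u + suc (suc r′) → h₀ k ≡ h₀ u
          pre₀ k u≤k k<r+1 with m≤n⇒m<n∨m≡n (s≤s⁻¹ (subst (k <_) (+-suc u (suc r′)) k<r+1))
          ... | inj₁ k<r  = trans (put-below k<r) (trans (trans (agree k (<-trans k<r r<d)) (pre k u≤k k<r)) (sym h₀u))
          ... | inj₂ refl = trans (put-in ≤-refl ≤-refl) (sym h₀u)
        F₁≡0 : f h₁ ≡ 0ℤ
        F₁≡0 = raise 0 n≤u+a
          (subst (λ z → n ≤ z + b) (sym h₁u) (subst (n ≤_) (+-suc d b) n≤d+b))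
          (m≤n+m e _) H₁ u<e e≤n (subst (e ≤_) (sym h₁u) (m≤n⇒m≤1+n e≤d))
          (λ k k<u → subst (λ z → z ≤ u ⊎ e ≤ z) (sym (put-below k<u)) (gap′ k k<u))
          (λ k u≤k k<u+1 → cong h₁ (≤-antisym (s≤s⁻¹ (subst (k <_) (+-comm u 1) k<u+1)) u≤k))
          (λ H″ ag d≤ fl → goal H″ (λ k k<u → trans (ag k k<u) (trans (put-below k<u) (agree-u k k<u)))
             (≤-trans (n≤1+n d) (subst (_≤ _) h₁u d≤)) fl)

    advanceOrSkip : ∀ a b c u e → (∀ u′ e′ → Flattens a n n u′ e′) →
      Flattens (suc a) (suc b) c u e → Flattens (suc a) b e u e → Flattens (suc a) (suc b) (suc c) u e
    advanceOrSkip a b c u e deep later raise r′ {h} n≤u+a n≤d+b e≤r+c H u<e e≤n e≤d gap pre goal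
      with <-≤-connex (u + suc r′) e
    ... | inj₂ e≤r = goal H (λ _ _ → refl) ≤-refl (λ k u≤k k<e → pre k u≤k (<-≤-trans k<e e≤r))
    ... | inj₁ r<e with m≤n⇒m<n∨m≡n (IsHess.mono H (m≤m+n u (suc r′)) (<-≤-trans r<e e≤n))
    ... | inj₁ d<hr = advance a b c u e deep later raise r′ n≤u+a n≤d+b e≤r+c H u<e e≤n e≤d gap pre goal r<e d<hr
    ... | inj₂ d≡hr = later (suc r′) n≤u+a n≤d+b
        (subst (e ≤_) (trans (+-suc _ c) (cong (_+ c) (sym (+-suc u (suc r′))))) e≤r+c)
        H u<e e≤n e≤d gap pre′ goal
      where
      pre′ : ∀ k → u ≤ k → k < u + suc (suc r′) → h k ≡ h u
      pre′ k u≤k k<r+1 with m≤n⇒m<n∨m≡n (s≤s⁻¹ (subst (k <_) (+-suc u (suc r′)) k<r+1))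
      ... | inj₁ k<r  = pre k u≤k k<r
      ... | inj₂ refl = sym d≡hr

    -- The induction is lexicographic: by the corner lemma, either row u or the first row of the
    -- block which exceeds it can be advanced, once the rows which the latter passes are flat.
    flatten : ∀ a b c u e → Flattens a b c u e
    -- Exhausted bounds are the base cases: `a = 0` is impossible as `u < n`, `c = 0` means that the
    -- block is flat, and `b = 0` that all its rows end at `n`.
    flatten zero b c u e r′ n≤u+a n≤d+b e≤r+c H u<e e≤n e≤d gap pre goal =
      contradiction (subst (n ≤_) (+-identityʳ u) n≤u+a) (<⇒≱ (<-≤-trans u<e e≤n))
    flatten (suc a) b zero u e r′ n≤u+a n≤d+b e≤r+c H u<e e≤n e≤d gap pre goal =
      goal H (λ _ _ → refl) ≤-refl (λ k u≤k k<e → pre k u≤k (<-≤-trans k<e (subst (e ≤_) (+-identityʳ _) e≤r+c)))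
    flatten (suc a) zero (suc c) u e r′ n≤u+a n≤d+b e≤r+c H u<e e≤n e≤d gap pre goal =
      goal H (λ _ _ → refl) ≤-refl λ k u≤k k<e → ≤-antisym
        (≤-trans (IsHess.bound H (<-≤-trans k<e e≤n)) (subst (n ≤_) (+-identityʳ _) n≤d+b))
        (IsHess.mono H u≤k (<-≤-trans k<e e≤n))
    flatten (suc a) (suc b) (suc c) u e =
      advanceOrSkip a b c u e (flatten a n n) (flatten (suc a) (suc b) c u e) (flatten (suc a) b e u e)

    -- Independence of the order of the cliques

    module Swap {h u w} (H : IsHess n h) (u≤w : u ≤ w) (w≤n : w ≤ n) (low : ∀ k → k < u → h k ≤ u) where

      -- A clique on the rows u, …, w - 1 from which the first r rows are cut down to v.
      shape : ℕ → ℕ → ℕ → ℕ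
      shape r v = put (put h u w w) u (u + r) v

      clique-hess : IsHess n (put h u w w)
      clique-hess = put-isHess H ≤-refl w≤n (λ k k<u → ≤-trans (low k k<u) u≤w)
        (λ k w≤k k<n → ≤-trans w≤k (<⇒≤ (IsHess.above H k<n)))

      clique-low : ∀ {v} k → k < u → u ≤ v → put h u w w k ≤ v
      clique-low k k<u u≤v = subst (_≤ _) (sym (put-below k<u)) (≤-trans (low k k<u) u≤v)

      clique-high : ∀ k → u ≤ k → k < n → w ≤ put h u w w k
      clique-high k u≤k k<n with <-≤-connex k w
      ... | inj₁ k<w = ≤-reflexive (sym (put-in u≤k k<w))
      ... | inj₂ w≤k = subst (w ≤_) (sym (put-above w≤k)) (≤-trans w≤k (<⇒≤ (IsHess.above H k<n)))

      shape-hess : ∀ {r v} → u + r ≤ v → v ≤ w → IsHess n (shape r v)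
      shape-hess {r} {v} r≤v v≤w = put-isHess clique-hess r≤v (≤-trans v≤w w≤n)
        (λ k k<u → clique-low k k<u (≤-trans (m≤m+n u r) r≤v))
        (λ k r≤k k<n → ≤-trans v≤w (clique-high k (≤-trans (m≤m+n u r) r≤k) k<n))

      -- The instance of `corner` that links the cliques from which a rectangle of edges of size r ×
      -- (s + 1), (r + 1) × (s + 1) or (r + 1) × s is missing.
      relation : ∀ {r s v} → v + suc s ≡ w → u + suc r ≤ v →
        ℤ.+ ([ suc r ] q) ℤ.* (f (shape r v) ℤ.- f (shape (suc r) v)) ≡
        ℤ.+ ([ suc s ] q) ℤ.* (f (shape (suc r) (suc v)) ℤ.- f (shape (suc r) v))
      relation {r} {s} {v} refl r<v = subst₂
        (λ y z → ℤ.+ ([ suc r ] q) ℤ.* (f (shape r v) ℤ.- y) ≡ ℤ.+ ([ suc s ] q) ℤ.* (z ℤ.- y))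
        (ext λ k _ → eq₀ k) (ext λ k _ → eq₁ k)
        (corner u r v s (shape-hess {r} {v} (<⇒≤ u+r<v) v≤w) u+r<v w≤n at-r
          (λ k u≤k k<r → put-in u≤k k<r)
          (λ k v≤k k<w → trans (flat k v≤k k<w) (sym (flat v ≤-refl (m<m+n v z<s))))
          (λ k k<u → subst (λ z → z ≤ v × (z ≤ u ⊎ suc (u + r) ≤ z))
             (sym (trans (put-below k<u) (put-below k<u)))
             (≤-trans (low k k<u) (≤-trans (m≤m+n u _) r<v) , inj₁ (low k k<u))))
        where
        u+r<v : u + r < v
        u+r<v = subst (_≤ v) (+-suc u r) r<v
        v≤w : v ≤ w
        v≤w = m≤m+n v (suc s)
        flat : ∀ k → v ≤ k → k < w → shape r v k ≡ w
        flat k v≤k k<w = trans (put-above (≤-trans (<⇒≤ u+r<v) v≤k))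
          (put-in (≤-trans (m≤m+n u r) (≤-trans (<⇒≤ u+r<v) v≤k)) k<w)
        at-r : shape r v (u + r) ≡ w
        at-r = trans (put-above ≤-refl) (put-in (m≤m+n u r) (<-≤-trans u+r<v v≤w))
        eq₀ : ∀ k → put (shape r v) (u + r) (suc (u + r)) v k ≡ shape (suc r) v k
        eq₀ k with <-≤-connex k (suc (u + r)) | <-≤-connex k (u + r) | <-≤-connex k u
        ... | inj₂ r<k | _ | _ = trans (put-above r<k) (trans (put-above (<⇒≤ r<k))
                           (sym (put-above (subst (_≤ k) (sym (+-suc u r)) r<k))))
        ... | inj₁ k≤r | inj₂ r≤k | _ = trans (put-in r≤k k≤r)
                           (sym (put-in (≤-trans (m≤m+n u r) r≤k) (subst (k <_) (sym (+-suc u r)) k≤r)))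
        ... | inj₁ k≤r | inj₁ k<r | inj₂ u≤k = trans (put-below k<r) (trans (put-in u≤k k<r)
                           (sym (put-in u≤k (subst (k <_) (sym (+-suc u r)) k≤r))))
        ... | inj₁ k≤r | inj₁ k<r | inj₁ k<u = trans (put-below k<r) (trans (put-below k<u) (sym (put-below k<u)))
        eq₁ : ∀ k → put (shape r v) u (suc (u + r)) (suc v) k ≡ shape (suc r) (suc v) k
        eq₁ k with <-≤-connex k (suc (u + r)) | <-≤-connex k u
        ... | inj₂ r<k | _ = trans (put-above r<k) (trans (put-above (<⇒≤ r<k))
                           (sym (put-above (subst (_≤ k) (sym (+-suc u r)) r<k))))
        ... | inj₁ k≤r | inj₂ u≤k = trans (put-in u≤k k≤r)
                           (sym (put-in u≤k (subst (k <_) (sym (+-suc u r)) k≤r)))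
        ... | inj₁ k≤r | inj₁ k<u = trans (put-below k<u) (trans (put-below k<u) (sym (put-below k<u)))

      shape-clique₁ : ∀ {v} → f (shape 0 v) ≡ f (put h u w w)
      shape-clique₁ = ext λ k _ → [ (λ k<u → put-below k<u)
        , (λ u≤k → put-above (subst (_≤ k) (sym (+-identityʳ u)) u≤k)) ]′ (<-≤-connex k u)

      shape-clique₂ : ∀ {r} → u + r ≤ w → f (shape r w) ≡ f (put h u w w)
      shape-clique₂ {r} r≤w = ext λ k _ → lem k
        where
        lem : ∀ k → shape r w k ≡ put h u w w k
        lem k with <-≤-connex k u | <-≤-connex k (u + r)
        ... | inj₁ k<u | _        = put-below k<u
        ... | inj₂ u≤k | inj₁ k<r = trans (put-in u≤k k<r) (sym (put-in u≤k (<-≤-trans k<r r≤w)))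
        ... | inj₂ _   | inj₂ r≤k = put-above r≤k

      -- A clique with an r × s rectangle of edges missing has the same value as its mirror image,
      -- which lacks an s × r rectangle. In the main case `relation` is used for both; the remaining
      -- shapes agree by induction, and eliminating them leaves (α - β)(X - Y) = 0. The q-integers α
      -- and β differ unless r = s, and then the two shapes coincide.
      shape-sym : ∀ r s {v v′} → v + s ≡ w → v′ + r ≡ w → u + r ≤ v → u + s ≤ v′ →
        f (shape r v) ≡ f (shape s v′)
      shape-sym zero s {v} {v′} _ v′≡w _ s≤v′ = trans shape-clique₁
        (sym (trans (cong (λ z → f (shape s z)) v′≡) (shape-clique₂ (subst (u + s ≤_) v′≡ s≤v′))))
        where
        v′≡ : v′ ≡ w
        v′≡ = trans (sym (+-identityʳ v′)) v′≡w
      shape-sym (suc r) zero {v} {v′} v≡w _ r≤v _ = trans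
        (trans (cong (λ z → f (shape (suc r) z)) v≡) (shape-clique₂ (subst (u + suc r ≤_) v≡ r≤v))) (sym shape-clique₁)
        where
        v≡ : v ≡ w
        v≡ = trans (sym (+-identityʳ v)) v≡w
      shape-sym (suc r) (suc s) {v} {v′} v+s v′+r r≤v s≤v′ with r ≟ s
      ... | yes refl = cong (λ z → f (shape (suc r) z)) (+-cancelʳ-≡ (suc r) v v′ (trans v+s (sym v′+r)))
      ... | no  r≢s  = [ (λ α≡β → contradiction (injective (ℤ.i-j≡0⇒i≡j α β α≡β)) r≢s) , ℤ.i-j≡0⇒i≡j X Y ]′
                         (ℤ.i*j≡0⇒i≡0∨j≡0 (α ℤ.- β) product)
        where
        X = f (shape (suc r) v)
        Y = f (shape (suc s) v′)
        P = f (shape r v)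
        Q = f (shape s v′)
        α = ℤ.+ ([ suc r ] q)
        β = ℤ.+ ([ suc s ] q)
        injective : α ≡ β → r ≡ s
        injective eq with <-cmp r s
        ... | tri< r<s _ _ = contradiction (ℤ.+-injective eq) (<⇒≢ ([]-mono-< (s≤s r<s)))
        ... | tri≈ _ r≡s _ = r≡s
        ... | tri> _ _ s<r = contradiction (ℤ.+-injective eq) (>⇒≢ ([]-mono-< (s≤s s<r)))
        expand : ∀ α β X Y P Q → (α ℤ.- β) ℤ.* (X ℤ.- Y) ≡
          (α ℤ.* (P ℤ.- Y) ℤ.- β ℤ.* (Q ℤ.- Y)) ℤ.- (α ℤ.* (P ℤ.- X) ℤ.- β ℤ.* (Q ℤ.- X))
        expand = ℤSolver.solve-∀
        P≡ : P ≡ f (shape (suc s) (suc v′))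
        P≡ = shape-sym r (suc s) v+s (trans (sym (+-suc v′ r)) v′+r)
               (≤-trans (+-monoʳ-≤ u (n≤1+n r)) r≤v) (m≤n⇒m≤1+n s≤v′)
        Q≡ : f (shape (suc r) (suc v)) ≡ Q
        Q≡ = shape-sym (suc r) s (trans (sym (+-suc v s)) v+s) v′+r (m≤n⇒m≤1+n r≤v)
               (≤-trans (+-monoʳ-≤ u (n≤1+n s)) s≤v′)
        product : (α ℤ.- β) ℤ.* (X ℤ.- Y) ≡ 0ℤ
        product = trans (expand α β X Y P Q) (cong₂ ℤ._-_
          (ℤ.i≡j⇒i-j≡0 (trans (cong (λ z → α ℤ.* (z ℤ.- Y)) P≡) (sym (relation v′+r s≤v′))))
          (ℤ.i≡j⇒i-j≡0 (trans (relation v+s r≤v) (cong (λ z → β ℤ.* (z ℤ.- X)) Q≡))))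

    -- Neighbouring cliques of sizes x and y form a clique of size x + y without the x × y rectangle
    -- between them, and exchanging them is taking the mirror image.
    cliques-swap : ∀ {h u} x y α → Low h u → u + sum (x ∷ y ∷ α) ≡ n →
      f (cliques h u (x ∷ y ∷ α)) ≡ f (cliques h u (y ∷ x ∷ α))
    cliques-swap {h} {u} x y α L total = begin
      f h₁                     ≡⟨ ext eq₁ ⟩
      f (S.shape x (u + x))    ≡⟨ S.shape-sym x y refl v′+x ≤-refl ≤-refl ⟩
      f (S.shape y (u + y))    ≡⟨ ext eq₂ ⟨
      f h₂                     ∎
      where
      open ≡-Reasoning
      w = u + x + y
      v′+x : u + y + x ≡ w
      v′+x = trans (+-assoc u y x) (trans (cong (u +_) (+-comm y x)) (sym (+-assoc u x y)))
      h₁ = cliques h u (x ∷ y ∷ α)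
      h₂ = cliques h u (y ∷ x ∷ α)
      total-w : w + sum α ≡ n
      total-w = trans (trans (+-assoc (u + x) y (sum α)) (+-assoc u x _)) total
      u≤w : u ≤ w
      u≤w = ≤-trans (m≤m+n u x) (m≤m+n _ y)
      w≤n : w ≤ n
      w≤n = subst (w ≤_) total-w (m≤m+n w _)
      H₁ : IsHess n h₁
      H₁ = low⇒isHess (subst (Low h₁) total (low-cliques (x ∷ y ∷ α) L))
      module S = Swap H₁ u≤w w≤n (λ k k<u → subst (_≤ u) (sym (cliques-below (x ∷ y ∷ α) k<u)) (Low.bound L k<u))
      eq₁ : h₁ ≗[ n ] S.shape x (u + x)
      eq₁ k _ with <-≤-connex k u | <-≤-connex k (u + x) | <-≤-connex k w
      ... | inj₁ k<u | _ | _ = sym (trans (put-below k<u) (put-below k<u))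
      ... | inj₂ u≤k | inj₁ k<x | _ = trans (cliques-below α (<-≤-trans k<x (m≤m+n _ y)))
              (trans (put-below k<x) (trans (put-in u≤k k<x) (sym (put-in u≤k k<x))))
      ... | inj₂ u≤k | inj₂ x≤k | inj₁ k<w = trans (cliques-below α k<w)
              (trans (put-in x≤k k<w) (sym (trans (put-above x≤k) (put-in u≤k k<w))))
      ... | inj₂ _ | inj₂ x≤k | inj₂ w≤k = sym (trans (put-above x≤k) (put-above w≤k))
      eq₂ : h₂ ≗[ n ] S.shape y (u + y)
      eq₂ k k<n with <-≤-connex k u | <-≤-connex k (u + y) | <-≤-connex k w
      ... | inj₁ k<u | _ | _ = trans (cliques-below (y ∷ x ∷ α) k<u)
              (trans (sym (cliques-below (x ∷ y ∷ α) k<u)) (sym (trans (put-below k<u) (put-below k<u))))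
      ... | inj₂ u≤k | inj₁ k<y | _ = trans (cliques-below α (<-≤-trans k<y (m≤m+n _ x)))
              (trans (put-below k<y) (trans (put-in u≤k k<y) (sym (put-in u≤k k<y))))
      ... | inj₂ u≤k | inj₂ y≤k | inj₁ k<w = trans (cliques-below α (subst (k <_) (sym v′+x) k<w))
              (trans (trans (put-in y≤k (subst (k <_) (sym v′+x) k<w)) v′+x) (sym (trans (put-above y≤k) (put-in u≤k k<w))))
      ... | inj₂ _ | inj₂ y≤k | inj₂ w≤k = trans
              (trans (cong (λ z → cliques (put (put h u (u + y) (u + y)) (u + y) z z) z α k) v′+x)
                     (cliques-cong α (λ k<w → contradiction w≤k (<⇒≱ k<w)) (subst (k <_) (sym total-w) k<n)))
              (sym (trans (put-above y≤k) (put-above w≤k)))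

    cliques-↭ : ∀ {α β} → α ↭ β → ∀ {h u} → Low h u → u + sum α ≡ n → f (cliques h u α) ≡ f (cliques h u β)
    cliques-↭ Perm.refl L total = refl
    cliques-↭ (Perm.prep x p) {u = u} L total = cliques-↭ p (low-put x L) (trans (+-assoc u x _) total)
    cliques-↭ (Perm.swap {xs} x y p) {u = u} L total = trans (cliques-swap x y xs L total)
      (cliques-↭ p (low-put x (low-put y L)) (trans (trans (+-assoc (u + y) x _) (+-assoc u y _)) total′))
      where
      total′ : u + (y + (x + sum xs)) ≡ n
      total′ = trans (cong (u +_) (trans (sym (+-assoc y x _)) (trans (cong (_+ sum xs) (+-comm y x)) (+-assoc x y _)))) total
    cliques-↭ (Perm.trans p p′) {u = u} L total =
      trans (cliques-↭ p L total) (cliques-↭ p′ L (trans (cong (u +_) (sym (sum-↭ p))) total))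

    module Vanish (base : ∀ α → All (1 ≤_) α → sum α ≡ n → f (cliques suc 0 α) ≡ 0ℤ) where

      -- `α` lists the cliques already split off, so the next row is `sum α`. The induction is on
      -- `a`, which bounds the number of remaining rows, and then on `b`, which bounds how much
      -- longer the next row can become.
      Vanishes : ℕ → ℕ → Set
      Vanishes a b = ∀ α {h} → IsHess n h → n ≤ sum α + a → n < h (sum α) + b → All (1 ≤_) α → sum α ≤ n →
        h ≗[ sum α ] cliques suc 0 α → f h ≡ 0ℤ

      -- After `flatten`, all rows of the next block end where row `u` does. If row `u` still ends
      -- at `e`, the block is a clique and joins `α`; otherwise row `u` has become longer and `b`
      -- decreases.
      step : ∀ a b → Vanishes a (suc n) → Vanishes (suc a) b → Vanishes (suc a) (suc b)
      step a b close raise α {h} H n≤u+a n<e+b pos u≤n agree with m≤n⇒m<n∨m≡n u≤n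
      ... | inj₂ u≡n = trans (ext (subst (h ≗[_] cliques suc 0 α) u≡n agree)) (base α pos u≡n)
      ... | inj₁ u<n = flatten n n e u e 0 (m≤n+m n u) (m≤n+m n e) (m≤n+m e _) H u<e (IsHess.bound H u<n) ≤-refl
          (λ k k<u → inj₁ (subst (_≤ u) (sym (agree k k<u)) (Low.bound (low-cliques α low-suc) k<u)))
          (λ k u≤k k<u+1 → cong h (≤-antisym (s≤s⁻¹ (subst (k <_) (+-comm u 1) k<u+1)) u≤k))
          next
        where
        u = sum α
        e = h u
        u<e : u < e
        u<e = IsHess.above H u<n
        x = e ∸ u
        u+x : u + x ≡ e
        u+x = m+[n∸m]≡n (<⇒≤ u<e)
        sum-∷ʳ : sum (α ∷ʳ x) ≡ e
        sum-∷ʳ = trans (sum-++ α (x ∷ [])) (trans (cong (u +_) (+-identityʳ x)) u+x)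
        next : ∀ {h′} → IsHess n h′ → (∀ k → k < u → h′ k ≡ h k) → e ≤ h′ u → Flat h′ u e → f h′ ≡ 0ℤ
        next {h′} H′ ag e≤ flat with m≤n⇒m<n∨m≡n e≤
        ... | inj₁ e< = raise α H′ n≤u+a
                          (≤-trans n<e+b (≤-trans (≤-reflexive (+-suc e b)) (+-monoˡ-≤ b e<))) pos u≤n
                          (λ k k<u → trans (ag k k<u) (agree k k<u))
        ... | inj₂ e≡ = close (α ∷ʳ x) H′
                          (subst (λ z → n ≤ z + a) (sym sum-∷ʳ)
                            (≤-trans n≤u+a (≤-trans (≤-reflexive (+-suc u a)) (+-monoˡ-≤ a u<e))))
                          (m≤n+m (suc n) _) (∷ʳ⁺ pos (m<n⇒0<n∸m u<e))
                          (subst (_≤ n) (sym sum-∷ʳ) (IsHess.bound H u<n))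
                          (subst (h′ ≗[_] cliques suc 0 (α ∷ʳ x)) (sym sum-∷ʳ) agree′)
          where
          agree′ : h′ ≗[ e ] cliques suc 0 (α ∷ʳ x)
          agree′ k k<e rewrite cliques-∷ʳ suc 0 α x | u+x with <-≤-connex k u
          ... | inj₁ k<u = trans (ag k k<u) (trans (agree k k<u) (sym (put-below k<u)))
          ... | inj₂ u≤k = trans (flat k u≤k k<e) (trans (sym e≡) (sym (put-in u≤k k<e)))

      vanishes : ∀ a b → Vanishes a b
      vanishes zero b α {h} H n≤u+a _ pos u≤n agree =
        trans (ext (subst (h ≗[_] cliques suc 0 α) u≡n agree)) (base α pos u≡n)
        where
        u≡n : sum α ≡ n
        u≡n = ≤-antisym u≤n (subst (n ≤_) (+-identityʳ _) n≤u+a)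
      vanishes (suc a) zero α {h} H _ n<e+b pos u≤n agree with m≤n⇒m<n∨m≡n u≤n
      ... | inj₁ u<n = contradiction (IsHess.bound H u<n) (<⇒≱ (subst (n <_) (+-identityʳ _) n<e+b))
      ... | inj₂ u≡n = trans (ext (subst (h ≗[_] cliques suc 0 α) u≡n agree)) (base α pos u≡n)
      vanishes (suc a) (suc b) = step a b (vanishes a (suc n)) (vanishes (suc a) b)

      vanish : ∀ {h} → IsHess n h → f h ≡ 0ℤ
      vanish {h} H = vanishes n (suc n) [] H ≤-refl (m≤n+m (suc n) _) [] z≤n (λ _ ())

-- The modular law for chromatic quasisymmetric functions

module ColouringLaw where

  open import Data.Nat
  open import Data.Nat.Properties
  open import Data.Nat.Tactic.RingSolver using (solve-∀)
  open import Data.Bool as Bool using (Bool; true; false; if_then_else_; _∧_)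
  open import Data.Bool.ListAction using (and)
  open import Data.List as List using (List; []; _∷_; upTo; length)
  open import Data.Vec as Vec using (Vec; []; _∷_)
  open import Data.Product using (_×_; _,_; proj₁; proj₂)
  open import Data.Sum using (_⊎_; inj₁; inj₂)
  open import Function using (_∘_)
  open import Relation.Nullary using (¬_; yes; no; does; contradiction)
  open import Relation.Nullary.Decidable using (⌊_⌋; dec-true; dec-false)
  open import Relation.Binary.PropositionalEquality hiding ([_])
  open import Relation.Binary.Definitions using (tri<; tri≈; tri>)
  open import Defs using (vecsOf; occ)
  open Sums
  open ModularLaw

  Graph : Set
  Graph = ℕ → ℕ → Bool

  graph : (ℕ → ℕ) → Graph
  graph h i j = does (j <? h i)

  -- The factor of an edge whose smaller vertex has colour `x` and whose larger vertex has colour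
  -- `y`: zero excludes improper colourings, and each ascent counts q.
  edge : ℕ → ℕ → ℕ → ℕ
  edge q x y = if does (x ≟ y) then 0 else if does (x <? y) then q else 1

  edge-≡ : ∀ q x → edge q x x ≡ 0
  edge-≡ q x rewrite dec-true (x ≟ x) refl = refl

  edge-< : ∀ q {x y} → x < y → edge q x y ≡ q
  edge-< q {x} {y} x<y rewrite dec-false (x ≟ y) (<⇒≢ x<y) | dec-true (x <? y) x<y = refl

  edge-> : ∀ q {x y} → y < x → edge q x y ≡ 1
  edge-> q {x} {y} y<x rewrite dec-false (x ≟ y) (>⇒≢ y<x) | dec-false (x <? y) (<-asym y<x) = refl

  pick : Bool → ℕ → ℕ
  pick b x = if b then x else 1

  module Weight (q : ℕ) where

    rowWeight : ∀ {n} → (ℕ → Bool) → ℕ → Vec ℕ n → ℕ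
    rowWeight P x []      = 1
    rowWeight P x (y ∷ κ) = pick (P 0) (edge q x y) * rowWeight (P ∘ suc) x κ

    -- The factor of a colouring κ: 0 if κ is not proper, and q ^ asc κ otherwise.
    weight : ∀ {n} → Graph → Vec ℕ n → ℕ
    weight E []      = 1
    weight E (x ∷ κ) = rowWeight (E 0 ∘ suc) x κ * weight (λ i j → E (suc i) (suc j)) κ

    rowWeight-cong : ∀ {n P P′} x (κ : Vec ℕ n) → (∀ j → j < n → P j ≡ P′ j) → rowWeight P x κ ≡ rowWeight P′ x κ
    rowWeight-cong x []      eq = refl
    rowWeight-cong x (y ∷ κ) eq =
      cong₂ _*_ (cong (λ b → pick b (edge q x y)) (eq 0 z<s)) (rowWeight-cong x κ (λ j j<n → eq (suc j) (s≤s j<n)))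

    weight-cong : ∀ {n E E′} (κ : Vec ℕ n) → (∀ i j → i < j → j < n → E i j ≡ E′ i j) → weight E κ ≡ weight E′ κ
    weight-cong []      eq = refl
    weight-cong (x ∷ κ) eq = cong₂ _*_ (rowWeight-cong x κ (λ j j<n → eq 0 (suc j) z<s (s≤s j<n)))
      (weight-cong κ (λ i j i<j j<n → eq (suc i) (suc j) (s≤s i<j) (s≤s j<n)))

    rowWeight-swap : ∀ {n} P x p (κ : Vec ℕ n) → P p ≡ P (suc p) → rowWeight P x (swapAt p κ) ≡ rowWeight P x κ
    rowWeight-swap P x zero    []          eq = refl
    rowWeight-swap P x zero    (y ∷ [])    eq = refl
    rowWeight-swap P x zero    (y ∷ z ∷ κ) eq rewrite eq = exchange (pick (P 1) (edge q x z)) (pick (P 1) (edge q x y)) _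
      where
      exchange : ∀ a b c → a * (b * c) ≡ b * (a * c)
      exchange = solve-∀
    rowWeight-swap P x (suc p) []          eq = refl
    rowWeight-swap P x (suc p) (y ∷ κ)     eq = cong (pick (P 0) (edge q x y) *_) (rowWeight-swap (P ∘ suc) x p κ eq)

    -- The vertices `p` and `suc p` are twins: not adjacent, with the same neighbours. Exchanging
    -- them preserves adjacency and, their numbers being consecutive, the order of the two ends of
    -- every edge, hence the ascents.
    weight-swap : ∀ {n} E p (κ : Vec ℕ n) → E p (suc p) ≡ false → (∀ k → k < p → E k p ≡ E k (suc p)) →
      (∀ k → suc p < k → k < n → E p k ≡ E (suc p) k) → weight E (swapAt p κ) ≡ weight E κ
    weight-swap E zero    []          _   _   _    = refl
    weight-swap E zero    (x ∷ [])    _   _   _    = refl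
    weight-swap E zero    (x ∷ y ∷ κ) off low high rewrite off = begin
      (rowWeight (E 0 ∘ suc ∘ suc) y κ + 0) * (rowWeight (E 1 ∘ suc ∘ suc) x κ * W)
        ≡⟨ cong₂ (λ a b → (a + 0) * (b * W)) (rowWeight-cong y κ same) (sym (rowWeight-cong x κ same)) ⟩
      (rowWeight (E 1 ∘ suc ∘ suc) y κ + 0) * (rowWeight (E 0 ∘ suc ∘ suc) x κ * W)
        ≡⟨ exchange (rowWeight (E 1 ∘ suc ∘ suc) y κ) (rowWeight (E 0 ∘ suc ∘ suc) x κ) W ⟩
      (rowWeight (E 0 ∘ suc ∘ suc) x κ + 0) * (rowWeight (E 1 ∘ suc ∘ suc) y κ * W) ∎
      where
      open ≡-Reasoning
      W = weight (λ i j → E (suc (suc i)) (suc (suc j))) κ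
      same : ∀ j → j < _ → E 0 (suc (suc j)) ≡ E 1 (suc (suc j))
      same j j<n = high (suc (suc j)) (s≤s (s≤s z≤n)) (s≤s (s≤s j<n))
      exchange : ∀ a b c → (a + 0) * (b * c) ≡ (b + 0) * (a * c)
      exchange = solve-∀
    weight-swap E (suc p) []      _   _   _    = refl
    weight-swap E (suc p) (x ∷ κ) off low high = cong₂ _*_
      (rowWeight-swap (E 0 ∘ suc) x p κ (low 0 z<s))
      (weight-swap _ p κ off (λ k k<p → low (suc k) (s≤s k<p)) (λ k p<k k<n → high (suc k) (s≤s p<k) (s≤s k<n)))

    -- 0 beyond the last vertex
    nth : ∀ {n} → Vec ℕ n → ℕ → ℕ
    nth []      _       = 0
    nth (x ∷ κ) zero    = x
    nth (x ∷ κ) (suc i) = nth κ i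

    rowWeight-add : ∀ {n} P P′ x b (κ : Vec ℕ n) → b < n → P b ≡ false → P′ b ≡ true →
      (∀ j → j < n → j ≢ b → P′ j ≡ P j) → rowWeight P′ x κ ≡ edge q x (nth κ b) * rowWeight P x κ
    rowWeight-add P P′ x zero    (y ∷ κ) _         off on eq rewrite off | on =
      cong (edge q x y *_) (trans (rowWeight-cong x κ (λ j j<n → eq (suc j) (s≤s j<n) (λ ()))) (sym (*-identityˡ _)))
    rowWeight-add P P′ x (suc b) (y ∷ κ) (s≤s b<n) off on eq
      rewrite eq 0 z<s (λ ())
            | rowWeight-add (P ∘ suc) (P′ ∘ suc) x b κ b<n off on (λ j j<n j≢b → eq (suc j) (s≤s j<n) (j≢b ∘ suc-injective)) =
      exchange (pick (P 0) (edge q x y)) (edge q x (nth κ b)) _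
      where
      exchange : ∀ a b c → a * (b * c) ≡ b * (a * c)
      exchange = solve-∀

    weight-add : ∀ {n} E E′ a b (κ : Vec ℕ n) → a < b → b < n → E a b ≡ false → E′ a b ≡ true →
      (∀ i j → i < j → j < n → ¬ (i ≡ a × j ≡ b) → E′ i j ≡ E i j) →
      weight E′ κ ≡ edge q (nth κ a) (nth κ b) * weight E κ
    weight-add E E′ zero    (suc b) (x ∷ κ) a<b (s≤s b<n) off on eq = begin
      rowWeight (E′ 0 ∘ suc) x κ * weight _ κ
        ≡⟨ cong₂ _*_ (rowWeight-add (E 0 ∘ suc) (E′ 0 ∘ suc) x b κ b<n off on
                        (λ j j<n j≢b → eq 0 (suc j) z<s (s≤s j<n) (λ ij → j≢b (suc-injective (proj₂ ij)))))
                     (weight-cong κ (λ i j i<j j<n → eq (suc i) (suc j) (s≤s i<j) (s≤s j<n) (λ ()))) ⟩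
      (edge q x (nth κ b) * rowWeight (E 0 ∘ suc) x κ) * weight _ κ
        ≡⟨ *-assoc (edge q x (nth κ b)) _ _ ⟩
      edge q x (nth κ b) * weight E (x ∷ κ) ∎
      where open ≡-Reasoning
    weight-add E E′ (suc a) (suc b) (x ∷ κ) (s≤s a<b) (s≤s b<n) off on eq
      rewrite rowWeight-cong x κ (λ j j<n → eq 0 (suc j) z<s (s≤s j<n) (λ ()))
            | weight-add (λ i j → E (suc i) (suc j)) (λ i j → E′ (suc i) (suc j)) a b κ a<b b<n off on
                (λ i j i<j j<n ij → eq (suc i) (suc j) (s≤s i<j) (s≤s j<n)
                  (λ z → ij (suc-injective (proj₁ z) , suc-injective (proj₂ z)))) =
      exchange (rowWeight (E 0 ∘ suc) x κ) (edge q (nth κ a) (nth κ b)) _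
      where
      exchange : ∀ a b c → a * (b * c) ≡ b * (a * c)
      exchange = solve-∀

    nth-swap : ∀ {n} p (κ : Vec ℕ n) → suc p < n → nth (swapAt p κ) p ≡ nth κ (suc p) × nth (swapAt p κ) (suc p) ≡ nth κ p
    nth-swap zero    (x ∷ y ∷ κ) _         = refl , refl
    nth-swap zero    (x ∷ [])    (s≤s ())
    nth-swap (suc p) (x ∷ κ)     (s≤s p<n) = nth-swap p κ p<n

    nth-swap-other : ∀ {n} p i (κ : Vec ℕ n) → i ≢ p → i ≢ suc p → nth (swapAt p κ) i ≡ nth κ i
    nth-swap-other zero    zero          κ           i≢p _ = contradiction refl i≢p
    nth-swap-other zero    (suc zero)    κ           _ i≢p = contradiction refl i≢p
    nth-swap-other zero    (suc (suc i)) []          _ _   = refl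
    nth-swap-other zero    (suc (suc i)) (x ∷ [])    _ _   = refl
    nth-swap-other zero    (suc (suc i)) (x ∷ y ∷ κ) _ _   = refl
    nth-swap-other (suc p) i             []          _ _   = refl
    nth-swap-other (suc p) zero          (x ∷ κ)     _ _   = refl
    nth-swap-other (suc p) (suc i)       (x ∷ κ)     a b   =
      nth-swap-other p i κ (a ∘ cong suc) (b ∘ cong suc)

    -- Exchanging two entries is a bijection on colourings, so the law may be checked on each
    -- colouring together with its exchanged version. Every sum then occurs twice, whence the
    -- cancelled factor 2.
    symmetrise : ∀ (xs : List ℕ) n p (g₀ g₁ g₂ : Vec ℕ n → ℕ) →
      (∀ κ → (1 + q) * (g₁ κ + g₁ (swapAt p κ)) ≡ q * (g₀ κ + g₀ (swapAt p κ)) + (g₂ κ + g₂ (swapAt p κ))) →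
      (1 + q) * ∑ (vecsOf xs n) g₁ ≡ q * ∑ (vecsOf xs n) g₀ + ∑ (vecsOf xs n) g₂
    symmetrise xs n p g₀ g₁ g₂ eq = *-cancelˡ-≡ _ _ 2 (begin
      2 * ((1 + q) * S g₁)                      ≡⟨ rearrange₁ (1 + q) (S g₁) ⟩
      (1 + q) * (2 * S g₁)                      ≡⟨ cong ((1 + q) *_) (double g₁) ⟨
      (1 + q) * S (sym₂ g₁)                     ≡⟨ ∑-*ˡ ks (1 + q) _ ⟨
      S (λ κ → (1 + q) * sym₂ g₁ κ)             ≡⟨ ∑-cong ks eq ⟩
      S (λ κ → q * sym₂ g₀ κ + sym₂ g₂ κ)       ≡⟨ ∑-+ ks _ _ ⟩
      S (λ κ → q * sym₂ g₀ κ) + S (sym₂ g₂)     ≡⟨ cong₂ _+_ (trans (∑-*ˡ ks q _) (cong (q *_) (double g₀))) (double g₂) ⟩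
      q * (2 * S g₀) + 2 * S g₂                 ≡⟨ rearrange₂ q (S g₀) (S g₂) ⟩
      2 * (q * S g₀ + S g₂)                     ∎)
      where
      open ≡-Reasoning
      ks = vecsOf xs n
      S : (Vec ℕ n → ℕ) → ℕ
      S = ∑ ks
      sym₂ : (Vec ℕ n → ℕ) → Vec ℕ n → ℕ
      sym₂ g κ = g κ + g (swapAt p κ)
      double : ∀ g → S (sym₂ g) ≡ 2 * S g
      double g = trans (∑-+ ks g _) (cong (S g +_) (trans (∑-swapAt xs n p g) (sym (+-identityʳ _))))
      rearrange₁ : ∀ a b → 2 * (a * b) ≡ a * (2 * b)
      rearrange₁ = solve-∀
      rearrange₂ : ∀ a b c → a * (2 * b) + 2 * c ≡ 2 * (a * b + c)
      rearrange₂ = solve-∀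

    -- With a = φ x and b = φ y, both sides differ by a multiple of (a - 1)(q - b).
    exchange-< : ∀ a b → a ≡ 1 ⊎ b ≡ q → (1 + q) * (a * q + b) ≡ q * (q + 1) + (q + 1) * (a * b)
    exchange-< a b (inj₁ refl) = lem q b
      where
      lem : ∀ q b → (1 + q) * (1 * q + b) ≡ q * (q + 1) + (q + 1) * (1 * b)
      lem = solve-∀
    exchange-< a b (inj₂ refl) = lem q a
      where
      lem : ∀ q a → (1 + q) * (a * q + q) ≡ q * (q + 1) + (q + 1) * (a * q)
      lem = solve-∀

    exchange-≡ : ∀ x y {e} a b → x ≡ y → e ≡ edge q x x → (1 + q) * (a * e + b * e) ≡ q * (e + e) + (a * b) * (e + e)
    exchange-≡ x y a b refl refl rewrite edge-≡ q x = lem q a b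
      where
      lem : ∀ q a b → (1 + q) * (a * 0 + b * 0) ≡ q * 0 + a * b * 0
      lem = solve-∀

    private
      normal₁ : ∀ q a b → q * (q + 1) + (q + 1) * (a * b) ≡ q * (q + 1) + (a * b) * (q + 1)
      normal₁ = solve-∀
      normal₂ : ∀ q a b → q * (q + 1) + (q + 1) * (b * a) ≡ q * (1 + q) + (a * b) * (1 + q)
      normal₂ = solve-∀
      normal₃ : ∀ q a b → (1 + q) * (a * 1 + b * q) ≡ (1 + q) * (b * q + a)
      normal₃ = solve-∀

    exchange : ∀ x y a b → (x < y → a ≡ 1 ⊎ b ≡ q) → (y < x → b ≡ 1 ⊎ a ≡ q) →
      (1 + q) * (a * edge q x y + b * edge q y x) ≡
      q * (edge q x y + edge q y x) + (a * b) * (edge q x y + edge q y x)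
    exchange x y a b lt gt with <-cmp x y
    ... | tri≈ _ refl _ = exchange-≡ x x a b refl refl
    ... | tri< x<y _ _ rewrite edge-< q x<y | edge-> q x<y | *-identityʳ b =
      trans (exchange-< a b (lt x<y)) (normal₁ q a b)
    ... | tri> _ _ y<x rewrite edge-< q y<x | edge-> q y<x =
      trans (normal₃ q a b) (trans (exchange-< b a (gt y<x)) (normal₂ q a b))

    -- The third vertex, of colour z, comes first. If x < y, either z < y and its edge to y is an
    -- ascent, or z ≥ y > x and its edge to x is a descent, so one of the two factors has the value
    -- that `exchange` asks for.
    exchange-row : ∀ x y z → (1 + q) * (edge q z x * edge q x y + edge q z y * edge q y x) ≡
      q * (edge q x y + edge q y x) + (edge q z x * edge q z y) * (edge q x y + edge q y x)
    exchange-row x y z = exchange x y _ _ (λ x<y → split x<y) (λ y<x → split y<x)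
      where
      split : ∀ {x y} → x < y → edge q z x ≡ 1 ⊎ edge q z y ≡ q
      split {x} {y} x<y with <-≤-connex z y
      ... | inj₁ z<y = inj₂ (edge-< q z<y)
      ... | inj₂ y≤z = inj₁ (edge-> q (<-≤-trans x<y y≤z))

    -- The third vertex comes last. If x < y, either x < z and the edge from x is an ascent, or z ≤
    -- x < y and the edge from y is a descent.
    exchange-col : ∀ x y z → (1 + q) * (edge q y z * edge q x y + edge q x z * edge q y x) ≡
      q * (edge q x y + edge q y x) + (edge q y z * edge q x z) * (edge q x y + edge q y x)
    exchange-col x y z = exchange x y _ _ (λ x<y → split x<y) (λ y<x → split y<x)
      where
      split : ∀ {x y} → x < y → edge q y z ≡ 1 ⊎ edge q x z ≡ q
      split {x} {y} x<y with <-≤-connex z x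
      ... | inj₁ z<x = inj₁ (edge-> q (<-trans z<x x<y))
      ... | inj₂ x≤z with m≤n⇒m<n∨m≡n x≤z
      ... | inj₁ x<z  = inj₂ (edge-< q x<z)
      ... | inj₂ refl = inj₁ (edge-> q x<y)

  content : ∀ {n} → Vec ℕ n → List ℕ → Bool
  content κ μ = and (List.zipWith (λ j μj → ⌊ occ κ j ≟ μj ⌋) (upTo (length μ)) μ)

  and-zipWith-cong : ∀ {f g : ℕ → ℕ → Bool} (xs ys : List ℕ) → (∀ x y → f x y ≡ g x y) →
    and (List.zipWith f xs ys) ≡ and (List.zipWith g xs ys)
  and-zipWith-cong []       _        eq = refl
  and-zipWith-cong (x ∷ xs) []       eq = refl
  and-zipWith-cong (x ∷ xs) (y ∷ ys) eq = cong₂ _∧_ (eq x y) (and-zipWith-cong xs ys eq)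

  content-swap : ∀ {n} p (κ : Vec ℕ n) μ → content (swapAt p κ) μ ≡ content κ μ
  content-swap p κ μ = and-zipWith-cong (upTo (length μ)) μ (λ j m → cong (λ z → ⌊ z ≟ m ⌋) (occ-swap j))
    where
    sum-swap : ∀ {n} p (κ : Vec ℕ n) (f : ℕ → ℕ) → ∑ (Vec.toList (swapAt p κ)) f ≡ ∑ (Vec.toList κ) f
    sum-swap zero    []          f = refl
    sum-swap zero    (x ∷ [])    f = refl
    sum-swap zero    (x ∷ y ∷ κ) f = comm (f y) (f x) _
      where
      comm : ∀ a b c → a + (b + c) ≡ b + (a + c)
      comm = solve-∀
    sum-swap (suc p) []          f = refl
    sum-swap (suc p) (x ∷ κ)     f = cong (f x +_) (sum-swap p κ f)
    occ-swap : ∀ j → occ (swapAt p κ) j ≡ occ κ j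
    occ-swap j = trans (count≡∑ _ (Vec.toList (swapAt p κ)))
      (trans (sum-swap p κ _) (sym (count≡∑ _ (Vec.toList κ))))

  module Chromatic (q n : ℕ) (μ : List ℕ) where
    open Weight q

    X : (ℕ → ℕ) → ℕ
    X h = ∑ (vecsOf (upTo (length μ)) n) (λ κ → 𝟙 (content κ μ) * weight (graph h) κ)

    X-ext : ∀ {h h′} → h ≗[ n ] h′ → X h ≡ X h′
    X-ext eq = ∑-cong (vecsOf (upTo (length μ)) n) λ κ → cong (𝟙 (content κ μ) *_)
      (weight-cong κ (λ i j i<j j<n → cong (λ z → does (j <? z)) (eq i (<-trans i<j j<n))))

    -- The colours of the adjacent vertices p and p + 1 are exchanged.  E is the graph without the
    -- edge {p , p + 1} and without its edges to the third vertex, which contribute a and b.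
    law : ∀ {h₀ h₁ h₂} p (E : Graph) (a b : Vec ℕ n → ℕ) → suc p < n →
      (∀ κ → weight E (swapAt p κ) ≡ weight E κ) →
      (∀ κ → weight (graph h₀) κ ≡ edge q (nth κ p) (nth κ (suc p)) * weight E κ) →
      (∀ κ → weight (graph h₁) κ ≡ a κ * weight (graph h₀) κ) →
      (∀ κ → weight (graph h₂) κ ≡ b κ * weight (graph h₁) κ) →
      (∀ κ → a (swapAt p κ) ≡ b κ) → (∀ κ → b (swapAt p κ) ≡ a κ) →
      (∀ κ → let e = edge q (nth κ p) (nth κ (suc p)); e′ = edge q (nth κ (suc p)) (nth κ p) in
        (1 + q) * (a κ * e + b κ * e′) ≡ q * (e + e′) + (a κ * b κ) * (e + e′)) →
      (1 + q) * X h₁ ≡ q * X h₀ + X h₂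
    law {h₀} {h₁} {h₂} p E a b p<n inv w₀ w₁ w₂ a-swap b-swap identity =
      symmetrise (upTo (length μ)) n p (term h₀) (term h₁) (term h₂) pointwise
      where
      term : (ℕ → ℕ) → Vec ℕ n → ℕ
      term h κ = 𝟙 (content κ μ) * weight (graph h) κ
      pointwise : ∀ κ → (1 + q) * (term h₁ κ + term h₁ (swapAt p κ)) ≡
        q * (term h₀ κ + term h₀ (swapAt p κ)) + (term h₂ κ + term h₂ (swapAt p κ))
      pointwise κ
        rewrite content-swap p κ μ
              | w₂ κ | w₂ (swapAt p κ) | w₁ κ | w₁ (swapAt p κ) | w₀ κ | w₀ (swapAt p κ)
              | proj₁ (nth-swap p κ p<n) | proj₂ (nth-swap p κ p<n)
              | inv κ | a-swap κ | b-swap κ =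
        trans (factorˡ q C A B e e′ W) (trans (cong (C * W *_) (identity κ)) (factorʳ q C A B e e′ W))
        where
        C = 𝟙 (content κ μ)
        W = weight E κ
        A = a κ
        B = b κ
        e = edge q (nth κ p) (nth κ (suc p))
        e′ = edge q (nth κ (suc p)) (nth κ p)
        factorˡ : ∀ q C A B e e′ W → (1 + q) * (C * (A * (e * W)) + C * (B * (e′ * W))) ≡
          C * W * ((1 + q) * (A * e + B * e′))
        factorˡ = solve-∀
        factorʳ : ∀ q C A B e e′ W → C * W * (q * (e + e′) + A * B * (e + e′)) ≡
          q * (C * (e * W) + C * (e′ * W)) + (C * (B * (A * (e * W))) + C * (A * (B * (e′ * W))))
        factorʳ = solve-∀

    without : (ℕ → ℕ) → ℕ → Graph
    without h p i j = if does (i ≟ p) ∧ does (j ≟ suc p) then false else graph h i j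

    without-off : ∀ h p → without h p p (suc p) ≡ false
    without-off h p rewrite dec-true (p ≟ p) refl = refl

    without-on : ∀ h p i j → ¬ (i ≡ p × j ≡ suc p) → without h p i j ≡ graph h i j
    without-on h p i j ne with i ≟ p
    ... | yes i≡p rewrite dec-true (i ≟ p) i≡p | dec-false (j ≟ suc p) (λ j≡p → ne (i≡p , j≡p)) = refl
    ... | no  i≢p rewrite dec-false (i ≟ p) i≢p = refl

    without-swap : ∀ h p → (∀ k → k < p → graph h k p ≡ graph h k (suc p)) →
      (∀ k → suc p < k → k < n → graph h p k ≡ graph h (suc p) k) →
      ∀ (κ : Vec ℕ n) → weight (without h p) (swapAt p κ) ≡ weight (without h p) κ
    without-swap h p low high κ = weight-swap (without h p) p κ (without-off h p)
      (λ k k<p → trans (without-on h p k p (λ z → <⇒≢ k<p (proj₁ z)))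
        (trans (low k k<p) (sym (without-on h p k (suc p) (λ z → <⇒≢ k<p (proj₁ z))))))
      (λ k p<k k<n → trans (without-on h p p k (λ z → >⇒≢ p<k (proj₂ z)))
        (trans (high k p<k k<n) (sym (without-on h p (suc p) k (λ z → >⇒≢ p<k (proj₂ z))))))

    graph-true : ∀ {h i j} → j < h i → graph h i j ≡ true
    graph-true {h} {i} {j} = dec-true (j <? h i)

    graph-false : ∀ {h i j} → h i ≤ j → graph h i j ≡ false
    graph-false {h} {i} {j} hi≤j = dec-false (j <? h i) (≤⇒≯ hi≤j)

    without-weight : ∀ h p → suc p < n → suc p < h p → (κ : Vec ℕ n) →
      weight (graph h) κ ≡ edge q (nth κ p) (nth κ (suc p)) * weight (without h p) κ
    without-weight h p p<n adj κ = weight-add (without h p) (graph h) p (suc p) κ (n<1+n p) p<n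
      (without-off h p) (graph-true {h} adj) (λ i j _ _ ne → sym (without-on h p i j ne))

    graph-same : ∀ {h h′ i j} → h i ≡ h′ i → graph h i j ≡ graph h′ i j
    graph-same {j = j} eq = cong (λ z → does (j <? z)) eq

    graph-step : ∀ {h h′ i b} → h i ≡ b → h′ i ≡ suc b → ∀ {j} → j ≢ b → graph h′ i j ≡ graph h i j
    graph-step {b = b} refl eq {j} j≢b rewrite eq with <-cmp j b
    ... | tri< j<b _ _ = trans (dec-true (j <? suc b) (m<n⇒m<1+n j<b)) (sym (dec-true (j <? b) j<b))
    ... | tri≈ _ j≡b _ = contradiction j≡b j≢b
    ... | tri> _ _ b<j = trans (dec-false (j <? suc b) (≤⇒≯ b<j)) (sym (dec-false (j <? b) (<-asym b<j)))

    graph-grow : ∀ {h h′ i b} → i < b → b < n → (∀ k → k < n → k ≢ i → h′ k ≡ h k) → h i ≡ b → h′ i ≡ suc b →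
      ∀ (κ : Vec ℕ n) → weight (graph h′) κ ≡ edge q (nth κ i) (nth κ b) * weight (graph h) κ
    graph-grow {h} {h′} {i} {b} i<b b<n off at at′ κ = weight-add (graph h) (graph h′) i b κ i<b b<n
      (graph-false {h} (≤-reflexive at)) (graph-true {h′} (subst (b <_) (sym at′) ≤-refl)) same
      where
      same : ∀ x y → x < y → y < n → ¬ (x ≡ i × y ≡ b) → graph h′ x y ≡ graph h x y
      same x y x<y y<n ne with x ≟ i
      ... | no  x≢i  = graph-same {h′} {h} (off x (<-trans x<y y<n) x≢i)
      ... | yes refl = graph-step {h} {h′} at at′ (λ y≡b → ne (refl , y≡b))

    -- Without the edge between them, `p` and `suc p` are twins in the graph of h₀. The edge from
    -- `i` to `p` leads to h₁ and the edge from `i` to `suc p` then to h₂; the exchange of colours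
    -- turns the factors of these two edges into each other.
    X-row : ∀ {h₀ h₁ h₂ i p} → RowMove n h₀ h₁ h₂ i p → (1 + q) * X h₁ ≡ q * X h₀ + X h₂
    X-row {h₀} {h₁} {h₂} {i} {p} M = law {h₀} {h₁} {h₂} p (without h₀ p)
      (λ κ → edge q (nth κ i) (nth κ p)) (λ κ → edge q (nth κ i) (nth κ (suc p))) p+1<n
      (without-swap h₀ p low (λ k _ _ → graph-≡ k))
      (without-weight h₀ p p+1<n (after p i<p (<-trans (n<1+n p) p+1<n)))
      (graph-grow i<p (<-trans (n<1+n p) p+1<n) off₁ at₀ at₁)
      (graph-grow (m<n⇒m<1+n i<p) p+1<n (λ k k<n k≢i → trans (off₂ k k<n k≢i) (sym (off₁ k k<n k≢i))) at₁ at₂)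
      (λ κ → cong₂ (edge q) (nth-swap-other p i κ (<⇒≢ i<p) (<⇒≢ (m<n⇒m<1+n i<p))) (proj₁ (nth-swap p κ p+1<n)))
      (λ κ → cong₂ (edge q) (nth-swap-other p i κ (<⇒≢ i<p) (<⇒≢ (m<n⇒m<1+n i<p))) (proj₂ (nth-swap p κ p+1<n)))
      (λ κ → exchange-row (nth κ p) (nth κ (suc p)) (nth κ i))
      where
      open RowMove M
      graph-≡ : ∀ k → graph h₀ p k ≡ graph h₀ (suc p) k
      graph-≡ k = cong (λ z → does (k <? z)) level
      low : ∀ k → k < p → graph h₀ k p ≡ graph h₀ k (suc p)
      low k k<p with <-cmp k i
      ... | tri< k<i _ _ = trans (graph-false {h₀} (before k k<i)) (sym (graph-false {h₀} (m≤n⇒m≤1+n (before k k<i))))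
      ... | tri≈ _ refl _ = trans (graph-false {h₀} (≤-reflexive at₀)) (sym (graph-false {h₀} (m≤n⇒m≤1+n (≤-reflexive at₀))))
      ... | tri> _ _ i<k = trans (graph-true {h₀} (<-≤-trans (n<1+n p) (<⇒≤ far))) (sym (graph-true {h₀} far))
        where
        far : suc p < h₀ k
        far = after k i<k (<-trans k<p (<-trans (n<1+n p) p+1<n))

    -- The twins are now `i` and `suc i`, both earlier than the third vertex `c`, which is joined
    -- first to `suc i` and then to `i`.
    X-col : ∀ {h₀ h₁ h₂ i c} → ColMove n h₀ h₁ h₂ i c → (1 + q) * X h₁ ≡ q * X h₀ + X h₂
    X-col {h₀} {h₁} {h₂} {i} {c} M = law {h₀} {h₁} {h₂} i (without h₀ i)
      (λ κ → edge q (nth κ (suc i)) (nth κ c)) (λ κ → edge q (nth κ i) (nth κ c)) i+1<n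
      (without-swap h₀ i low (λ k _ _ → graph-≡ k))
      (without-weight h₀ i i+1<n (subst (suc i <_) (sym (proj₁ at₀)) i+1<c))
      (graph-grow i+1<c c<n off-i+1 (proj₂ at₀) (proj₂ at₁))
      (graph-grow (<-trans (n<1+n i) i+1<c) c<n off-i (proj₁ at₁) (proj₁ at₂))
      (λ κ → cong₂ (edge q) (proj₂ (nth-swap i κ i+1<n)) (far κ))
      (λ κ → cong₂ (edge q) (proj₁ (nth-swap i κ i+1<n)) (far κ))
      (λ κ → exchange-col (nth κ i) (nth κ (suc i)) (nth κ c))
      where
      open ColMove M
      i+1<n : suc i < n
      i+1<n = <-trans i+1<c c<n
      far : ∀ (κ : Vec ℕ n) → nth (swapAt i κ) c ≡ nth κ c
      far κ = nth-swap-other i c κ (>⇒≢ (<-trans (n<1+n i) i+1<c)) (>⇒≢ i+1<c)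
      off-i+1 : ∀ k → k < n → k ≢ suc i → h₁ k ≡ h₀ k
      off-i+1 k k<n k≢ with k ≟ i
      ... | yes refl = trans (proj₁ at₁) (sym (proj₁ at₀))
      ... | no  k≢i  = off₁ k k<n k≢i k≢
      off-i : ∀ k → k < n → k ≢ i → h₂ k ≡ h₁ k
      off-i k k<n k≢i with k ≟ suc i
      ... | yes refl = trans (proj₂ at₂) (sym (proj₂ at₁))
      ... | no  k≢   = trans (off₂ k k<n k≢i k≢) (sym (off₁ k k<n k≢i k≢))
      graph-≡ : ∀ k → graph h₀ i k ≡ graph h₀ (suc i) k
      graph-≡ k = cong (λ z → does (k <? z)) (trans (proj₁ at₀) (sym (proj₂ at₀)))
      low : ∀ k → k < i → graph h₀ k i ≡ graph h₀ k (suc i)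
      low k k<i with <-cmp (h₀ k) (suc i)
      ... | tri< lt _ _ = trans (graph-false {h₀} (s≤s⁻¹ lt)) (sym (graph-false {h₀} (<⇒≤ lt)))
      ... | tri≈ _ eq _ = contradiction eq (proj₂ (before k k<i))
      ... | tri> _ _ gt = trans (graph-true {h₀} (<-trans (n<1+n i) gt)) (sym (graph-true {h₀} gt))

    X-move : ∀ {h₀ h₁ h₂} → Move n h₀ h₁ h₂ → (1 + q) * X h₁ ≡ q * X h₀ + X h₂
    X-move (row M) = X-row M
    X-move (col M) = X-col M

-- The coefficients of X as sums of products over edges

module ColouringCoefficients where

  open import Data.Nat
  open import Data.Nat.Properties
  open import Data.Nat.Tactic.RingSolver using (solve-∀)
  open import Data.Bool as Bool using (Bool; true; false; if_then_else_; _∧_; not)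
  open import Data.Bool.ListAction using (all)
  open import Data.Integer as ℤ using ()
  open import Data.List as List using (List; []; _∷_; map; concatMap; filter; upTo; allFin; length)
  open import Data.Fin as Fin using (Fin; toℕ; fromℕ<)
  open import Data.Fin.Properties using (toℕ<n; fromℕ<-toℕ)
  open import Data.Vec as Vec using (Vec; []; _∷_; lookup)
  open import Data.Vec.Relation.Unary.All as VAll using ([]; _∷_)
  open import Data.Product using (_,_; proj₁; proj₂)
  open import Function using (_∘_)
  open import Relation.Nullary using (yes; no; does; contradiction)
  open import Relation.Nullary.Decidable using (⌊_⌋; isYes≗does)
  open import Relation.Binary.PropositionalEquality hiding ([_])
  open import Relation.Binary.Definitions using (tri<; tri≈; tri>)
  open import Defs using (vecsOf; count; isEdge; Xcoef; IsHessenberg)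
  open Sums
  open ModularLaw
  open ColouringLaw

  rowEnds : ∀ {n} → (Fin n → Fin n) → ℕ → ℕ
  rowEnds {n} m k with k <? n
  ... | yes k<n = suc (toℕ (m (fromℕ< k<n)))
  -- A vertex beyond the last one gets no later neighbours.
  ... | no  _   = suc k

  rowEnds-toℕ : ∀ {n} (m : Fin n → Fin n) i → rowEnds m (toℕ i) ≡ suc (toℕ (m i))
  rowEnds-toℕ {n} m i with toℕ i <? n
  ... | yes i<n = cong (suc ∘ toℕ ∘ m) (fromℕ<-toℕ i i<n)
  ... | no  i≮n = contradiction (toℕ<n i) i≮n

  rowEnds-isHess : ∀ {n} {m : Fin n → Fin n} → IsHessenberg m → IsHess n (rowEnds m)
  rowEnds-isHess {n} {m} (above , mono) = record
    { above = λ {k} k<n → subst₂ _<_ (toℕ-fromℕ< k<n) (sym (at k<n)) (s≤s (above (fromℕ< k<n)))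
    ; bound = λ {k} k<n → subst (_≤ n) (sym (at k<n)) (toℕ<n (m (fromℕ< k<n)))
    ; mono  = λ {j} {k} j≤k k<n → let j<n = ≤-<-trans j≤k k<n in
        subst₂ _≤_ (sym (at j<n)) (sym (at k<n))
          (s≤s (mono _ _ (subst₂ _≤_ (sym (toℕ-fromℕ< j<n)) (sym (toℕ-fromℕ< k<n)) j≤k))) }
    where
    open import Data.Fin.Properties using (toℕ-fromℕ<)
    at : ∀ {k} (k<n : k < n) → rowEnds m k ≡ suc (toℕ (m (fromℕ< k<n)))
    at k<n = trans (cong (rowEnds m) (sym (toℕ-fromℕ< k<n))) (rowEnds-toℕ m (fromℕ< k<n))

  module _ (q : ℕ) where
    open Weight q

    private
      interchange : ∀ a b c → a * (b * c) ≡ b * (a * c)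
      interchange = solve-∀

    -- The power of q counting ascents is multiplicative over the edges, and a single monochromatic
    -- edge makes the product zero, as the properness test does.
    ascents : ∀ {A : Set} (a b : A → ℕ) (c : Bool) (L : List A) →
      (if all (λ e → not ⌊ a e ≟ b e ⌋) L ∧ c then q ^ count (λ e → ⌊ a e <? b e ⌋) L else 0) ≡
      𝟙 c * ∏ L (λ e → edge q (a e) (b e))
    ascents a b true  []      = refl
    ascents a b false []      = refl
    ascents a b c (e ∷ L) rewrite count-∷ (λ e → ⌊ a e <? b e ⌋) e L with <-cmp (a e) (b e)
    ... | tri≈ _ ae≡be _ rewrite ⌊⌋-true (a e ≟ b e) ae≡be
            | trans (cong (edge q (a e)) (sym ae≡be)) (edge-≡ q (a e)) = sym (*-zeroʳ (𝟙 c))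
    ... | tri> ae≮be ne be<ae rewrite ⌊⌋-false (a e ≟ b e) ne | ⌊⌋-false (a e <? b e) ae≮be | edge-> q be<ae =
          trans (ascents a b c L) (cong (𝟙 c *_) (sym (*-identityˡ _)))
    ... | tri< ae<be ne _ rewrite ⌊⌋-false (a e ≟ b e) ne | ⌊⌋-true (a e <? b e) ae<be | edge-< q ae<be =
          trans (pull (all (λ e → not ⌊ a e ≟ b e ⌋) L ∧ c)) (trans (cong (q *_) (ascents a b c L)) (interchange q (𝟙 c) _))
          where
          pull : ∀ t {x} → (if t then q * x else 0) ≡ q * (if t then x else 0)
          pull true  = refl
          pull false = sym (*-zeroʳ q)

    pairFactor : ∀ {n} → Graph → Vec ℕ n → Fin n → Fin n → ℕ
    pairFactor E κ i j = pick (does (toℕ i <? toℕ j) ∧ E (toℕ i) (toℕ j)) (edge q (lookup κ i) (lookup κ j))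

    rowWeight-∏ : ∀ {n} P x (κ : Vec ℕ n) →
      ∏ (allFin n) (λ j → pick (P (toℕ j)) (edge q x (lookup κ j))) ≡ rowWeight P x κ
    rowWeight-∏ P x []              = refl
    rowWeight-∏ {suc n} P x (y ∷ κ) = trans
      (∏-allFin n (λ j → pick (P (toℕ j)) (edge q x (lookup (y ∷ κ) j))))
      (cong (pick (P 0) (edge q x y) *_) (rowWeight-∏ (P ∘ suc) x κ))

    weight-∏ : ∀ {n} E (κ : Vec ℕ n) →
      ∏ (allFin n) (λ i → ∏ (allFin n) (pairFactor E κ i)) ≡ weight E κ
    weight-∏ E []              = refl
    weight-∏ {suc n} E (x ∷ κ) = trans
      (∏-allFin n (λ i → ∏ (allFin (suc n)) (pairFactor E (x ∷ κ) i)))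
      (cong₂ _*_
        (trans (∏-allFin n (pairFactor E (x ∷ κ) Fin.zero))
               (trans (*-identityˡ _) (rowWeight-∏ (E 0 ∘ suc) x κ)))
        (trans (∏-cong (allFin n) (λ i → trans (∏-allFin n (pairFactor E (x ∷ κ) (Fin.suc i))) (*-identityˡ _)))
               (weight-∏ (λ i j → E (suc i) (suc j)) κ)))

    Xcoef≡X : ∀ {n} (m : Fin n → Fin n) μ → Xcoef q m μ ≡ ℤ.+ Chromatic.X q n μ (rowEnds m)
    Xcoef≡X {n} m μ = cong ℤ.+_ (∑-cong (vecsOf (upTo (length μ)) n) λ κ →
      trans (ascents (lookup κ ∘ proj₁) (lookup κ ∘ proj₂) (content κ μ) edges)
            (cong (𝟙 (content κ μ) *_) (product-edges κ)))
      where
      pairs = concatMap (λ i → map (i ,_) (allFin n)) (allFin n)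
      edges = filter (λ e → isEdge m (proj₁ e) (proj₂ e) Bool.≟ true) pairs
      adjacent : ∀ i j → isEdge m i j ≡ (does (toℕ i <? toℕ j) ∧ graph (rowEnds m) (toℕ i) (toℕ j))
      adjacent i j = cong₂ _∧_ (isYes≗does (toℕ i <? toℕ j)) (trans (isYes≗does (toℕ j ≤? toℕ (m i)))
        (trans (≤ᵇ-suc (toℕ j)) (cong (λ z → does (toℕ j <? z)) (sym (rowEnds-toℕ m i)))))
        where
        ≤ᵇ-suc : ∀ j {k} → does (j ≤? k) ≡ does (j <? suc k)
        ≤ᵇ-suc zero    = refl
        ≤ᵇ-suc (suc _) = refl
      product-edges : ∀ (κ : Vec ℕ n) →
        ∏ edges (λ e → edge q (lookup κ (proj₁ e)) (lookup κ (proj₂ e))) ≡ weight (graph (rowEnds m)) κ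
      product-edges κ = begin
        ∏ edges _                                         ≡⟨ ∏-filter (λ e → isEdge m (proj₁ e) (proj₂ e)) pairs _ ⟩
        ∏ pairs _                                         ≡⟨ ∏-concatMap _ (allFin n) _ ⟩
        ∏ (allFin n) (λ i → ∏ (map (i ,_) (allFin n)) _)  ≡⟨ ∏-cong (allFin n) (λ i → ∏-map (i ,_) (allFin n) _) ⟩
        ∏ (allFin n) (λ i → ∏ (allFin n) (λ j → pick (isEdge m i j) (edge q (lookup κ i) (lookup κ j))))
          ≡⟨ ∏-cong (allFin n) (λ i → ∏-cong (allFin n) (λ j →
               cong (λ b → pick b (edge q (lookup κ i) (lookup κ j))) (adjacent i j))) ⟩
        ∏ (allFin n) (λ i → ∏ (allFin n) (pairFactor (graph (rowEnds m)) κ i))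
          ≡⟨ weight-∏ (graph (rowEnds m)) κ ⟩
        weight (graph (rowEnds m)) κ                      ∎
        where open ≡-Reasoning

-- The value of X at disjoint unions of cliques

module CliqueColourings where

  open import Data.Nat
  open import Data.Nat.Properties
  open import Data.Nat.Tactic.RingSolver using (solve-∀)
  open import Data.Nat.ListAction using (sum; product)
  open import Data.Bool as Bool using (Bool; true; false; if_then_else_; _∧_)
  open import Data.Bool.ListAction using (and; all)
  open import Data.List as List using (List; []; _∷_; map; upTo; length; replicate; zipWith)
  open import Data.List.Properties using (map-∘; map-cong; map-upTo; length-zipWith; length-replicate)
  open import Data.List.Membership.Propositional using (_∈_; find)
  open import Data.List.Membership.Propositional.Properties using (∈-upTo⁻; ∈-concatMap⁻; ∈-map⁻)
  open import Data.Vec as Vec using (Vec; []; _∷_)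
  open import Data.Vec.Relation.Unary.All as VAll using ([]; _∷_)
  open import Data.Product using (_,_)
  open import Function using (_∘_)
  open import Relation.Nullary using (Dec; yes; no; does)
  open import Relation.Nullary.Decidable using (⌊_⌋; isYes≗does; dec-true; dec-false)
  open import Relation.Binary.PropositionalEquality hiding ([_])
  open import Defs using (vecsOf; occ; ecoefAux)
  open Sums
  open ModularLaw
  open ColouringLaw

  ∈-vecsOf⁻ : ∀ {A : Set} {xs : List A} {k} {v : Vec A k} → v ∈ vecsOf xs k → VAll.All (_∈ xs) v
  ∈-vecsOf⁻ {k = zero}  {[]}    _ = []
  ∈-vecsOf⁻ {xs = xs} {suc k} {y ∷ v} v∈ with find (∈-concatMap⁻ (λ x → map (x ∷_) (vecsOf xs k)) {xs = xs} v∈)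
  ... | x , x∈ , p with ∈-map⁻ (x ∷_) p
  ... | w , w∈ , refl = x∈ ∷ ∈-vecsOf⁻ w∈

  [_]!_ : ℕ → ℕ → ℕ
  [ zero  ]! q = 1
  [ suc k ]! q = [ suc k ] q * [ k ]! q

  factorials : ℕ → List ℕ → ℕ
  factorials q α = product (map ([_]! q) α)

  incr : ℕ → List ℕ → List ℕ
  incr _       []      = []
  incr zero    (b ∷ v) = suc b ∷ v
  incr (suc x) (b ∷ v) = b ∷ incr x v

  -- The multiplicities of the colours below `ℓ`, by recursion on the vertices rather than on the
  -- colours as in `occ`, so that a clique can be coloured one vertex at a time.
  occs : ∀ {n} → ℕ → Vec ℕ n → List ℕ
  occs ℓ []      = replicate ℓ 0
  occs ℓ (x ∷ κ) = incr x (occs ℓ κ)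

  length-incr : ∀ x v → length (incr x v) ≡ length v
  length-incr x       []      = refl
  length-incr zero    (b ∷ v) = refl
  length-incr (suc x) (b ∷ v) = cong suc (length-incr x v)

  length-occs : ∀ {n} ℓ (κ : Vec ℕ n) → length (occs ℓ κ) ≡ ℓ
  length-occs ℓ []      = length-replicate ℓ
  length-occs ℓ (x ∷ κ) = trans (length-incr x (occs ℓ κ)) (length-occs ℓ κ)

  incr-tabulated : ∀ x ℓ (f g : ℕ → ℕ) → (∀ j → g j ≡ 𝟙 ⌊ x ≟ j ⌋ + f j) → incr x (map f (upTo ℓ)) ≡ map g (upTo ℓ)
  incr-tabulated x zero    f g eq = refl
  incr-tabulated zero (suc ℓ) f g eq = cong₂ _∷_ (sym (eq 0)) (begin
    map f (List.applyUpTo suc ℓ)  ≡⟨ cong (map f) (map-upTo suc ℓ) ⟨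
    map f (map suc (upTo ℓ))      ≡⟨ map-∘ (upTo ℓ) ⟨
    map (f ∘ suc) (upTo ℓ)        ≡⟨ map-cong (λ j → sym (eq (suc j))) (upTo ℓ) ⟩
    map (g ∘ suc) (upTo ℓ)        ≡⟨ map-∘ (upTo ℓ) ⟩
    map g (map suc (upTo ℓ))      ≡⟨ cong (map g) (map-upTo suc ℓ) ⟩
    map g (List.applyUpTo suc ℓ)  ∎)
    where open ≡-Reasoning
  incr-tabulated (suc x) (suc ℓ) f g eq = cong₂ _∷_ (sym (eq 0)) (begin
    incr x (map f (List.applyUpTo suc ℓ)) ≡⟨ cong (incr x ∘ map f) (map-upTo suc ℓ) ⟨
    incr x (map f (map suc (upTo ℓ)))     ≡⟨ cong (incr x) (map-∘ (upTo ℓ)) ⟨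
    incr x (map (f ∘ suc) (upTo ℓ))
      ≡⟨ incr-tabulated x ℓ (f ∘ suc) (g ∘ suc) (λ j → trans (eq (suc j)) (cong (_+ f (suc j)) (same j))) ⟩
    map (g ∘ suc) (upTo ℓ)                ≡⟨ map-∘ (upTo ℓ) ⟩
    map g (map suc (upTo ℓ))              ≡⟨ cong (map g) (map-upTo suc ℓ) ⟩
    map g (List.applyUpTo suc ℓ)          ∎)
    where
    open ≡-Reasoning
    same : ∀ j → 𝟙 ⌊ suc x ≟ suc j ⌋ ≡ 𝟙 ⌊ x ≟ j ⌋
    same j = cong 𝟙 (trans (isYes≗does (suc x ≟ suc j)) (sym (isYes≗does (x ≟ j))))

  occs≡ : ∀ {n} ℓ (κ : Vec ℕ n) → map (occ κ) (upTo ℓ) ≡ occs ℓ κ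
  occs≡ ℓ []      = zeros (upTo ℓ) ℓ (λ { refl → Data.List.Properties.length-upTo ℓ })
    where
    import Data.List.Properties
    zeros : ∀ (xs : List ℕ) ℓ → (xs ≡ xs → length xs ≡ ℓ) → map (occ []) xs ≡ replicate ℓ 0
    zeros []       zero    _ = refl
    zeros []       (suc ℓ) e with () ← e refl
    zeros (x ∷ xs) zero    e with () ← e refl
    zeros (x ∷ xs) (suc ℓ) e = cong (0 ∷_) (zeros xs ℓ (λ _ → suc-injective (e refl)))
  occs≡ ℓ (x ∷ κ) = trans (sym (incr-tabulated x ℓ (occ κ) (occ (x ∷ κ)) (λ j → count-∷ (λ c → ⌊ c ≟ j ⌋) x (Vec.toList κ))))
    (cong (incr x) (occs≡ ℓ κ))

  agree : List ℕ → List ℕ → Bool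
  agree v μ = and (zipWith (λ a b → ⌊ a ≟ b ⌋) v μ)

  dominated : List ℕ → List ℕ → Bool
  dominated v μ = and (zipWith (λ a b → ⌊ a ≤? b ⌋) v μ)

  content≡agree : ∀ {n} (κ : Vec ℕ n) μ → content κ μ ≡ agree (occs (length μ) κ) μ
  content≡agree κ μ = trans (lem (upTo (length μ)) μ) (cong (λ v → agree v μ) (occs≡ (length μ) κ))
    where
    lem : ∀ xs μ → and (zipWith (λ j μj → ⌊ occ κ j ≟ μj ⌋) xs μ) ≡ agree (map (occ κ) xs) μ
    lem []       μ       = refl
    lem (x ∷ xs) []      = refl
    lem (x ∷ xs) (m ∷ μ) = cong (⌊ occ κ x ≟ m ⌋ ∧_) (lem xs μ)

  plus-incr : ∀ x v w → incr x (zipWith _+_ v w) ≡ zipWith _+_ (incr x v) w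
  plus-incr x       []      w       = refl
  plus-incr zero    (a ∷ v) []      = refl
  plus-incr (suc x) (a ∷ v) []      = refl
  plus-incr zero    (a ∷ v) (b ∷ w) = refl
  plus-incr (suc x) (a ∷ v) (b ∷ w) = cong (a + b ∷_) (plus-incr x v w)

  plus-zeros : ∀ ℓ w → length w ≡ ℓ → zipWith _+_ (replicate ℓ 0) w ≡ w
  plus-zeros zero    []      _  = refl
  plus-zeros (suc ℓ) (x ∷ w) eq = cong (x ∷_) (plus-zeros ℓ w (suc-injective eq))

  occs-++ : ∀ {j k} ℓ (κ : Vec ℕ j) (κ′ : Vec ℕ k) → occs ℓ (κ Vec.++ κ′) ≡ zipWith _+_ (occs ℓ κ) (occs ℓ κ′)
  occs-++ ℓ []      κ′ = sym (plus-zeros ℓ (occs ℓ κ′) (length-occs ℓ κ′))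
  occs-++ ℓ (x ∷ κ) κ′ = trans (cong (incr x) (occs-++ ℓ κ κ′)) (plus-incr x (occs ℓ κ) (occs ℓ κ′))

  -- Subtraction is truncated, so `dominated` has to accompany it: a + b = m if and only if a ≤ m
  -- and b = m - a.
  agree-plus : ∀ v w μ → length v ≡ length μ → length w ≡ length μ →
    agree (zipWith _+_ v w) μ ≡ dominated v μ ∧ agree w (zipWith _∸_ μ v)
  agree-plus []      []      []      _  _  = refl
  agree-plus (a ∷ v) (b ∷ w) (m ∷ μ) ev ew
    rewrite agree-plus v w μ (suc-injective ev) (suc-injective ew) with a ≤? m
  ... | yes a≤m = trans (cong (_∧ (dominated v μ ∧ agree w (zipWith _∸_ μ v))) same)
                        (shuffle ⌊ b ≟ m ∸ a ⌋ (dominated v μ) _)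
    where
    shuffle : ∀ x y z → x ∧ (y ∧ z) ≡ y ∧ (x ∧ z)
    shuffle true  y     z = refl
    shuffle false true  z = refl
    shuffle false false z = refl
    same : ⌊ a + b ≟ m ⌋ ≡ ⌊ b ≟ m ∸ a ⌋
    same with b ≟ m ∸ a
    ... | yes refl = ⌊⌋-true (a + b ≟ m) (m+[n∸m]≡n a≤m)
    ... | no  ne   = ⌊⌋-false (a + b ≟ m) (λ eq → ne (trans (sym (m+n∸m≡n a b)) (cong (_∸ a) eq)))
  ... | no a≰m rewrite ⌊⌋-false (a + b ≟ m) (λ eq → a≰m (subst (a ≤_) eq (m≤m+n a b))) = refl

  module CliqueSum (q : ℕ) where
    open Weight q

    complete : Graph
    complete _ _ = true

    -- For a 0/1 vector v of the colours used by the later vertices of a clique: q to the number of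
    -- those above x, provided that x itself is not used.
    rank : ℕ → List ℕ → ℕ
    rank _       []          = 0
    rank zero    (zero ∷ v)  = q ^ sum v
    rank zero    (suc _ ∷ v) = 0
    rank (suc x) (_ ∷ v)     = rank x v

    sum-incr : ∀ x v → x < length v → sum (incr x v) ≡ suc (sum v)
    sum-incr zero    (a ∷ v) _         = refl
    sum-incr (suc x) (a ∷ v) (s≤s x<ℓ) = trans (cong (a +_) (sum-incr x v x<ℓ)) (+-suc a (sum v))

    -- One more later vertex of colour `y` acts on the rank as its edge does: it uses up `x` itself,
    -- adds a colour above `x`, or changes nothing above `x`.
    rank-incr : ∀ x y v → x < length v → y < length v → rank x (incr y v) ≡ edge q x y * rank x v
    rank-incr zero    zero    (a ∷ v)     _ _ = refl
    rank-incr zero    (suc y) (zero ∷ v)  _ (s≤s y<ℓ) = cong (q ^_) (sum-incr y v y<ℓ)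
    rank-incr zero    (suc y) (suc a ∷ v) _ _ = sym (*-zeroʳ q)
    rank-incr (suc x) zero    (a ∷ v)     _ _ = sym (*-identityˡ _)
    rank-incr (suc x) (suc y) (a ∷ v)     (s≤s x<ℓ) (s≤s y<ℓ) = rank-incr x y v x<ℓ y<ℓ

    rank-zeros : ∀ x ℓ → x < ℓ → rank x (replicate ℓ 0) ≡ 1
    rank-zeros zero    (suc ℓ) _         = cong (q ^_) (zeros ℓ)
      where
      zeros : ∀ ℓ → sum (replicate ℓ 0) ≡ 0
      zeros zero    = refl
      zeros (suc ℓ) = zeros ℓ
    rank-zeros (suc x) (suc ℓ) (s≤s x<ℓ) = rank-zeros x ℓ x<ℓ

    rowWeight-rank : ∀ {k} ℓ x (κ : Vec ℕ k) → x < ℓ → VAll.All (_∈ upTo ℓ) κ →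
      rowWeight (λ _ → true) x κ ≡ rank x (occs ℓ κ)
    rowWeight-rank ℓ x []      x<ℓ []        = sym (rank-zeros x ℓ x<ℓ)
    rowWeight-rank ℓ x (y ∷ κ) x<ℓ (y∈ ∷ κ∈) = trans (cong (edge q x y *_) (rowWeight-rank ℓ x κ x<ℓ κ∈))
      (sym (rank-incr x y (occs ℓ κ) (subst (x <_) (sym (length-occs ℓ κ)) x<ℓ)
                                     (subst (y <_) (sym (length-occs ℓ κ)) (∈-upTo⁻ y∈))))

    -- The 0/1 vectors of weight `k` are the sets of `k` colours, or the exponent vectors of the
    -- monomials of e_k in `ℓ` variables.
    ∑bits : ℕ → ℕ → (List ℕ → ℕ) → ℕ
    ∑bits ℓ k g = ∑ (vecsOf (0 ∷ 1 ∷ []) ℓ) (λ v → 𝟙 ⌊ sum (Vec.toList v) ≟ k ⌋ * g (Vec.toList v))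

    ∑bits-cong : ∀ ℓ k {f g} → (∀ v → length v ≡ ℓ → sum v ≡ k → f v ≡ g v) → ∑bits ℓ k f ≡ ∑bits ℓ k g
    ∑bits-cong ℓ k {f} {g} eq = ∑-cong (vecsOf (0 ∷ 1 ∷ []) ℓ) λ v → lem v (sum (Vec.toList v) ≟ k)
      where
      open import Data.Vec.Properties using (length-toList)
      lem : ∀ (v : Vec ℕ ℓ) (d : Dec (sum (Vec.toList v) ≡ k)) → 𝟙 ⌊ d ⌋ * f (Vec.toList v) ≡ 𝟙 ⌊ d ⌋ * g (Vec.toList v)
      lem v (yes e) = cong (1 *_) (eq (Vec.toList v) (length-toList v) e)
      lem v (no _)  = refl

    ∑bits-+ : ∀ ℓ k f g → ∑bits ℓ k (λ v → f v + g v) ≡ ∑bits ℓ k f + ∑bits ℓ k g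
    ∑bits-+ ℓ k f g = trans (∑-cong vs (λ v → *-distribˡ-+ (𝟙 ⌊ sum (Vec.toList v) ≟ k ⌋) _ _)) (∑-+ vs _ _)
      where vs = vecsOf (0 ∷ 1 ∷ []) ℓ

    ∑bits-*ˡ : ∀ ℓ k c f → ∑bits ℓ k (λ v → c * f v) ≡ c * ∑bits ℓ k f
    ∑bits-*ˡ ℓ k c f = trans (∑-cong vs (λ v → comm (𝟙 ⌊ sum (Vec.toList v) ≟ k ⌋) c _)) (∑-*ˡ vs c _)
      where
      vs = vecsOf (0 ∷ 1 ∷ []) ℓ
      comm : ∀ a b c → a * (b * c) ≡ b * (a * c)
      comm = solve-∀

    ∑bits-split : ∀ ℓ k g → ∑bits (suc ℓ) (suc k) g ≡ ∑bits ℓ (suc k) (g ∘ (0 ∷_)) + ∑bits ℓ k (g ∘ (1 ∷_))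
    ∑bits-split ℓ k g = trans (∑-vecs (0 ∷ 1 ∷ []) ℓ _) (cong (∑bits ℓ (suc k) (g ∘ (0 ∷_)) +_)
      (trans (+-identityʳ _) (∑-cong (vecsOf (0 ∷ 1 ∷ []) ℓ) (λ v → cong (λ b → 𝟙 b * g (1 ∷ Vec.toList v))
        (trans (isYes≗does (suc (sum (Vec.toList v)) ≟ suc k)) (sym (isYes≗does (sum (Vec.toList v) ≟ k))))))))

    ∑bits-split₀ : ∀ ℓ g → ∑bits (suc ℓ) 0 g ≡ ∑bits ℓ 0 (g ∘ (0 ∷_))
    ∑bits-split₀ ℓ g = trans (∑-vecs (0 ∷ 1 ∷ []) ℓ _) (trans (cong (∑bits ℓ 0 (g ∘ (0 ∷_)) +_)
      (trans (+-identityʳ _) (∑-0 (vecsOf (0 ∷ 1 ∷ []) ℓ) (λ _ → refl)))) (+-identityʳ _))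

    insertions : ℕ → (List ℕ → ℕ) → List ℕ → ℕ
    insertions ℓ g v = ∑ (upTo ℓ) (λ x → rank x v * g (incr x v))

    insertions-0 : ∀ ℓ g v → insertions (suc ℓ) g (0 ∷ v) ≡ q ^ sum v * g (1 ∷ v) + insertions ℓ (g ∘ (0 ∷_)) v
    insertions-0 ℓ g v = ∑-upTo ℓ (λ x → rank x (0 ∷ v) * g (incr x (0 ∷ v)))

    insertions-1 : ∀ ℓ g v → insertions (suc ℓ) g (1 ∷ v) ≡ insertions ℓ (g ∘ (1 ∷_)) v
    insertions-1 ℓ g v = ∑-upTo ℓ (λ x → rank x (1 ∷ v) * g (incr x (1 ∷ v)))

    -- A set of k + 1 colours arises by inserting any of its members into the rest, with weight q to
    -- the number of members above it. These numbers run through 0, ..., k, which gives the factor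
    -- [k + 1]. The proof splits off the first colour, as in the Pascal recursion.
    ∑bits-insert : ∀ ℓ k g → ∑bits ℓ k (insertions ℓ g) ≡ [ suc k ] q * ∑bits ℓ (suc k) g
    ∑bits-insert zero    k g = trans (trans (+-identityʳ _) (*-zeroʳ (𝟙 ⌊ 0 ≟ k ⌋))) (sym (*-zeroʳ ([ suc k ] q)))
    ∑bits-insert (suc ℓ) k g = begin
      ∑bits (suc ℓ) k (insertions (suc ℓ) g)
        ≡⟨ first k ⟩
      q ^ k * ∑bits ℓ k (g ∘ (1 ∷_)) + [ suc k ] q * ∑bits ℓ (suc k) (g ∘ (0 ∷_)) + [ k ] q * ∑bits ℓ k (g ∘ (1 ∷_))
        ≡⟨ collect (q ^ k) (∑bits ℓ k (g ∘ (1 ∷_))) (∑bits ℓ (suc k) (g ∘ (0 ∷_))) ([ k ] q) ⟩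
      [ suc k ] q * (∑bits ℓ (suc k) (g ∘ (0 ∷_)) + ∑bits ℓ k (g ∘ (1 ∷_)))
        ≡⟨ cong ([ suc k ] q *_) (∑bits-split ℓ k g) ⟨
      [ suc k ] q * ∑bits (suc ℓ) (suc k) g ∎
      where
      open ≡-Reasoning
      collect : ∀ Q a b K → Q * a + (K + Q) * b + K * a ≡ (K + Q) * (b + a)
      collect = solve-∀
      zeroPart : ∀ k → ∑bits ℓ k (insertions (suc ℓ) g ∘ (0 ∷_)) ≡
        q ^ k * ∑bits ℓ k (g ∘ (1 ∷_)) + [ suc k ] q * ∑bits ℓ (suc k) (g ∘ (0 ∷_))
      zeroPart k = begin
        ∑bits ℓ k (insertions (suc ℓ) g ∘ (0 ∷_))
          ≡⟨ ∑bits-cong ℓ k (λ v _ sv → trans (insertions-0 ℓ g v) (cong (λ z → q ^ z * g (1 ∷ v) + _) sv)) ⟩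
        ∑bits ℓ k (λ v → q ^ k * g (1 ∷ v) + insertions ℓ (g ∘ (0 ∷_)) v)
          ≡⟨ ∑bits-+ ℓ k (λ v → q ^ k * g (1 ∷ v)) (insertions ℓ (g ∘ (0 ∷_))) ⟩
        ∑bits ℓ k (λ v → q ^ k * g (1 ∷ v)) + ∑bits ℓ k (insertions ℓ (g ∘ (0 ∷_)))
          ≡⟨ cong₂ _+_ (∑bits-*ˡ ℓ k (q ^ k) (g ∘ (1 ∷_))) (∑bits-insert ℓ k (g ∘ (0 ∷_))) ⟩
        q ^ k * ∑bits ℓ k (g ∘ (1 ∷_)) + [ suc k ] q * ∑bits ℓ (suc k) (g ∘ (0 ∷_)) ∎
      first : ∀ k → ∑bits (suc ℓ) k (insertions (suc ℓ) g) ≡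
        q ^ k * ∑bits ℓ k (g ∘ (1 ∷_)) + [ suc k ] q * ∑bits ℓ (suc k) (g ∘ (0 ∷_)) + [ k ] q * ∑bits ℓ k (g ∘ (1 ∷_))
      first zero    = trans (∑bits-split₀ ℓ (insertions (suc ℓ) g)) (trans (zeroPart 0) (sym (+-identityʳ _)))
      first (suc k) = trans (∑bits-split ℓ k (insertions (suc ℓ) g)) (cong₂ _+_ (zeroPart (suc k))
        (trans (∑bits-cong ℓ k (λ v _ _ → insertions-1 ℓ g v)) (∑bits-insert ℓ k (g ∘ (1 ∷_)))))

    ∑bits-zero : ∀ ℓ g → ∑bits ℓ 0 g ≡ g (replicate ℓ 0)
    ∑bits-zero zero    g = trans (+-identityʳ _) (+-identityʳ _)
    ∑bits-zero (suc ℓ) g = trans (∑bits-split₀ ℓ g) (∑bits-zero ℓ (g ∘ (0 ∷_)))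

    -- This is X = [k]! e_k for a clique on k vertices. The function `g` is arbitrary because the
    -- induction sums over the colour of the first vertex innermost and absorbs it into `g` as
    -- `insertions`.
    clique-sum : ∀ ℓ k (g : List ℕ → ℕ) →
      ∑ (vecsOf (upTo ℓ) k) (λ κ → weight complete κ * g (occs ℓ κ)) ≡ [ k ]! q * ∑bits ℓ k g
    clique-sum ℓ zero    g = trans (+-identityʳ _) (cong (1 *_) (sym (∑bits-zero ℓ g)))
    clique-sum ℓ (suc k) g = begin
      ∑ (vecsOf xs (suc k)) (λ κ → weight complete κ * g (occs ℓ κ))
        ≡⟨ ∑-vecs xs k _ ⟩
      ∑ xs (λ x → ∑ (vecsOf xs k) (λ κ → rowWeight (λ _ → true) x κ * weight complete κ * g (incr x (occs ℓ κ))))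
        ≡⟨ ∑-cong∈ xs (λ {x} x∈ → ∑-cong∈ (vecsOf xs k) (λ {κ} κ∈ →
             trans (cong (λ z → z * weight complete κ * g (incr x (occs ℓ κ)))
                     (rowWeight-rank ℓ x κ (∈-upTo⁻ x∈) (∈-vecsOf⁻ κ∈)))
                   (shuffle (rank x (occs ℓ κ)) (weight complete κ) _))) ⟩
      ∑ xs (λ x → ∑ (vecsOf xs k) (λ κ → weight complete κ * (rank x (occs ℓ κ) * g (incr x (occs ℓ κ)))))
        ≡⟨ ∑-swap xs (vecsOf xs k) _ ⟩
      ∑ (vecsOf xs k) (λ κ → ∑ xs (λ x → weight complete κ * (rank x (occs ℓ κ) * g (incr x (occs ℓ κ)))))
        ≡⟨ ∑-cong (vecsOf xs k) (λ κ → ∑-*ˡ xs (weight complete κ) _) ⟩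
      ∑ (vecsOf xs k) (λ κ → weight complete κ * insertions ℓ g (occs ℓ κ))
        ≡⟨ clique-sum ℓ k (insertions ℓ g) ⟩
      [ k ]! q * ∑bits ℓ k (insertions ℓ g)
        ≡⟨ cong ([ k ]! q *_) (∑bits-insert ℓ k g) ⟩
      [ k ]! q * ([ suc k ] q * ∑bits ℓ (suc k) g)
        ≡⟨ reassoc ([ k ]! q) ([ suc k ] q) _ ⟩
      [ suc k ]! q * ∑bits ℓ (suc k) g ∎
      where
      open ≡-Reasoning
      xs = upTo ℓ
      shuffle : ∀ a b c → a * b * c ≡ b * (a * c)
      shuffle = solve-∀
      reassoc : ∀ a b c → a * (b * c) ≡ b * a * c
      reassoc = solve-∀

    rowWeight-none : ∀ {k} P x (κ : Vec ℕ k) → (∀ j → j < k → P j ≡ false) → rowWeight P x κ ≡ 1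
    rowWeight-none P x []      none = refl
    rowWeight-none P x (y ∷ κ) none rewrite none 0 z<s =
      trans (+-identityʳ _) (rowWeight-none (P ∘ suc) x κ (λ j j<k → none (suc j) (s≤s j<k)))

    rowWeight-++ : ∀ {j k} P x (κ : Vec ℕ j) (κ′ : Vec ℕ k) →
      rowWeight P x (κ Vec.++ κ′) ≡ rowWeight P x κ * rowWeight (λ i → P (j + i)) x κ′
    rowWeight-++ P x []      κ′ = sym (*-identityˡ _)
    rowWeight-++ P x (y ∷ κ) κ′ = trans (cong (pick (P 0) (edge q x y) *_) (rowWeight-++ (P ∘ suc) x κ κ′))
      (sym (*-assoc (pick (P 0) (edge q x y)) _ _))

    weight-++ : ∀ {j k} E (κ : Vec ℕ j) (κ′ : Vec ℕ k) → (∀ a b → a < j → b < k → E a (j + b) ≡ false) →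
      weight E (κ Vec.++ κ′) ≡ weight E κ * weight (λ a b → E (j + a) (j + b)) κ′
    weight-++ E []      κ′ none = sym (*-identityˡ _)
    weight-++ {suc j} E (x ∷ κ) κ′ none = trans
      (cong₂ _*_ (trans (rowWeight-++ (E 0 ∘ suc) x κ κ′)
                   (trans (cong (rowWeight (E 0 ∘ suc) x κ *_)
                             (rowWeight-none (λ b → E 0 (suc (j + b))) x κ′ (λ b b<k → none 0 b z<s b<k)))
                          (*-identityʳ (rowWeight (E 0 ∘ suc) x κ))))
                 (weight-++ (λ a b → E (suc a) (suc b)) κ κ′ (λ a b a<j b<k → none (suc a) b (s≤s a<j) b<k)))
      (sym (*-assoc (rowWeight (E 0 ∘ suc) x κ) (weight (λ a b → E (suc a) (suc b)) κ)
                    (weight (λ a b → E (suc j + a) (suc j + b)) κ′)))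

    agree-zeros : ∀ μ → agree (replicate (length μ) 0) μ ≡ all (λ a → ⌊ a ≟ 0 ⌋) μ
    agree-zeros []      = refl
    agree-zeros (m ∷ μ) = cong₂ _∧_ (same m) (agree-zeros μ)
      where
      same : ∀ m → ⌊ 0 ≟ m ⌋ ≡ ⌊ m ≟ 0 ⌋
      same zero    = refl
      same (suc m) = refl

    𝟙-∧ : ∀ a b → 𝟙 (a ∧ b) ≡ 𝟙 a * 𝟙 b
    𝟙-∧ true  b = sym (+-identityʳ (𝟙 b))
    𝟙-∧ false b = refl

    shifted : (ℕ → ℕ) → ℕ → Graph
    shifted h u i j = graph h (u + i) (u + j)

    -- No edge joins the first clique to the later ones, so the weight factors. The colours which
    -- the clique uses are subtracted from `μ`, exactly as `ecoefAux` peels off its first factor;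
    -- `shifted` renumbers the vertices from the first one not yet treated.
    cliques-sum : ∀ g u α ℓ μ → length μ ≡ ℓ →
      ∑ (vecsOf (upTo ℓ) (sum α)) (λ κ → 𝟙 (agree (occs ℓ κ) μ) * weight (shifted (cliques g u α) u) κ) ≡
      factorials q α * ecoefAux α μ
    cliques-sum g u []      ℓ μ refl rewrite agree-zeros μ with all (λ a → ⌊ a ≟ 0 ⌋) μ
    ... | true  = refl
    ... | false = refl
    cliques-sum g u (x ∷ α) ℓ μ refl = begin
      ∑ (vecsOf xs (x + sum α)) (λ κ → 𝟙 (agree (occs ℓ κ) μ) * weight E κ)
        ≡⟨ ∑-vecs-++ xs x (sum α) _ ⟩
      ∑ (vecsOf xs x) (λ κ → ∑ (vecsOf xs (sum α)) (λ κ′ → 𝟙 (agree (occs ℓ (κ Vec.++ κ′)) μ) * weight E (κ Vec.++ κ′)))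
        ≡⟨ ∑-cong (vecsOf xs x) (λ κ → trans (∑-cong (vecsOf xs (sum α)) (split κ)) (tail κ)) ⟩
      ∑ (vecsOf xs x) (λ κ → weight complete κ * G (occs ℓ κ))
        ≡⟨ clique-sum ℓ x G ⟩
      [ x ]! q * ∑bits ℓ x G
        ≡⟨ cong ([ x ]! q *_) (trans (∑-cong (vecsOf (0 ∷ 1 ∷ []) ℓ) (λ v → regroup (Vec.toList v)))
             (∑-*ˡ (vecsOf (0 ∷ 1 ∷ []) ℓ) (factorials q α) (λ v → term (Vec.toList v)))) ⟩
      [ x ]! q * (factorials q α * ∑ (vecsOf (0 ∷ 1 ∷ []) ℓ) (λ v → term (Vec.toList v)))
        ≡⟨ *-assoc ([ x ]! q) (factorials q α) _ ⟨
      [ x ]! q * factorials q α * ∑ (vecsOf (0 ∷ 1 ∷ []) ℓ) (λ v → term (Vec.toList v))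
        ≡⟨ cong ([ x ]! q * factorials q α *_) (∑-map Vec.toList (vecsOf (0 ∷ 1 ∷ []) ℓ) term) ⟨
      factorials q (x ∷ α) * ecoefAux (x ∷ α) μ ∎
      where
      open ≡-Reasoning
      xs = upTo ℓ
      h = cliques g u (x ∷ α)
      E = shifted h u
      G : List ℕ → ℕ
      G v = 𝟙 (dominated v μ) * (factorials q α * ecoefAux α (zipWith _∸_ μ v))
      term : List ℕ → ℕ
      term v = if ⌊ sum v ≟ x ⌋ ∧ dominated v μ then ecoefAux α (zipWith _∸_ μ v) else 0
      if-𝟙 : ∀ b {y} → (if b then y else 0) ≡ 𝟙 b * y
      if-𝟙 true  = sym (+-identityʳ _)
      if-𝟙 false = refl
      regroup : ∀ v → 𝟙 ⌊ sum v ≟ x ⌋ * G v ≡ factorials q α * term v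
      regroup v = begin
        𝟙 s * (𝟙 d * (factorials q α * e))    ≡⟨ shuffle (𝟙 s) (𝟙 d) (factorials q α) e ⟩
        factorials q α * (𝟙 s * 𝟙 d * e)      ≡⟨ cong (λ z → factorials q α * (z * e)) (𝟙-∧ s d) ⟨
        factorials q α * (𝟙 (s ∧ d) * e)      ≡⟨ cong (factorials q α *_) (if-𝟙 (s ∧ d)) ⟨
        factorials q α * term v               ∎
        where
        s = ⌊ sum v ≟ x ⌋
        d = dominated v μ
        e = ecoefAux α (zipWith _∸_ μ v)
        shuffle : ∀ a b c d → a * (b * (c * d)) ≡ c * (a * b * d)
        shuffle = solve-∀
      row-end : ∀ {i} → i < x → h (u + i) ≡ u + x
      row-end {i} i<x = trans (cliques-below α (+-monoʳ-< u i<x)) (put-in (m≤m+n u i) (+-monoʳ-< u i<x))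
      inside : ∀ (κ : Vec ℕ x) → weight E κ ≡ weight complete κ
      inside κ = weight-cong κ λ i j i<j j<x → trans (cong (λ z → does (u + j <? z)) (row-end (<-trans i<j j<x)))
        (dec-true (u + j <? u + x) (+-monoʳ-< u j<x))
      apart : ∀ a b → a < x → b < sum α → E a (x + b) ≡ false
      apart a b a<x _ = trans (cong (λ z → does (u + (x + b) <? z)) (row-end a<x))
        (dec-false (u + (x + b) <? u + x) (≤⇒≯ (+-monoʳ-≤ u (m≤m+n x b))))
      rest : ∀ (κ′ : Vec ℕ (sum α)) → weight (λ a b → E (x + a) (x + b)) κ′ ≡
        weight (shifted (cliques (put g u (u + x) (u + x)) (u + x) α) (u + x)) κ′
      rest κ′ = weight-cong κ′ λ i j _ _ → cong₂ (graph h) (sym (+-assoc u x i)) (sym (+-assoc u x j))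
      split : ∀ (κ : Vec ℕ x) (κ′ : Vec ℕ (sum α)) →
        𝟙 (agree (occs ℓ (κ Vec.++ κ′)) μ) * weight E (κ Vec.++ κ′) ≡
        weight complete κ * 𝟙 (dominated (occs ℓ κ) μ) *
          (𝟙 (agree (occs ℓ κ′) (zipWith _∸_ μ (occs ℓ κ))) *
           weight (shifted (cliques (put g u (u + x) (u + x)) (u + x) α) (u + x)) κ′)
      split κ κ′
        rewrite occs-++ ℓ κ κ′
              | agree-plus (occs ℓ κ) (occs ℓ κ′) μ (length-occs ℓ κ) (length-occs ℓ κ′)
              | 𝟙-∧ (dominated (occs ℓ κ) μ) (agree (occs ℓ κ′) (zipWith _∸_ μ (occs ℓ κ)))
              | weight-++ E κ κ′ apart | inside κ | rest κ′ =
        shuffle (𝟙 (dominated (occs ℓ κ) μ)) _ (weight complete κ) _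
        where
        shuffle : ∀ d a w w′ → d * a * (w * w′) ≡ w * d * (a * w′)
        shuffle = solve-∀
      tail : ∀ (κ : Vec ℕ x) → ∑ (vecsOf xs (sum α)) (λ κ′ → weight complete κ * 𝟙 (dominated (occs ℓ κ) μ) *
          (𝟙 (agree (occs ℓ κ′) (zipWith _∸_ μ (occs ℓ κ))) *
           weight (shifted (cliques (put g u (u + x) (u + x)) (u + x) α) (u + x)) κ′)) ≡
        weight complete κ * G (occs ℓ κ)
      tail κ = trans (∑-*ˡ (vecsOf xs (sum α)) (weight complete κ * 𝟙 (dominated (occs ℓ κ) μ)) _)
        (trans (cong (weight complete κ * 𝟙 (dominated (occs ℓ κ) μ) *_)
                 (cliques-sum (put g u (u + x) (u + x)) (u + x) α ℓ (zipWith _∸_ μ (occs ℓ κ)) len))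
               (*-assoc (weight complete κ) _ _))
        where
        len : length (zipWith _∸_ μ (occs ℓ κ)) ≡ ℓ
        len = trans (length-zipWith _∸_ μ (occs ℓ κ)) (trans (cong (ℓ ⊓_) (length-occs ℓ κ)) (⊓-idem ℓ))

    X-cliques : ∀ α μ → Chromatic.X q (sum α) μ (cliques suc 0 α) ≡ factorials q α * ecoefAux α μ
    X-cliques α μ = trans
      (∑-cong (vecsOf (upTo (length μ)) (sum α)) (λ κ →
        cong (λ b → 𝟙 b * weight (graph (cliques suc 0 α)) κ) (content≡agree κ μ)))
      (cliques-sum suc 0 α (length μ) μ refl)

-- Unitriangularity of the elementary symmetric functions

module ElementaryBasis where

  open import Data.Nat
  open import Data.Nat.Properties
  open import Data.Nat.ListAction using (sum)
  open import Data.Bool as Bool using (Bool; true; false; if_then_else_; _∧_)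
  open import Data.Bool.Properties using (∧-conicalˡ; ∧-conicalʳ)
  open import Data.Bool.ListAction using (all)
  open import Data.Integer as ℤ using (ℤ; 0ℤ)
  import Data.Integer.Properties as ℤ
  import Data.Integer.Tactic.RingSolver as ℤSolver
  open import Data.List as List using (List; []; _∷_; _++_; map; concatMap; upTo; length; replicate; zipWith)
  open import Data.List.Properties using (++-identityʳ)
  open import Data.List.Membership.Propositional using (_∈_)
  open import Data.List.Membership.Propositional.Properties
  open import Data.List.Relation.Unary.Any as Any using (here; there)
  open import Data.List.Relation.Unary.All as All using (All; []; _∷_)
  open import Data.List.Relation.Unary.Linked as Linked using (Linked; []; [-]; _∷_)
  open import Data.Vec as Vec using (Vec; []; _∷_)
  open import Data.Product using (∃; _×_; _,_; proj₂)
  open import Function using (_∘_)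
  open import Relation.Nullary using (Dec; yes)
  open import Relation.Nullary.Decidable using (⌊_⌋; isYes≗does)
  open import Relation.Binary.PropositionalEquality hiding ([_])
  open import Relation.Binary.Definitions using (tri<; tri≈; tri>)
  open import Defs using (vecsOf; isPartitionOf; partitions; ecoefAux; ecoef)
  open Sums
  open CliqueColourings

  record Partition (n : ℕ) (μ : List ℕ) : Set where
    constructor partition
    field
      total      : sum μ ≡ n
      positive   : All (1 ≤_) μ
      descending : Linked _≥_ μ

  -- The function f is the local function of isPartitionOf, which has no name outside.
  descends : ∀ n → ∃ λ (f : List ℕ → Bool) →
    (∀ μ → isPartitionOf n μ ≡ (⌊ sum μ ≟ n ⌋ ∧ all (λ k → ⌊ 1 ≤? k ⌋) μ ∧ f μ)) ×
    f [] ≡ true × (∀ a → f (a ∷ []) ≡ true) × (∀ a b xs → f (a ∷ b ∷ xs) ≡ ⌊ b ≤? a ⌋ ∧ f (b ∷ xs))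
  descends n = _ , (λ μ → refl) , refl , (λ a → refl) , λ a b xs → refl

  ∧-true : ∀ {a b} → a ∧ b ≡ true → a ≡ true × b ≡ true
  ∧-true {a} {b} eq = ∧-conicalˡ a b eq , ∧-conicalʳ a b eq

  ⌊⌋-witness : ∀ {P : Set} (d : Dec P) → ⌊ d ⌋ ≡ true → P
  ⌊⌋-witness (yes p) _ = p

  isPartition⁻ : ∀ {n} μ → isPartitionOf n μ ≡ true → Partition n μ
  isPartition⁻ {n} μ eq with descends n
  ... | f , unfold , nil , one , more =
    let a , bc = ∧-true {⌊ sum μ ≟ n ⌋} (trans (sym (unfold μ)) eq)
        b , c  = ∧-true {all (λ k → ⌊ 1 ≤? k ⌋) μ} bc
    in partition (⌊⌋-witness (sum μ ≟ n) a) (positive μ b) (linked μ c)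
    where
    positive : ∀ μ → all (λ k → ⌊ 1 ≤? k ⌋) μ ≡ true → All (1 ≤_) μ
    positive []      _ = []
    positive (k ∷ μ) e = let a , b = ∧-true e in ⌊⌋-witness (1 ≤? k) a ∷ positive μ b
    linked : ∀ μ → f μ ≡ true → Linked _≥_ μ
    linked []          _ = []
    linked (a ∷ [])    _ = [-]
    linked (a ∷ b ∷ μ) e = let x , y = ∧-true (trans (sym (more a b μ)) e) in ⌊⌋-witness (b ≤? a) x ∷ linked (b ∷ μ) y

  isPartition⁺ : ∀ {n μ} → Partition n μ → isPartitionOf n μ ≡ true
  isPartition⁺ {n} {μ} (partition total pos desc) with descends n
  ... | f , unfold , nil , one , more =
    trans (unfold μ) (cong₂ _∧_ (⌊⌋-true (sum μ ≟ n) total) (cong₂ _∧_ (positive pos) (linked desc)))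
    where
    positive : ∀ {μ} → All (1 ≤_) μ → all (λ k → ⌊ 1 ≤? k ⌋) μ ≡ true
    positive []                 = refl
    positive (_∷_ {x = k} p ps) = cong₂ _∧_ (⌊⌋-true (1 ≤? k) p) (positive ps)
    linked : ∀ {μ} → Linked _≥_ μ → f μ ≡ true
    linked []                              = nil
    linked [-]                             = one _
    linked (_∷_ {x = a} {y = b} {xs} r rs) = trans (more a b xs) (cong₂ _∧_ (⌊⌋-true (b ≤? a) r) (linked rs))

  ∈-partitions⁻ : ∀ {n μ} → μ ∈ partitions n → Partition n μ
  ∈-partitions⁻ {n} {μ} μ∈ = isPartition⁻ μ (proj₂ (∈-filter⁻ (λ μ → isPartitionOf n μ Bool.≟ true)
    {xs = concatMap (λ ℓ → map Vec.toList (vecsOf (upTo (suc n)) ℓ)) (upTo (suc n))} μ∈))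

  ∈-vecsOf⁺ : ∀ {A : Set} {xs : List A} (v : List A) → All (_∈ xs) v → v ∈ map Vec.toList (vecsOf xs (length v))
  ∈-vecsOf⁺ {xs = xs} v v∈ = subst (_∈ map Vec.toList (vecsOf xs (length v))) (toList∘fromList v) (∈-map⁺ Vec.toList (lem v v∈))
    where
    open import Data.Vec.Properties using (toList∘fromList)
    lem : ∀ v → All (_∈ xs) v → Vec.fromList v ∈ vecsOf xs (length v)
    lem []      []         = here refl
    lem (x ∷ v) (x∈ ∷ v∈) = ∈-concatMap⁺ (λ x → map (x ∷_) (vecsOf xs (length v)))
      (Any.map (λ { refl → ∈-map⁺ (x ∷_) (lem v v∈) }) x∈)

  ∈-partitions⁺ : ∀ {n μ} → Partition n μ → μ ∈ partitions n
  ∈-partitions⁺ {n} {μ} P@(partition refl pos _) = ∈-filter⁺ (λ μ → isPartitionOf n μ Bool.≟ true)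
    (∈-concatMap⁺ (λ ℓ → map Vec.toList (vecsOf (upTo (suc n)) ℓ)) {xs = upTo (suc n)}
      (Any.map (λ { refl → ∈-vecsOf⁺ μ (All.map (λ k≤n → ∈-upTo⁺ (s≤s k≤n)) (parts μ)) }) (∈-upTo⁺ (s≤s (len pos)))))
    (isPartition⁺ P)
    where
    len : ∀ {μ} → All (1 ≤_) μ → length μ ≤ sum μ
    len []       = z≤n
    len (p ∷ ps) = +-mono-≤ p (len ps)
    parts : ∀ μ → All (_≤ sum μ) μ
    parts []      = []
    parts (k ∷ μ) = m≤m+n k _ ∷ All.map (λ j≤ → ≤-trans j≤ (m≤n+m _ k)) (parts μ)

  -- On the column heights `β` of a Young diagram this inserts a row of length `k`, opening new
  -- columns where `β` is too short.
  addOnes : ℕ → List ℕ → List ℕ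
  addOnes zero    β       = β
  addOnes (suc k) []      = 1 ∷ addOnes k []
  addOnes (suc k) (b ∷ β) = suc b ∷ addOnes k β

  conjugate : List ℕ → List ℕ
  conjugate []      = []
  conjugate (k ∷ ν) = addOnes k (conjugate ν)

  length-addOnes : ∀ k β → length β ≤ k → length (addOnes k β) ≡ k
  length-addOnes zero    []      _        = refl
  length-addOnes (suc k) []      _        = cong suc (length-addOnes k [] z≤n)
  length-addOnes (suc k) (b ∷ β) (s≤s le) = cong suc (length-addOnes k β le)

  length-conjugate : ∀ {k ν} → Linked _≥_ (k ∷ ν) → length (conjugate ν) ≤ k
  length-conjugate [-]                       = z≤n
  length-conjugate (_∷_ {y = k′} {ν} k≥k′ l) =
    ≤-trans (≤-reflexive (length-addOnes k′ (conjugate ν) (length-conjugate l))) k≥k′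

  sum-addOnes : ∀ k β → sum (addOnes k β) ≡ k + sum β
  sum-addOnes zero    β       = refl
  sum-addOnes (suc k) []      = cong suc (sum-addOnes k [])
  sum-addOnes (suc k) (b ∷ β) = cong suc (trans (cong (b +_) (sum-addOnes k β)) (comm b k (sum β)))
    where
    comm : ∀ a b c → a + (b + c) ≡ b + (a + c)
    comm a b c = trans (sym (+-assoc a b c)) (trans (cong (_+ c) (+-comm a b)) (+-assoc b a c))

  positive-addOnes : ∀ k {β} → All (1 ≤_) β → All (1 ≤_) (addOnes k β)
  positive-addOnes zero    ps       = ps
  positive-addOnes (suc k) []       = s≤s z≤n ∷ positive-addOnes k []
  positive-addOnes (suc k) (p ∷ ps) = s≤s z≤n ∷ positive-addOnes k ps

  descending-addOnes : ∀ k {β} → length β ≤ k → Linked _≥_ β → Linked _≥_ (addOnes k β)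
  descending-addOnes zero          {[]}        _        _        = []
  descending-addOnes (suc zero)    {[]}        _        _        = [-]
  descending-addOnes (suc (suc k)) {[]}        _        _        = ≤-refl ∷ descending-addOnes (suc k) z≤n []
  descending-addOnes (suc zero)    {b ∷ []}    _        _        = [-]
  descending-addOnes (suc (suc k)) {b ∷ []}    _        _        = s≤s z≤n ∷ descending-addOnes (suc k) z≤n []
  descending-addOnes (suc (suc k)) {b ∷ c ∷ β} (s≤s le) (r ∷ rs) = s≤s r ∷ descending-addOnes (suc k) le rs
  descending-addOnes (suc zero)    {b ∷ c ∷ β} (s≤s ()) _

  conjugate-partition : ∀ {n ν} → Partition n ν → Partition n (conjugate ν)
  conjugate-partition {ν = ν} (partition refl _ desc) = partition (sum-conjugate ν) (positive ν) (descending desc)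
    where
    sum-conjugate : ∀ ν → sum (conjugate ν) ≡ sum ν
    sum-conjugate []      = refl
    sum-conjugate (k ∷ ν) = trans (sum-addOnes k (conjugate ν)) (cong (k +_) (sum-conjugate ν))
    positive : ∀ ν → All (1 ≤_) (conjugate ν)
    positive []      = []
    positive (k ∷ ν) = positive-addOnes k (positive ν)
    descending : ∀ {ν} → Linked _≥_ ν → Linked _≥_ (conjugate ν)
    descending []        = []
    descending {k ∷ ν} l = descending-addOnes k (length-conjugate l) (descending (Linked.tail l))

  -- The sum over the 0/1 vectors v ≤ α of weight k which occurs in ecoefAux.
  ∑sub : ℕ → List ℕ → (List ℕ → ℕ) → ℕ
  ∑sub k α G = ∑ (map Vec.toList (vecsOf (0 ∷ 1 ∷ []) (length α)))
    (λ v → if ⌊ sum v ≟ k ⌋ ∧ dominated v α then G (zipWith _∸_ α v) else 0)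

  ∑sub-split : ∀ k a α G → ∑sub k (a ∷ α) G ≡ ∑sub k α (G ∘ (a ∷_)) +
    ∑ (vecsOf (0 ∷ 1 ∷ []) (length α)) (λ v → if ⌊ sum (1 ∷ Vec.toList v) ≟ k ⌋ ∧ dominated (1 ∷ Vec.toList v) (a ∷ α)
      then G (zipWith _∸_ (a ∷ α) (1 ∷ Vec.toList v)) else 0)
  ∑sub-split k a α G = trans (∑-map Vec.toList (vecsOf (0 ∷ 1 ∷ []) (suc (length α))) _)
    (trans (∑-vecs (0 ∷ 1 ∷ []) (length α) _) (cong₂ _+_
      (sym (∑-map Vec.toList (vecsOf (0 ∷ 1 ∷ []) (length α)) _)) (+-identityʳ _)))

  ∑sub-suc : ∀ k a α G → ∑sub (suc k) (suc a ∷ α) G ≡ ∑sub (suc k) α (G ∘ (suc a ∷_)) + ∑sub k α (G ∘ (a ∷_))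
  ∑sub-suc k a α G = trans (∑sub-split (suc k) (suc a) α G) (cong (∑sub (suc k) α (G ∘ (suc a ∷_)) +_)
    (trans (∑-cong (vecsOf (0 ∷ 1 ∷ []) (length α)) (λ v →
       cong (λ b → if b ∧ dominated (Vec.toList v) α then G (a ∷ zipWith _∸_ α (Vec.toList v)) else 0)
       (trans (isYes≗does (suc (sum (Vec.toList v)) ≟ suc k)) (sym (isYes≗does (sum (Vec.toList v) ≟ k))))))
     (sym (∑-map Vec.toList (vecsOf (0 ∷ 1 ∷ []) (length α)) _))))

  ∑sub-zero : ∀ k α G → ∑sub k (0 ∷ α) G ≡ ∑sub k α (G ∘ (0 ∷_))
  ∑sub-zero k α G = trans (∑sub-split k 0 α G) (trans (cong (∑sub k α (G ∘ (0 ∷_)) +_)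
    (∑-0 (vecsOf (0 ∷ 1 ∷ []) (length α)) (λ {v} _ → never ⌊ suc (sum (Vec.toList v)) ≟ k ⌋))) (+-identityʳ _))
    where
    never : ∀ b {x} → (if b ∧ false then x else 0) ≡ 0
    never true  = refl
    never false = refl

  -- A variable whose exponent is used up stays in the list with exponent 0; `t` counts such
  -- variables.
  pad : List ℕ → ℕ → List ℕ
  pad α t = α ++ replicate t 0

  ∑sub-zeros : ∀ t G → ∑sub 0 (replicate t 0) G ≡ G (replicate t 0)
  ∑sub-zeros zero    G = +-identityʳ _
  ∑sub-zeros (suc t) G = trans (∑sub-zero 0 (replicate t 0) G) (∑sub-zeros t (G ∘ (0 ∷_)))

  -- Only the first `k′` entries are positive, so no 0/1 vector of weight `k > k′` fits below the
  -- list.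
  ∑sub-tooMany : ∀ {k} k′ β t G → length β ≤ k′ → k′ < k → ∑sub k (pad (addOnes k′ β) t) G ≡ 0
  ∑sub-tooMany {suc k} zero     []      zero    G _        _          = refl
  ∑sub-tooMany {suc k} zero     []      (suc t) G _        lt         =
    trans (∑sub-zero (suc k) (replicate t 0) G) (∑sub-tooMany zero [] t (G ∘ (0 ∷_)) z≤n lt)
  ∑sub-tooMany {suc k} (suc k′) []      t       G le       (s≤s k′<k) =
    trans (∑sub-suc k 0 (pad (addOnes k′ []) t) G)
      (cong₂ _+_ (∑sub-tooMany k′ [] t (G ∘ (1 ∷_)) z≤n (m<n⇒m<1+n k′<k)) (∑sub-tooMany k′ [] t (G ∘ (0 ∷_)) z≤n k′<k))
  ∑sub-tooMany {suc k} (suc k′) (b ∷ β) t       G (s≤s le) (s≤s k′<k) =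
    trans (∑sub-suc k b (pad (addOnes k′ β) t) G)
      (cong₂ _+_ (∑sub-tooMany k′ β t (G ∘ (suc b ∷_)) le (m<n⇒m<1+n k′<k)) (∑sub-tooMany k′ β t (G ∘ (b ∷_)) le k′<k))

  -- Exactly `k` entries are positive, so the 0/1 vector is forced. Subtracting it undoes `addOnes`
  -- and leaves a zero in each column that was opened.
  ∑sub-exact : ∀ k β t G → length β ≤ k → ∑sub k (pad (addOnes k β) t) G ≡ G (pad β (k ∸ length β + t))
  ∑sub-exact zero    []      t G _        = ∑sub-zeros t G
  ∑sub-exact (suc k) []      t G le       =
    trans (∑sub-suc k 0 (pad (addOnes k []) t) G)
      (cong₂ _+_ (∑sub-tooMany k [] t (G ∘ (1 ∷_)) z≤n ≤-refl) (∑sub-exact k [] t (G ∘ (0 ∷_)) z≤n))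
  ∑sub-exact (suc k) (b ∷ β) t G (s≤s le) =
    trans (∑sub-suc k b (pad (addOnes k β) t) G)
      (cong₂ _+_ (∑sub-tooMany k β t (G ∘ (suc b ∷_)) le ≤-refl) (∑sub-exact k β t (G ∘ (b ∷_)) le))

  data _>ₗ_ : List ℕ → List ℕ → Set where
    nil  : ∀ {k μ} → (k ∷ μ) >ₗ []
    this : ∀ {k k′ μ ν} → k′ < k → (k ∷ μ) >ₗ (k′ ∷ ν)
    next : ∀ {k μ ν} → μ >ₗ ν → (k ∷ μ) >ₗ (k ∷ ν)

  -- As long as the parts of `μ` and `ν` agree, each part removes one row of the diagram. At the
  -- first difference `μ` asks for more variables than still have a positive exponent.
  ecoefAux-above : ∀ {μ ν} t → All (1 ≤_) μ → Linked _≥_ ν → μ >ₗ ν → ecoefAux μ (pad (conjugate ν) t) ≡ 0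
  ecoefAux-above {k ∷ μ}          t (k≥1 ∷ _) _ nil         = ∑sub-tooMany {k} 0 [] t (ecoefAux μ) z≤n k≥1
  ecoefAux-above {k ∷ μ} {k′ ∷ ν} t _         l (this k′<k) =
    ∑sub-tooMany {k} k′ (conjugate ν) t (ecoefAux μ) (length-conjugate l) k′<k
  ecoefAux-above {k ∷ μ} {_ ∷ ν}  t (_ ∷ pos) l (next gt)   =
    trans (∑sub-exact k (conjugate ν) t (ecoefAux μ) (length-conjugate l)) (ecoefAux-above _ pos (Linked.tail l) gt)

  -- The diagonal entry: each part removes its row of the diagram in the only possible way. Together
  -- with `ecoefAux-above` this is unitriangularity for the order `_>ₗ_`.
  ecoefAux-conjugate : ∀ {ν} t → Linked _≥_ ν → ecoefAux ν (pad (conjugate ν) t) ≡ 1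
  ecoefAux-conjugate {[]}    t _ = cong (λ b → if b then 1 else 0) (zeros t)
    where
    zeros : ∀ t → all (λ a → ⌊ a ≟ 0 ⌋) (replicate t 0) ≡ true
    zeros zero    = refl
    zeros (suc t) = zeros t
  ecoefAux-conjugate {k ∷ ν} t l =
    trans (∑sub-exact k (conjugate ν) t (ecoefAux ν) (length-conjugate l)) (ecoefAux-conjugate _ (Linked.tail l))

  data Compare (μ ν : List ℕ) : Set where
    above : μ >ₗ ν → Compare μ ν
    equal : μ ≡ ν → Compare μ ν
    below : ν >ₗ μ → Compare μ ν

  compareₗ : ∀ μ ν → Compare μ ν
  compareₗ []      []       = equal refl
  compareₗ []      (_ ∷ _)  = below nil
  compareₗ (_ ∷ _) []       = above nil
  compareₗ (k ∷ μ) (k′ ∷ ν) with <-cmp k k′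
  ... | tri< lt _ _ = below (this lt)
  ... | tri> _ _ gt = above (this gt)
  ... | tri≈ _ refl _ with compareₗ μ ν
  ... | above gt   = above (next gt)
  ... | equal refl = equal refl
  ... | below lt   = below (next lt)

  >ₗ-trans : ∀ {λ′ μ ν} → λ′ >ₗ μ → μ >ₗ ν → λ′ >ₗ ν
  >ₗ-trans (this _)   nil        = nil
  >ₗ-trans (next _)   nil        = nil
  >ₗ-trans (this a)   (this b)   = this (<-trans b a)
  >ₗ-trans (this a)   (next _)   = this a
  >ₗ-trans (next _)   (this b)   = this b
  >ₗ-trans (next a)   (next b)   = next (>ₗ-trans a b)

  data Descending : List (List ℕ) → Set where
    []  : Descending []
    _∷_ : ∀ {μ Λ} → All (μ >ₗ_) Λ → Descending Λ → Descending (μ ∷ Λ)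

  insert : List ℕ → List (List ℕ) → List (List ℕ)
  insert μ []      = μ ∷ []
  insert μ (ν ∷ Λ) with compareₗ μ ν
  ... | above _ = μ ∷ ν ∷ Λ
  ... | equal _ = ν ∷ Λ
  ... | below _ = ν ∷ insert μ Λ

  insert-all : ∀ {P : List ℕ → Set} μ {Λ} → P μ → All P Λ → All P (insert μ Λ)
  insert-all μ p [] = p ∷ []
  insert-all μ {ν ∷ Λ} p (r ∷ rs) with compareₗ μ ν
  ... | above _ = p ∷ r ∷ rs
  ... | equal _ = r ∷ rs
  ... | below _ = r ∷ insert-all μ p rs

  insert-descending : ∀ μ {Λ} → Descending Λ → Descending (insert μ Λ)
  insert-descending μ [] = [] ∷ []
  insert-descending μ {ν ∷ Λ} (r ∷ rs) with compareₗ μ ν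
  ... | above gt = (gt ∷ All.map (>ₗ-trans gt) r) ∷ r ∷ rs
  ... | equal _  = r ∷ rs
  ... | below lt = insert-all μ lt r ∷ insert-descending μ rs

  insert-here : ∀ μ Λ → μ ∈ insert μ Λ
  insert-here μ []      = here refl
  insert-here μ (ν ∷ Λ) with compareₗ μ ν
  ... | above _    = here refl
  ... | equal refl = here refl
  ... | below _    = there (insert-here μ Λ)

  insert-there : ∀ {ρ} μ Λ → ρ ∈ Λ → ρ ∈ insert μ Λ
  insert-there μ (ν ∷ Λ) ρ∈ with compareₗ μ ν | ρ∈
  ... | above _ | _       = there ρ∈
  ... | equal _ | _       = ρ∈
  ... | below _ | here e  = here e
  ... | below _ | there a = there (insert-there μ Λ a)

  descendingOf : ∀ {P : List ℕ → Set} (Λ : List (List ℕ)) → All P Λ →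
    ∃ λ Λ′ → Descending Λ′ × All P Λ′ × (∀ {μ} → μ ∈ Λ → μ ∈ Λ′)
  descendingOf []      []       = [] , [] , [] , λ ()
  descendingOf (μ ∷ Λ) (p ∷ ps) = let Λ′ , d , q , sub = descendingOf Λ ps in
    insert μ Λ′ , insert-descending μ d , insert-all μ p q ,
    λ { (here refl) → insert-here μ Λ′ ; (there a) → insert-there μ Λ′ (sub a) }

  -- The list stands for a linear functional, the sum of `z` times the coefficient of x^ν, and `φ`
  -- for a symmetric function given by its coefficients.
  combine : List (ℤ × List ℕ) → (List ℕ → ℤ) → ℤ
  combine []            φ = 0ℤ
  combine ((z , ν) ∷ b) φ = z ℤ.* φ ν ℤ.+ combine b φ

  -- Triangular elimination from the largest partition downwards. Extracting the coefficient at the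
  -- conjugate of `μ` gives 1 on e_μ, and what it contributes at smaller partitions is subtracted
  -- from the values still to be attained. The last conclusion is an induction invariant: the terms
  -- added for smaller partitions do not disturb the value at e_μ.
  solve : ∀ {n} {Λ : List (List ℕ)} → Descending Λ → All (Partition n) Λ → (r : List ℕ → ℤ) →
    ∃ λ b → All (λ t → proj₂ t ∈ partitions n) b × (∀ {μ} → μ ∈ Λ → r μ ≡ combine b (ecoef μ)) ×
      (∀ {μ} → All (1 ≤_) μ → All (μ >ₗ_) Λ → combine b (ecoef μ) ≡ 0ℤ)
  solve []             _        r = [] , [] , (λ ()) , (λ _ _ → refl)
  solve {n} {μ ∷ Λ} (gt ∷ d) (p ∷ ps) r with solve d ps (λ ρ → r ρ ℤ.- r μ ℤ.* ecoef ρ (conjugate μ))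
  ... | b , b∈ , solves , vanishes =
    (r μ , conjugate μ) ∷ b , ∈-partitions⁺ (conjugate-partition p) ∷ b∈ , solves′ , vanishes′
    where
    open Partition p
    unpadded : ∀ ρ → ecoefAux ρ (conjugate μ) ≡ ecoefAux ρ (pad (conjugate μ) 0)
    unpadded ρ = cong (ecoefAux ρ) (sym (++-identityʳ (conjugate μ)))
    solves′ : ∀ {ρ} → ρ ∈ μ ∷ Λ → r ρ ≡ r μ ℤ.* ecoef ρ (conjugate μ) ℤ.+ combine b (ecoef ρ)
    solves′ (here refl) rewrite vanishes positive gt
      | trans (unpadded μ) (ecoefAux-conjugate 0 descending) = sym (trans (ℤ.+-identityʳ _) (ℤ.*-identityʳ (r μ)))
    solves′ {ρ} (there ρ∈) = trans (add-back (r ρ) (r μ ℤ.* ecoef ρ (conjugate μ)))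
      (cong (λ z → r μ ℤ.* ecoef ρ (conjugate μ) ℤ.+ z) (solves ρ∈))
      where
      add-back : ∀ x y → x ≡ y ℤ.+ (x ℤ.- y)
      add-back = ℤSolver.solve-∀
    vanishes′ : ∀ {ρ} → All (1 ≤_) ρ → All (ρ >ₗ_) (μ ∷ Λ) → r μ ℤ.* ecoef ρ (conjugate μ) ℤ.+ combine b (ecoef ρ) ≡ 0ℤ
    vanishes′ {ρ} pos (gt ∷ gts) rewrite vanishes pos gts | trans (unpadded ρ) (ecoefAux-above 0 pos descending gt) =
      trans (ℤ.+-identityʳ _) (ℤ.*-zeroʳ (r μ))

  -- Every function on the partitions of n extends linearly from the e_λ to symmetric functions;
  -- b lists its values on a spanning set of monomial symmetric functions.
  monomialFunctional : ∀ n (g : List ℕ → ℤ) → ∃ λ b → All (λ t → proj₂ t ∈ partitions n) b ×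
    (∀ {μ} → μ ∈ partitions n → g μ ≡ combine b (ecoef μ))
  monomialFunctional n g with descendingOf (partitions n) (All.tabulate {xs = partitions n} (∈-partitions⁻ {n}))
  ... | Λ , d , ps , sub with solve d ps g
  ... | b , b∈ , solves , _ = b , b∈ , λ {μ} μ∈ → solves (sub {μ} μ∈)

-- Vectors over a finite field, listed up to the field equality

module FieldVectors where

  open import Data.Nat as ℕ using (ℕ; zero; suc)
  import Data.Nat.Properties as ℕ
  open import Data.Bool as Bool using (Bool; true; false; _∧_)
  open import Data.Bool.Properties using (⇔→≡)
  open import Data.Bool.ListAction using (all; any)
  open import Data.List as List using (List; []; _∷_; map; length; concatMap)
  open import Data.List.Membership.Propositional using (_∈_; find)
  open import Data.List.Relation.Unary.Any as Any using (Any; here; there)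
  import Data.List.Relation.Unary.Any.Properties as Any
  open import Data.List.Relation.Unary.All as All using (All; []; _∷_)
  import Data.List.Relation.Unary.All.Properties as All
  open import Data.List.Relation.Unary.AllPairs as AllPairs using (AllPairs; []; _∷_)
  import Data.List.Relation.Unary.AllPairs.Properties as AllPairs
  open import Data.Vec as Vec using (Vec; []; _∷_)
  open import Data.Vec.Relation.Binary.Pointwise.Inductive as PW using (Pointwise; []; _∷_)
  open import Data.Product using (∃; _×_; _,_)
  open import Function using (_∘_; mk⇔)
  open import Relation.Nullary using (¬_; Dec; yes; no; contradiction)
  open import Relation.Nullary.Decidable using (⌊_⌋)
  open import Relation.Binary.PropositionalEquality as ≡ using (_≡_; refl; cong; cong₂)
  open import Algebra.Bundles using (CommutativeRing)
  open import Defs using (vecsOf; FiniteField)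
  open Sums

  private variable A B : Set

  true-≡ : ∀ {a b} → (a ≡ true → b ≡ true) → (b ≡ true → a ≡ true) → a ≡ b
  true-≡ f g = ⇔→≡ (mk⇔ f g)

  all⁻ : ∀ {p : A → Bool} {xs} → all p xs ≡ true → ∀ {x} → x ∈ xs → p x ≡ true
  all⁻ {p = p} {x ∷ xs} eq x∈ with p x in px | x∈
  ... | true | here refl = px
  ... | true | there y∈  = all⁻ eq y∈

  all⁺ : ∀ {p : A → Bool} xs → (∀ {x} → x ∈ xs → p x ≡ true) → all p xs ≡ true
  all⁺ []       f = refl
  all⁺ (x ∷ xs) f rewrite f (here refl) = all⁺ xs (f ∘ there)

  any⁻ : ∀ {p : A → Bool} xs → any p xs ≡ true → ∃ λ x → x ∈ xs × p x ≡ true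
  any⁻ {p = p} (x ∷ xs) eq with p x in px
  ... | true  = x , here refl , px
  ... | false = let y , y∈ , py = any⁻ xs eq in y , there y∈ , py

  any⁺ : ∀ {p : A → Bool} {xs x} → x ∈ xs → p x ≡ true → any p xs ≡ true
  any⁺ {p = p} (here refl) px rewrite px = refl
  any⁺ {p = p} {y ∷ ys} (there x∈) px with p y
  ... | true  = refl
  ... | false = any⁺ x∈ px

  module _ (_∼_ : A → A → Set) where

    Distinct : List A → Set
    Distinct = AllPairs (λ a b → ¬ (a ∼ b))

    ∑-unique : ∀ {xs} (p : A → Bool) → Distinct xs →
      (∀ {x y} → x ∈ xs → y ∈ xs → p x ≡ true → p y ≡ true → x ∼ y) →
      ∀ {x} → x ∈ xs → p x ≡ true → ∑ xs (𝟙 ∘ p) ≡ 1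
    ∑-unique p (d ∷ ds) uniq (here refl) px rewrite px =
      cong suc (∑-0 _ (λ {y} y∈ → lem y (λ py → All.lookup d y∈ (uniq (here refl) (there y∈) px py))))
      where
      lem : ∀ y → ¬ (p y ≡ true) → 𝟙 (p y) ≡ 0
      lem y ne with p y
      ... | true  = contradiction refl ne
      ... | false = refl
    ∑-unique {y ∷ ys} p (d ∷ ds) uniq (there x∈) px with p y in py
    ... | true  = contradiction (uniq (here refl) (there x∈) py px) (All.lookup d x∈)
    ... | false = ∑-unique p ds (λ x∈ y∈ → uniq (there x∈) (there y∈)) x∈ px

    record Enumerates (xs : List A) : Set where
      field
        complete : ∀ a → Any (a ∼_) xs
        distinct : Distinct xs

    -- Elements are listed only up to `∼`: the sum meets the representative of `a` in the list, and
    -- `f` must respect `∼` for its value there to be the value at `a`.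
    ∑-δ : ∀ {xs} → Enumerates xs → (_≟_ : ∀ a b → Dec (a ∼ b)) → (∀ {a b} → a ∼ b → b ∼ a) →
      (∀ {a b c} → a ∼ b → b ∼ c → a ∼ c) → ∀ a (f : A → ℕ) → (∀ {x} → a ∼ x → f x ≡ f a) →
      ∑ xs (λ x → 𝟙 ⌊ a ≟ x ⌋ ℕ.* f x) ≡ f a
    ∑-δ {xs} E _≟_ sym trans a f resp = begin
      ∑ xs (λ x → 𝟙 ⌊ a ≟ x ⌋ ℕ.* f x)     ≡⟨ ∑-cong xs (λ x → lem x (a ≟ x)) ⟩
      ∑ xs (λ x → 𝟙 ⌊ a ≟ x ⌋ ℕ.* f a)     ≡⟨ ∑-*ʳ xs (f a) _ ⟩
      ∑ xs (λ x → 𝟙 ⌊ a ≟ x ⌋) ℕ.* f a     ≡⟨ cong (ℕ._* f a) one ⟩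
      1 ℕ.* f a                            ≡⟨ ℕ.*-identityˡ (f a) ⟩
      f a                                  ∎
      where
      open ≡.≡-Reasoning
      lem : ∀ x (d : Dec (a ∼ x)) → 𝟙 ⌊ d ⌋ ℕ.* f x ≡ 𝟙 ⌊ d ⌋ ℕ.* f a
      lem x (yes a∼x) = cong (1 ℕ.*_) (resp a∼x)
      lem x (no _)    = refl
      witness : ∀ x → ⌊ a ≟ x ⌋ ≡ true → a ∼ x
      witness x eq with a ≟ x
      ... | yes a∼x = a∼x
      one : ∑ xs (λ x → 𝟙 ⌊ a ≟ x ⌋) ≡ 1
      one = let x , x∈ , a∼x = find (Enumerates.complete E a) in
        ∑-unique (λ x → ⌊ a ≟ x ⌋) (Enumerates.distinct E)
          (λ {x} {y} _ _ px py → trans (sym (witness x px)) (witness y py)) x∈ (⌊⌋-true (a ≟ x) a∼x)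

  distinct-vecs : ∀ {_∼_ : A → A → Set} {xs} → Distinct _∼_ xs → ∀ k → Distinct (Pointwise _∼_ {k}) (vecsOf xs k)
  distinct-vecs d zero = [] ∷ []
  distinct-vecs {_∼_ = _∼_} {xs} d (suc k) = go xs d
    where
    tails = distinct-vecs d k
    head-apart : ∀ {x ys} → All (λ y → ¬ (x ∼ y)) ys → ∀ {v} →
      All (λ w → ¬ Pointwise _∼_ (x ∷ v) w) (concatMap (λ y → map (y ∷_) (vecsOf xs k)) ys)
    head-apart []       = []
    head-apart {x} {y ∷ ys} (d ∷ ds) =
      All.++⁺ (All.map⁺ (All.universal (λ _ → λ { (x∼y ∷ _) → d x∼y }) (vecsOf xs k))) (head-apart ds)
    go : ∀ ys → Distinct _∼_ ys → Distinct (Pointwise _∼_) (concatMap (λ y → map (y ∷_) (vecsOf xs k)) ys)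
    go []       []       = []
    go (y ∷ ys) (d ∷ ds) = AllPairs.++⁺
      (AllPairs.map⁺ (AllPairs.map (λ ne → λ { (_ ∷ p) → ne p }) tails))
      (go ys ds) (All.map⁺ (All.universal (λ _ → head-apart d) (vecsOf xs k)))

  complete-vecs : ∀ {_∼_ : A → A → Set} {xs} → (∀ a → Any (a ∼_) xs) → ∀ k (v : Vec A k) → Any (Pointwise _∼_ v) (vecsOf xs k)
  complete-vecs c zero    []      = here []
  complete-vecs {xs = xs} c (suc k) (x ∷ v) =
    Any.concatMap⁺ (λ y → map (y ∷_) (vecsOf xs k))
      (Any.map (λ x∼y → Any.map⁺ (Any.map (λ p → x∼y ∷ p) (complete-vecs c k v))) (c x))

  length-vecsOf : ∀ (xs : List A) k → length (vecsOf xs k) ≡ length xs ℕ.^ k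
  length-vecsOf xs zero    = refl
  length-vecsOf xs (suc k) = begin
    length (vecsOf xs (suc k))                            ≡⟨ ∑-1 (vecsOf xs (suc k)) ⟨
    ∑ (vecsOf xs (suc k)) (λ _ → 1)                       ≡⟨ ∑-vecs xs k _ ⟩
    ∑ xs (λ _ → ∑ (vecsOf xs k) (λ _ → 1))
      ≡⟨ ∑-cong xs (λ _ → ≡.trans (∑-1 (vecsOf xs k)) (length-vecsOf xs k)) ⟩
    ∑ xs (λ _ → length xs ℕ.^ k)                          ≡⟨ ∑-cong xs (λ _ → ≡.sym (ℕ.*-identityˡ _)) ⟩
    ∑ xs (λ _ → 1 ℕ.* length xs ℕ.^ k)                    ≡⟨ ∑-*ʳ xs (length xs ℕ.^ k) (λ _ → 1) ⟩
    ∑ xs (λ _ → 1) ℕ.* length xs ℕ.^ k                    ≡⟨ cong (ℕ._* length xs ℕ.^ k) (∑-1 xs) ⟩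
    length xs ℕ.^ suc k                                   ∎
    where open ≡.≡-Reasoning

  module RingIdentities {c ℓ} (C : CommutativeRing c ℓ) where
    open CommutativeRing C renaming (refl to ≈-refl; sym to ≈-sym; trans to ≈-trans)
    open import Algebra.Solver.Ring.NaturalCoefficients.Default commutativeSemiring
      using (solve; _:=_; _:+_; _:*_)

    +-·-interchange : ∀ x y z c d → (x + y) + (c + d) * z ≈ (x + c * z) + (y + d * z)
    +-·-interchange = solve 5 (λ x y z c d → (x :+ y) :+ (c :+ d) :* z := (x :+ c :* z) :+ (y :+ d :* z)) ≈-refl

    ·-+-distrib : ∀ a c x y → a * x + (a * c) * y ≈ a * (x + c * y)
    ·-+-distrib = solve 4 (λ a c x y → a :* x :+ (a :* c) :* y := a :* (x :+ c :* y)) ≈-refl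

    dot-step : ∀ a x y c s t → a * (x + c * y) + (s + c * t) ≈ (a * x + s) + c * (a * y + t)
    dot-step = solve 6 (λ a x y c s t → a :* (x :+ c :* y) :+ (s :+ c :* t) := (a :* x :+ s) :+ c :* (a :* y :+ t)) ≈-refl

    combine-step : ∀ a x y v u w → (x + a * y) * v + (u + a * w) ≈ (x * v + u) + a * (y * v + w)
    combine-step = solve 6 (λ a x y v u w →
      (x :+ a :* y) :* v :+ (u :+ a :* w) := (x :* v :+ u) :+ a :* (y :* v :+ w)) ≈-refl

    -- In the following semiring identities m stands for - c, - y or - 1.
    cancel-step : ∀ x y c m → (x + c * y) + m * y ≈ x + (c + m) * y
    cancel-step = solve 4 (λ x y c m → (x :+ c :* y) :+ m :* y := x :+ (c :+ m) :* y) ≈-refl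

    difference-step : ∀ x y c d m → (x + c * y) + m * (x + d * y) ≈ (c + m * d) * y + (x + m * x)
    difference-step = solve 5 (λ x y c d m →
      (x :+ c :* y) :+ m :* (x :+ d :* y) := (c :+ m :* d) :* y :+ (x :+ m :* x)) ≈-refl

    isolate-step : ∀ x z c y m → (y * c) * x + m * (c * x + z) ≈ m * z + (y + m) * (c * x)
    isolate-step = solve 5 (λ x z c y m → (y :* c) :* x :+ m :* (c :* x :+ z) := m :* z :+ (y :+ m) :* (c :* x)) ≈-refl

    kill : ∀ x y {c} → c ≈ 0# → x + c * y ≈ x
    kill x y c≈0 = ≈-trans (+-congˡ (≈-trans (*-congʳ c≈0) (zeroˡ y))) (+-identityʳ x)

    self-cancel : ∀ a → a + - 1# * a ≈ 0#
    self-cancel a = ≈-trans (+-congʳ (≈-sym (*-identityˡ a)))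
      (≈-trans (≈-sym (distribʳ a 1# (- 1#))) (≈-trans (*-congʳ (-‿inverseʳ 1#)) (zeroˡ a)))

  module Vectors (F : FiniteField) where
    open FiniteField F renaming (refl to ≈-refl; sym to ≈-sym; trans to ≈-trans)
    open RingIdentities commutativeRing

    infix 4 _≋_
    _≋_ : ∀ {k} → Vec Carrier k → Vec Carrier k → Set
    _≋_ = Pointwise _≈_

    ≋-refl : ∀ {k} {u : Vec Carrier k} → u ≋ u
    ≋-refl = PW.refl ≈-refl

    ≋-sym : ∀ {k} {u v : Vec Carrier k} → u ≋ v → v ≋ u
    ≋-sym = PW.sym ≈-sym

    ≋-trans : ∀ {k} {u v w : Vec Carrier k} → u ≋ v → v ≋ w → u ≋ w
    ≋-trans = PW.trans ≈-trans

    ≈b⁺ : ∀ {a b} → a ≈ b → (a ≈b b) ≡ true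
    ≈b⁺ {a} {b} = ⌊⌋-true (a ≟ b)

    ≋⁻ : ∀ {k} {u v : Vec Carrier k} → (u ≈ᵥ v) ≡ true → u ≋ v
    ≋⁻ {u = []}    {[]}    _  = []
    ≋⁻ {u = a ∷ u} {b ∷ v} eq with a ≟ b
    ... | yes p = p ∷ ≋⁻ eq

    ≋⁺ : ∀ {k} {u v : Vec Carrier k} → u ≋ v → (u ≈ᵥ v) ≡ true
    ≋⁺ []       = refl
    ≋⁺ (p ∷ ps) = cong₂ _∧_ (≈b⁺ p) (≋⁺ ps)

    _≋?_ : ∀ {k} (u v : Vec Carrier k) → Dec (u ≋ v)
    u ≋? v = PW.decidable _≟_ u v

    ≋?-≈ᵥ : ∀ {k} (u v : Vec Carrier k) → ⌊ u ≋? v ⌋ ≡ (u ≈ᵥ v)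
    ≋?-≈ᵥ u v = true-≡ (λ e → ≋⁺ (witness (u ≋? v) e)) (λ e → ⌊⌋-true (u ≋? v) (≋⁻ e))
      where
      witness : (d : Dec (u ≋ v)) → ⌊ d ⌋ ≡ true → u ≋ v
      witness (yes p) _ = p

    vecs-enumerate : ∀ k → Enumerates _≋_ (allVecs k)
    vecs-enumerate k = record { complete = complete-vecs complete k ; distinct = distinct-vecs distinct k }

    ∑-δᵥ : ∀ {k} a (f : Vec Carrier k → ℕ) → (∀ {x} → a ≋ x → f x ≡ f a) →
      ∑ (allVecs k) (λ x → 𝟙 (a ≈ᵥ x) ℕ.* f x) ≡ f a
    ∑-δᵥ {k} a f resp = ≡.trans (∑-cong (allVecs k) (λ x → cong (λ b → 𝟙 b ℕ.* f x) (≡.sym (≋?-≈ᵥ a x))))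
      (∑-δ _≋_ (vecs-enumerate k) _≋?_ ≋-sym ≋-trans a f resp)

    -- `φ` and `ψ` are inverse only up to `≋`. A Kronecker delta spreads each value of `φ` over the
    -- list; after the sums are exchanged, it is read as a delta for `ψ`.
    ∑-reindex : ∀ {k} (φ ψ : Vec Carrier k → Vec Carrier k) → (∀ {x y} → φ x ≋ y → ψ y ≋ x) → (∀ {x y} → ψ y ≋ x → φ x ≋ y) →
      (f : Vec Carrier k → ℕ) → (∀ {x y} → x ≋ y → f x ≡ f y) → ∑ (allVecs k) (f ∘ φ) ≡ ∑ (allVecs k) f
    ∑-reindex {k} φ ψ to from f resp = begin
      ∑ vs (f ∘ φ)                                        ≡⟨ ∑-cong vs (λ x → ≡.sym (∑-δᵥ (φ x) f (λ e → resp (≋-sym e)))) ⟩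
      ∑ vs (λ x → ∑ vs (λ y → 𝟙 (φ x ≈ᵥ y) ℕ.* f y))      ≡⟨ ∑-swap vs vs _ ⟩
      ∑ vs (λ y → ∑ vs (λ x → 𝟙 (φ x ≈ᵥ y) ℕ.* f y))
        ≡⟨ ∑-cong vs (λ y → ∑-cong vs (λ x → cong (λ b → 𝟙 b ℕ.* f y) (true-≡ (≋⁺ ∘ to ∘ ≋⁻) (≋⁺ ∘ from ∘ ≋⁻)))) ⟩
      ∑ vs (λ y → ∑ vs (λ x → 𝟙 (ψ y ≈ᵥ x) ℕ.* f y))      ≡⟨ ∑-cong vs (λ y → ∑-δᵥ (ψ y) (λ _ → f y) (λ _ → refl)) ⟩
      ∑ vs f                                              ∎
      where
      open ≡.≡-Reasoning
      vs = allVecs k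

    +ᵥ-cong : ∀ {k} {u u′ v v′ : Vec Carrier k} → u ≋ u′ → v ≋ v′ → u +ᵥ v ≋ u′ +ᵥ v′
    +ᵥ-cong []       []       = []
    +ᵥ-cong (p ∷ ps) (r ∷ rs) = +-cong p r ∷ +ᵥ-cong ps rs

    ·ᵥ-cong : ∀ {k c d} {u v : Vec Carrier k} → c ≈ d → u ≋ v → c ·ᵥ u ≋ d ·ᵥ v
    ·ᵥ-cong c []       = []
    ·ᵥ-cong c (p ∷ ps) = *-cong c p ∷ ·ᵥ-cong c ps

    infixl 6 _-ᵥ_
    _-ᵥ_ : ∀ {k} → Vec Carrier k → Vec Carrier k → Vec Carrier k
    u -ᵥ v = u +ᵥ ((- 1#) ·ᵥ v)

    zero-·ᵥ : ∀ {k c} (v : Vec Carrier k) → c ≈ 0# → c ·ᵥ v ≋ zeroV k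
    zero-·ᵥ []      c≈0 = []
    zero-·ᵥ (a ∷ v) c≈0 = ≈-trans (*-congʳ c≈0) (zeroˡ a) ∷ zero-·ᵥ v c≈0

    ·ᵥ-zero : ∀ {k} c → c ·ᵥ zeroV k ≋ zeroV k
    ·ᵥ-zero {zero}  c = []
    ·ᵥ-zero {suc k} c = zeroʳ c ∷ ·ᵥ-zero c

    +ᵥ-identityʳ : ∀ {k} (v : Vec Carrier k) → v +ᵥ zeroV k ≋ v
    +ᵥ-identityʳ []      = []
    +ᵥ-identityʳ (a ∷ v) = +-identityʳ a ∷ +ᵥ-identityʳ v

    +ᵥ-identityˡ : ∀ {k} (v : Vec Carrier k) → zeroV k +ᵥ v ≋ v
    +ᵥ-identityˡ []      = []
    +ᵥ-identityˡ (a ∷ v) = +-identityˡ a ∷ +ᵥ-identityˡ v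

    one-·ᵥ : ∀ {k c} (v : Vec Carrier k) → c ≈ 1# → c ·ᵥ v ≋ v
    one-·ᵥ []      _   = []
    one-·ᵥ (a ∷ v) c≈1 = ≈-trans (*-congʳ c≈1) (*-identityˡ a) ∷ one-·ᵥ v c≈1

    -ᵥ-self : ∀ {k} (v : Vec Carrier k) → v -ᵥ v ≋ zeroV k
    -ᵥ-self []      = []
    -ᵥ-self (a ∷ v) = self-cancel a ∷ -ᵥ-self v

    -ᵥ-zero : ∀ {k} {u v : Vec Carrier k} → u -ᵥ v ≋ zeroV k → u ≋ v
    -ᵥ-zero {u = []}    {[]}    []       = []
    -ᵥ-zero {u = a ∷ u} {b ∷ v} (p ∷ ps) = ≈-trans
      (≈-sym (kill a b (-‿inverseˡ 1#)))
      (≈-trans (≈-sym (cancel-step a b (- 1#) 1#)) (≈-trans (+-congʳ p) (≈-trans (+-identityˡ _) (*-identityˡ b)))) ∷ -ᵥ-zero ps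

    +-·ᵥ : ∀ {k} (u v w : Vec Carrier k) c d → (u +ᵥ v) +ᵥ ((c + d) ·ᵥ w) ≋ (u +ᵥ (c ·ᵥ w)) +ᵥ (v +ᵥ (d ·ᵥ w))
    +-·ᵥ []      []      []      c d = []
    +-·ᵥ (x ∷ u) (y ∷ v) (z ∷ w) c d = +-·-interchange x y z c d ∷ +-·ᵥ u v w c d

    ·ᵥ-+ : ∀ {k} a c (u v : Vec Carrier k) → (a ·ᵥ u) +ᵥ ((a * c) ·ᵥ v) ≋ a ·ᵥ (u +ᵥ (c ·ᵥ v))
    ·ᵥ-+ a c []      []      = []
    ·ᵥ-+ a c (x ∷ u) (y ∷ v) = ·-+-distrib a c x y ∷ ·ᵥ-+ a c u v

    shift-back : ∀ {k} c (u v : Vec Carrier k) → (u +ᵥ (c ·ᵥ v)) +ᵥ ((- c) ·ᵥ v) ≋ u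
    shift-back c []      []      = []
    shift-back c (x ∷ u) (y ∷ v) = ≈-trans (cancel-step x y c (- c)) (kill x y (-‿inverseʳ c)) ∷ shift-back c u v

    shift-forth : ∀ {k} c (u v : Vec Carrier k) → (u +ᵥ ((- c) ·ᵥ v)) +ᵥ (c ·ᵥ v) ≋ u
    shift-forth c []      []      = []
    shift-forth c (x ∷ u) (y ∷ v) = ≈-trans (cancel-step x y (- c) c) (kill x y (-‿inverseˡ c)) ∷ shift-forth c u v

    shift-difference : ∀ {k} c d (u v : Vec Carrier k) → (u +ᵥ (c ·ᵥ v)) -ᵥ (u +ᵥ (d ·ᵥ v)) ≋ (c + - 1# * d) ·ᵥ v
    shift-difference c d []      []      = []
    shift-difference c d (x ∷ u) (y ∷ v) = ≈-trans (difference-step x y c d (- 1#))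
      (≈-trans (+-congˡ (self-cancel x)) (+-identityʳ _)) ∷ shift-difference c d u v

    ·ᵥ-assoc : ∀ {k} a b (v : Vec Carrier k) → a ·ᵥ (b ·ᵥ v) ≋ (a * b) ·ᵥ v
    ·ᵥ-assoc a b []      = []
    ·ᵥ-assoc a b (x ∷ v) = ≈-sym (*-assoc a b x) ∷ ·ᵥ-assoc a b v

    -- If c x + w = 0 and y c = 1 then x = - y w.
    isolate : ∀ {k} c y (x w : Vec Carrier k) → y * c ≈ 1# → (c ·ᵥ x) +ᵥ w ≋ zeroV k → (- y) ·ᵥ w ≋ x
    isolate c y []      []      yc []       = []
    isolate c y (x ∷ u) (z ∷ w) yc (p ∷ ps) =
      ≈-trans (≈-trans (≈-sym (kill _ (c * x) (-‿inverseʳ y))) (≈-sym (isolate-step x z c y (- y))))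
        (≈-trans (+-cong (≈-trans (*-congʳ yc) (*-identityˡ x)) (≈-trans (*-congˡ p) (zeroʳ (- y)))) (+-identityʳ x))
      ∷ isolate c y u w yc ps

    dot-+ : ∀ {k} (r u v : Vec Carrier k) c → dot r (u +ᵥ (c ·ᵥ v)) ≈ dot r u + c * dot r v
    dot-+ []      []      []      c = ≈-sym (≈-trans (+-congˡ (zeroʳ c)) (+-identityʳ 0#))
    dot-+ (a ∷ r) (x ∷ u) (y ∷ v) c = ≈-trans (+-congˡ (dot-+ r u v c)) (dot-step a x y c _ _)

    dot-cong : ∀ {k} (r : Vec Carrier k) {u v} → u ≋ v → dot r u ≈ dot r v
    dot-cong []      []       = ≈-refl
    dot-cong (a ∷ r) (p ∷ ps) = +-cong (*-congˡ p) (dot-cong r ps)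

    apply-+ : ∀ {j k} (T : Vec (Vec Carrier j) k) u v c →
      Vec.map (λ r → dot r (u +ᵥ (c ·ᵥ v))) T ≋ Vec.map (λ r → dot r u) T +ᵥ (c ·ᵥ Vec.map (λ r → dot r v) T)
    apply-+ []      u v c = []
    apply-+ (r ∷ T) u v c = dot-+ r u v c ∷ apply-+ T u v c

    apply-cong : ∀ {j k} (T : Vec (Vec Carrier j) k) {u v} → u ≋ v → Vec.map (λ r → dot r u) T ≋ Vec.map (λ r → dot r v) T
    apply-cong []      p = []
    apply-cong (r ∷ T) p = dot-cong r p ∷ apply-cong T p

    lincomb-cong : ∀ {j k} {c d : Vec Carrier k} (b : Vec (Vec Carrier j) k) → c ≋ d → lincomb c b ≋ lincomb d b
    lincomb-cong []      []       = ≋-refl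
    lincomb-cong (x ∷ b) (p ∷ ps) = +ᵥ-cong (·ᵥ-cong p ≋-refl) (lincomb-cong b ps)

    combine₂ : ∀ {k} a x y (v u w : Vec Carrier k) →
      ((x + a * y) ·ᵥ v) +ᵥ (u +ᵥ (a ·ᵥ w)) ≋ ((x ·ᵥ v) +ᵥ u) +ᵥ (a ·ᵥ ((y ·ᵥ v) +ᵥ w))
    combine₂ a x y []      []      []      = []
    combine₂ a x y (v ∷ vs) (u ∷ us) (w ∷ ws) = combine-step a x y v u w ∷ combine₂ a x y vs us ws

    lincomb-+ : ∀ {j k} (c d : Vec Carrier k) a (b : Vec (Vec Carrier j) k) →
      lincomb (c +ᵥ (a ·ᵥ d)) b ≋ lincomb c b +ᵥ (a ·ᵥ lincomb d b)
    lincomb-+ []      []      a []      = ≋-sym (≋-trans (+ᵥ-cong ≋-refl (·ᵥ-zero a)) (+ᵥ-identityʳ _))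
    lincomb-+ (x ∷ c) (y ∷ d) a (v ∷ b) = ≋-trans (+ᵥ-cong ≋-refl (lincomb-+ c d a b)) (combine₂ a x y v _ _)

    lincomb-zero : ∀ {j k} (b : Vec (Vec Carrier j) k) → lincomb (zeroV k) b ≋ zeroV j
    lincomb-zero []      = ≋-refl
    lincomb-zero (v ∷ b) = ≋-trans (+ᵥ-cong (zero-·ᵥ v ≈-refl) (lincomb-zero b)) (+ᵥ-identityʳ _)

-- Subspaces as lists of flags, and their extension by one vector

module SubspaceLists where

  open import Data.Nat as ℕ using (ℕ)
  import Data.Nat.Properties as ℕ
  open import Data.Bool as Bool using (Bool; true; false; _∧_)
  open import Data.Bool.Properties using (not-¬)
  open import Data.Bool.ListAction using (all; any)
  open import Data.List as List using (List; []; _∷_; map; length; filter; zip)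
  open import Data.List.Properties using (map-∘; length-map)
  open import Data.List.Membership.Propositional using (_∈_; find)
  open import Data.List.Membership.Propositional.Properties using (∈-map⁻; ∈-map⁺; ∈-filter⁻; ∈-filter⁺)
  open import Data.List.Relation.Unary.Any as Any using (here; there)
  open import Data.List.Relation.Unary.All as All using (All; []; _∷_)
  import Data.List.Relation.Unary.All.Properties as All
  open import Data.List.Relation.Unary.AllPairs as AllPairs using (AllPairs; []; _∷_)
  import Data.List.Relation.Unary.AllPairs.Properties as AllPairs
  open import Data.Vec as Vec using (Vec; []; _∷_)
  open import Data.Vec.Properties using (length-toList)
  open import Data.Vec.Relation.Binary.Pointwise.Inductive as PW using (Pointwise; []; _∷_)
  open import Data.Product using (∃; _×_; _,_; proj₁; proj₂)
  open import Function using (_∘_)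
  open import Relation.Nullary using (¬_; yes; no; contradiction)
  open import Relation.Binary.PropositionalEquality as ≡ using (_≡_; refl; cong; cong₂)
  open import Defs using (vecsOf; FiniteField)
  open Sums
  open ElementaryBasis using (∧-true; ∈-vecsOf⁺)
  open FieldVectors

  private variable A B : Set

  select : List A → List Bool → List A
  select xs bs = map proj₁ (filter (λ p → proj₂ p Bool.≟ true) (zip xs bs))

  select-⊆ : ∀ (xs : List A) bs {x} → x ∈ select xs bs → x ∈ xs
  select-⊆ (x ∷ xs) (true  ∷ bs) (here refl) = here refl
  select-⊆ (x ∷ xs) (true  ∷ bs) (there y∈)  = there (select-⊆ xs bs y∈)
  select-⊆ (x ∷ xs) (false ∷ bs) y∈          = there (select-⊆ xs bs y∈)

  ∈-select-map⁻ : ∀ (p : A → Bool) xs {x} → x ∈ select xs (map p xs) → x ∈ xs × p x ≡ true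
  ∈-select-map⁻ p (y ∷ xs) x∈ with p y in py | x∈
  ... | true  | here refl = here refl , py
  ... | true  | there z∈  = let a , b = ∈-select-map⁻ p xs z∈ in there a , b
  ... | false | z∈        = let a , b = ∈-select-map⁻ p xs z∈ in there a , b

  ∈-select-map⁺ : ∀ (p : A → Bool) xs {x} → x ∈ xs → p x ≡ true → x ∈ select xs (map p xs)
  ∈-select-map⁺ p (y ∷ xs) (here refl) px rewrite px = here refl
  ∈-select-map⁺ p (y ∷ xs) (there x∈)  px with p y
  ... | true  = there (∈-select-map⁺ p xs x∈ px)
  ... | false = ∈-select-map⁺ p xs x∈ px

  -- The flags are recovered from membership, since the entries of xs are pairwise inequivalent.
  flags-recover : ∀ {_∼_ : A → A → Set} (_≈b_ : A → A → Bool) → (∀ {x} → (x ≈b x) ≡ true) →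
    (∀ {x y} → (x ≈b y) ≡ true → x ∼ y) → (∀ {x y} → x ∼ y → y ∼ x) →
    ∀ {xs} → Distinct _∼_ xs → ∀ bs → length bs ≡ length xs → bs ≡ map (λ x → any (x ≈b_) (select xs bs)) xs
  flags-recover _≈b_ rfl wit sym {[]}     d        []       _  = refl
  flags-recover {_∼_ = _∼_} _≈b_ rfl wit sym {x ∷ xs} (d ∷ ds) (b ∷ bs) eq =
    cong₂ _∷_ (first b) (≡.trans (flags-recover _≈b_ rfl wit sym ds bs (ℕ.suc-injective eq)) (rest b d))
    where
    absent : any (x ≈b_) (select xs bs) ≡ false
    absent with any (x ≈b_) (select xs bs) in e
    ... | false = refl
    ... | true  = let y , y∈ , py = any⁻ (select xs bs) e in contradiction (wit py) (All.lookup d (select-⊆ xs bs y∈))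
    first : ∀ b → b ≡ any (x ≈b_) (select (x ∷ xs) (b ∷ bs))
    first true rewrite rfl {x} = refl
    first false = ≡.sym absent
    rest : ∀ b {ys} → All (λ y → ¬ (x ∼ y)) ys →
      map (λ y → any (y ≈b_) (select xs bs)) ys ≡ map (λ y → any (y ≈b_) (select (x ∷ xs) (b ∷ bs))) ys
    rest b     []       = refl
    rest false (d ∷ ds) = cong (_ ∷_) (rest false ds)
    rest true  (_∷_ {y} d ds) = cong₂ _∷_ (lem (y ≈b x) refl) (rest true ds)
      where
      lem : ∀ c → (y ≈b x) ≡ c → any (y ≈b_) (select xs bs) ≡ (c Bool.∨ any (y ≈b_) (select xs bs))
      lem true  e = contradiction (sym (wit e)) d
      lem false _ = refl

  module Subspaces (F : FiniteField) where
    open FiniteField F renaming (refl to ≈-refl; sym to ≈-sym; trans to ≈-trans)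
    open Vectors F public

    module _ {n : ℕ} where

      infix 4 _∈′_ _⊆′_
      -- A record rather than the bare equation, so that `v` and `S` can be inferred from a proof of
      -- membership.
      record _∈′_ (v : Vec Carrier n) (S : Subset n) : Set where
        constructor member
        field holds : (v ∈ₛ S) ≡ true
      open _∈′_ public

      _⊆′_ : Subset n → Subset n → Set
      S ⊆′ S′ = ∀ {v} → v ∈′ S → v ∈′ S′

      ∈-elems⁺ : ∀ {v S} → v ∈ elemsOf S → v ∈′ S
      ∈-elems⁺ {v} v∈ = member (any⁺ v∈ (≋⁺ (≋-refl {u = v})))

      ∈-elems⁻ : ∀ {v} S → v ∈′ S → ∃ λ x → x ∈ elemsOf S × v ≋ x
      ∈-elems⁻ S v∈ = let x , x∈ , e = any⁻ (elemsOf S) (holds v∈) in x , x∈ , ≋⁻ e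

      ∈-resp : ∀ {u v} S → u ≋ v → u ∈′ S → v ∈′ S
      ∈-resp S u≋v u∈ = let x , x∈ , u≋x = ∈-elems⁻ S u∈ in member (any⁺ x∈ (≋⁺ (≋-trans (≋-sym u≋v) u≋x)))

      ∈ₛ-cong : ∀ {u v} S → u ≋ v → (u ∈ₛ S) ≡ (v ∈ₛ S)
      ∈ₛ-cong S e = true-≡ (holds ∘ ∈-resp S e ∘ member) (holds ∘ ∈-resp S (≋-sym e) ∘ member)

      all-elems⁻ : ∀ {p : Vec Carrier n → Bool} S → (∀ {u v} → u ≋ v → p u ≡ true → p v ≡ true) →
        all p (elemsOf S) ≡ true → ∀ {v} → v ∈′ S → p v ≡ true
      all-elems⁻ S resp eq v∈ = let x , x∈ , e = ∈-elems⁻ S v∈ in resp (≋-sym e) (all⁻ eq x∈)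

      all-elems⁺ : ∀ {p : Vec Carrier n → Bool} S → (∀ {v} → v ∈′ S → p v ≡ true) → all p (elemsOf S) ≡ true
      all-elems⁺ S f = all⁺ (elemsOf S) (f ∘ ∈-elems⁺ {S = S})

      ⊆ₛ⁻ : ∀ {S S′} → (S ⊆ₛ S′) ≡ true → S ⊆′ S′
      ⊆ₛ⁻ {S} {S′} eq = member ∘ all-elems⁻ S (λ e → holds ∘ ∈-resp S′ e ∘ member) eq

      ⊆ₛ⁺ : ∀ {S S′} → S ⊆′ S′ → (S ⊆ₛ S′) ≡ true
      ⊆ₛ⁺ {S} p = all-elems⁺ S (holds ∘ p)

      fromPred : (Vec Carrier n → Bool) → Subset n
      fromPred p = mkSub (map p (allVecs n))

      module _ {p : Vec Carrier n → Bool} (resp : ∀ {u v} → u ≋ v → p u ≡ true → p v ≡ true) where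

        ∈-fromPred⁻ : ∀ {v} → v ∈′ fromPred p → p v ≡ true
        ∈-fromPred⁻ v∈ = let x , x∈ , e = ∈-elems⁻ (fromPred p) v∈ in
          resp (≋-sym e) (proj₂ (∈-select-map⁻ p (allVecs n) x∈))

        ∈-fromPred⁺ : ∀ {v} → p v ≡ true → v ∈′ fromPred p
        ∈-fromPred⁺ {v} pv = let x , x∈ , e = find (Enumerates.complete (vecs-enumerate n) v) in
          member (any⁺ (∈-select-map⁺ p (allVecs n) x∈ (resp e pv)) (≋⁺ e))

        ∈ₛ-fromPred : ∀ v → (v ∈ₛ fromPred p) ≡ p v
        ∈ₛ-fromPred v = true-≡ (∈-fromPred⁻ ∘ member) (holds ∘ ∈-fromPred⁺)

      record IsSubspace (S : Subset n) : Set where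
        field
          zero-∈ : zeroV n ∈′ S
          add-∈  : ∀ {u v} → u ∈′ S → v ∈′ S → u +ᵥ v ∈′ S
          scale-∈ : ∀ {u} c → u ∈′ S → c ·ᵥ u ∈′ S

        addScaled-∈ : ∀ {u v} c → u ∈′ S → v ∈′ S → u +ᵥ (c ·ᵥ v) ∈′ S
        addScaled-∈ c u∈ v∈ = add-∈ u∈ (scale-∈ c v∈)

      isSubspace⁻ : ∀ {S} → isSubspace S ≡ true → IsSubspace S
      isSubspace⁻ {S} eq with ∧-true {zeroV n ∈ₛ S} eq
      ... | z , rest with ∧-true {all (λ u → all (λ v → (u +ᵥ v) ∈ₛ S) (elemsOf S)) (elemsOf S)} rest
      ... | a , s = record
        { zero-∈  = member z
        ; add-∈   = λ {u} {v} u∈ v∈ → member (all-elems⁻ S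
                      (λ e p → holds (∈-resp S (+ᵥ-cong (≋-refl {u = u}) e) (member p))) (adds u∈) v∈)
        ; scale-∈ = λ {u} c u∈ → let c′ , c′∈ , e = find (complete c) in
                      ∈-resp S (·ᵥ-cong (≈-sym e) ≋-refl) (member (all⁻ (scales u∈) c′∈)) }
        where
        adds : ∀ {u} → u ∈′ S → all (λ v → (u +ᵥ v) ∈ₛ S) (elemsOf S) ≡ true
        adds = all-elems⁻ {λ u → all (λ v → (u +ᵥ v) ∈ₛ S) (elemsOf S)} S
          (λ {u} {u′} e p → all⁺ (elemsOf S) (λ {v} v∈ → holds (∈-resp S (+ᵥ-cong e (≋-refl {u = v})) (member (all⁻ p v∈))))) a
        scales : ∀ {u} → u ∈′ S → all (λ c → (c ·ᵥ u) ∈ₛ S) elems ≡ true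
        scales = all-elems⁻ {λ u → all (λ c → (c ·ᵥ u) ∈ₛ S) elems} S
          (λ {u} {u′} e p → all⁺ elems (λ {c} c∈ → holds (∈-resp S (·ᵥ-cong (≈-refl {c}) e) (member (all⁻ p c∈))))) s

      isSubspace⁺ : ∀ {S} → IsSubspace S → isSubspace S ≡ true
      isSubspace⁺ {S} I = cong₂ _∧_ (holds zero-∈) (cong₂ _∧_
        (all-elems⁺ S (λ u∈ → all-elems⁺ S (λ v∈ → holds (add-∈ u∈ v∈))))
        (all-elems⁺ S (λ u∈ → all⁺ elems (λ {c} _ → holds (scale-∈ c u∈)))))
        where open IsSubspace I

      bools : List Bool
      bools = true ∷ false ∷ []

      ∈-bools : ∀ b → b ∈ bools
      ∈-bools true  = here refl
      ∈-bools false = there (here refl)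

      fromPred-∈ : ∀ p → fromPred p ∈ allSubsets n
      fromPred-∈ p = ≡.subst (_∈ allSubsets n) refl
        (≡.subst (λ xs → fromPred p ∈ xs) (≡.sym (map-∘ (vecsOf bools (length (allVecs n)))))
          (∈-map⁺ mkSub (≡.subst (λ k → map p (allVecs n) ∈ map Vec.toList (vecsOf bools k)) (length-map p (allVecs n))
            (∈-vecsOf⁺ (map p (allVecs n)) (All.tabulate (λ {b} _ → ∈-bools b))))))

      fromPred-subspace : ∀ p → IsSubspace (fromPred p) → fromPred p ∈ subspaces n
      fromPred-subspace p I = ∈-filter⁺ (λ S → isSubspace S Bool.≟ true) (fromPred-∈ p) (isSubspace⁺ I)

      -- Flags are determined by membership. Hence subspaces with the same members are equal as
      -- entries of the list and can be counted there.
      canonical : ∀ {S} → S ∈ allSubsets n → S ≡ fromPred (_∈ₛ S)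
      canonical S∈ with ∈-map⁻ (λ bs → mkSub (Vec.toList bs)) S∈
      ... | bs , _ , refl = cong mkSub (flags-recover {_∼_ = _≋_} _≈ᵥ_ (λ {x} → ≋⁺ (≋-refl {u = x})) ≋⁻ ≋-sym
        (Enumerates.distinct (vecs-enumerate n)) (Vec.toList bs) (length-toList bs))

      ∈-subspaces⁻ : ∀ {S} → S ∈ subspaces n → S ∈ allSubsets n × IsSubspace S
      ∈-subspaces⁻ S∈ = let a , b = ∈-filter⁻ (λ S → isSubspace S Bool.≟ true) {xs = allSubsets n} S∈ in a , isSubspace⁻ b

      subspace : ∀ {S} → S ∈ subspaces n → IsSubspace S
      subspace = proj₂ ∘ ∈-subspaces⁻

      ⊆-antisym : ∀ {S S′} → S ∈ subspaces n → S′ ∈ subspaces n → S ⊆′ S′ → S′ ⊆′ S → S ≡ S′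
      ⊆-antisym {S} {S′} S∈ S′∈ p r = ≡.trans (canonical (proj₁ (∈-subspaces⁻ S∈)))
        (≡.trans (cong mkSub (map-cong′ (allVecs n))) (≡.sym (canonical (proj₁ (∈-subspaces⁻ S′∈)))))
        where
        map-cong′ : ∀ vs → map (_∈ₛ S) vs ≡ map (_∈ₛ S′) vs
        map-cong′ []       = refl
        map-cong′ (v ∷ vs) = cong₂ _∷_ (true-≡ (λ h → holds (p {v} (member h))) (λ h → holds (r {v} (member h)))) (map-cong′ vs)

      distinct-subspaces : Distinct _≡_ (subspaces n)
      distinct-subspaces = AllPairs.filter⁺ (λ S → isSubspace S Bool.≟ true)
        (AllPairs.map⁺ (AllPairs.map (λ ne e → ne (toList-injective _ _ (cong Subset.flags e)))
          (distinct-vecs {_∼_ = _≡_} (((λ ()) ∷ []) ∷ [] ∷ []) (length (allVecs n)))))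
        where
        toList-injective : ∀ {k} (u v : Vec Bool k) → Vec.toList u ≡ Vec.toList v → Pointwise _≡_ u v
        toList-injective []      []      _ = []
        toList-injective (a ∷ u) (b ∷ v) e = proj₁ (∷-injective e) ∷ toList-injective u v (proj₂ (∷-injective e))
          where open import Data.List.Properties using (∷-injective)

      card : Subset n → ℕ
      card S = ∑ (allVecs n) (λ v → 𝟙 (v ∈ₛ S))

      -- S + ⟨v⟩
      extend : Subset n → Vec Carrier n → Subset n
      extend S v = fromPred (λ x → any (λ c → (x +ᵥ (c ·ᵥ v)) ∈ₛ S) elems)

      module Extend {S} (S∈ : S ∈ subspaces n) (v : Vec Carrier n) where
        open IsSubspace (subspace S∈)

        private
          p : Vec Carrier n → Bool
          p x = any (λ c → (x +ᵥ (c ·ᵥ v)) ∈ₛ S) elems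

          p⁺ : ∀ {x} c → x +ᵥ (c ·ᵥ v) ∈′ S → p x ≡ true
          p⁺ c h = let c′ , c′∈ , e = find (complete c) in
            any⁺ c′∈ (holds (∈-resp S (+ᵥ-cong ≋-refl (·ᵥ-cong e ≋-refl)) h))

          resp : ∀ {u w} → u ≋ w → p u ≡ true → p w ≡ true
          resp e pu = let c , c∈ , h = any⁻ elems pu in p⁺ c (∈-resp S (+ᵥ-cong e ≋-refl) (member h))

        ∈-extend⁺ : ∀ {x} c → x +ᵥ (c ·ᵥ v) ∈′ S → x ∈′ extend S v
        ∈-extend⁺ c h = ∈-fromPred⁺ resp (p⁺ c h)

        ∈-extend⁻ : ∀ {x} → x ∈′ extend S v → ∃ λ c → x +ᵥ (c ·ᵥ v) ∈′ S
        ∈-extend⁻ x∈ = let c , _ , h = any⁻ elems (∈-fromPred⁻ resp x∈) in c , member h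

        extend-⊇ : S ⊆′ extend S v
        extend-⊇ {x} x∈ = ∈-extend⁺ 0# (addScaled-cancel x∈)
          where
          addScaled-cancel : ∀ {x} → x ∈′ S → x +ᵥ (0# ·ᵥ v) ∈′ S
          addScaled-cancel x∈ = ∈-resp S (≋-sym (≋-trans (+ᵥ-cong ≋-refl (zero-·ᵥ v ≈-refl)) (+ᵥ-identityʳ _))) x∈

        extend-∋ : v ∈′ extend S v
        extend-∋ = ∈-extend⁺ (- 1#) (∈-resp S (≋-sym (-ᵥ-self v)) zero-∈)

        extend-subspace : extend S v ∈ subspaces n
        extend-subspace = fromPred-subspace p record
          { zero-∈  = extend-⊇ zero-∈
          ; add-∈   = λ {x} {y} x∈ y∈ → let c , hx = ∈-extend⁻ x∈ ; d , hy = ∈-extend⁻ y∈ in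
              ∈-extend⁺ (c + d) (∈-resp S (≋-sym (+-·ᵥ x y v c d)) (add-∈ hx hy))
          ; scale-∈ = λ {x} a x∈ → let c , hx = ∈-extend⁻ x∈ in
              ∈-extend⁺ (a * c) (∈-resp S (≋-sym (·ᵥ-+ a c x v)) (scale-∈ a hx)) }

        extend-least : ∀ {W} → W ∈ subspaces n → S ⊆′ W → v ∈′ W → extend S v ⊆′ W
        extend-least {W} W∈ S⊆W v∈W {x} x∈ = let c , h = ∈-extend⁻ x∈ in
          ∈-resp W (shift-back c x v) (IsSubspace.addScaled-∈ (subspace W∈) (- c) (S⊆W h) v∈W)

        module _ (v∉S : ¬ (v ∈′ S)) where

          -- The difference of the two vectors is (c - d) v. If c - d were not zero, it could be
          -- divided out and `v` would lie in `S`.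
          shift-unique : ∀ {x} c d → x +ᵥ (c ·ᵥ v) ∈′ S → x +ᵥ (d ·ᵥ v) ∈′ S → c ≈ d
          shift-unique {x} c d hc hd with (c + - 1# * d) ≟ 0#
          ... | yes e = difference-zero e
            where
            difference-zero : ∀ {c d} → c + - 1# * d ≈ 0# → c ≈ d
            difference-zero {c} {d} e with -ᵥ-zero {u = c ∷ []} {d ∷ []} (e ∷ [])
            ... | p ∷ [] = p
          ... | no ne = let y , cy = inverse _ ne in contradiction
            (∈-resp S (≋-trans (·ᵥ-assoc y _ v) (one-·ᵥ v (≈-trans (*-comm y _) cy)))
              (scale-∈ y (∈-resp S (shift-difference c d x v) (addScaled-∈ (- 1#) hc hd)))) v∉S

          -- Each `x` in the extension has exactly one `c` with x + c v in `S`. Counting these pairs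
          -- by `c` instead gives q translates of `S`.
          card-extend : card (extend S v) ≡ q ℕ.* card S
          card-extend = begin
            ∑ vs (λ x → 𝟙 (x ∈ₛ extend S v))                        ≡⟨ ∑-cong vs (λ x → split x (x ∈ₛ extend S v) refl) ⟩
            ∑ vs (λ x → ∑ elems (λ c → 𝟙 ((x +ᵥ (c ·ᵥ v)) ∈ₛ S)))    ≡⟨ ∑-swap vs elems _ ⟩
            ∑ elems (λ c → ∑ vs (λ x → 𝟙 ((x +ᵥ (c ·ᵥ v)) ∈ₛ S)))    ≡⟨ ∑-cong elems translate ⟩
            ∑ elems (λ _ → card S)                                  ≡⟨ ∑-cong elems (λ _ → ≡.sym (ℕ.*-identityˡ _)) ⟩
            ∑ elems (λ _ → 1 ℕ.* card S)                            ≡⟨ ∑-*ʳ elems (card S) (λ _ → 1) ⟩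
            ∑ elems (λ _ → 1) ℕ.* card S                            ≡⟨ cong (ℕ._* card S) (∑-1 elems) ⟩
            q ℕ.* card S                                            ∎
            where
            open ≡.≡-Reasoning
            vs = allVecs n
            translate : ∀ c → ∑ vs (λ x → 𝟙 ((x +ᵥ (c ·ᵥ v)) ∈ₛ S)) ≡ card S
            translate c = ∑-reindex (λ x → x +ᵥ (c ·ᵥ v)) (λ y → y +ᵥ ((- c) ·ᵥ v))
              (λ {x} e → ≋-trans (+ᵥ-cong (≋-sym e) ≋-refl) (shift-back c x v))
              (λ {x} {y} e → ≋-trans (+ᵥ-cong (≋-sym e) ≋-refl) (shift-forth c y v))
              (λ x → 𝟙 (x ∈ₛ S)) (λ e → cong 𝟙 (∈ₛ-cong S e))
            split : ∀ x b → (x ∈ₛ extend S v) ≡ b → 𝟙 b ≡ ∑ elems (λ c → 𝟙 ((x +ᵥ (c ·ᵥ v)) ∈ₛ S))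
            split x true e = let c , h = ∈-extend⁻ {x} (member e)
                                 c′ , c′∈ , c≈c′ = find (complete c)
                             in ≡.sym (∑-unique _≈_ (λ c → (x +ᵥ (c ·ᵥ v)) ∈ₛ S) distinct
                                  (λ {c} {d} _ _ hc hd → shift-unique {x} c d (member hc) (member hd)) c′∈
                                  (holds (∈-resp S (+ᵥ-cong ≋-refl (·ᵥ-cong c≈c′ ≋-refl)) h)))
            split x false e = ≡.sym (∑-0 elems (λ {c} _ → none c ((x +ᵥ (c ·ᵥ v)) ∈ₛ S) refl))
              where
              none : ∀ c b → ((x +ᵥ (c ·ᵥ v)) ∈ₛ S) ≡ b → 𝟙 b ≡ 0
              none c false _ = refl
              none c true  h = contradiction (holds (∈-extend⁺ {x} c (member h))) (not-¬ e)

-- Dimension read off from cardinality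

module DimensionCounts where

  open import Data.Nat as ℕ using (ℕ; zero; suc; _^_)
  import Data.Nat.Properties as ℕ
  open import Data.Nat.Tactic.RingSolver using (solve-∀)
  open import Data.Bool as Bool using (Bool; true; false; _∧_; _∨_; not)
  open import Data.Bool.Properties using (¬-not; not-¬)
  open import Data.Bool.ListAction using (all; any)
  open import Data.List as List using (List; []; _∷_; map; length)
  open import Data.List.Membership.Propositional using (_∈_; find)
  open import Data.List.Membership.Propositional.Properties using (∈-map⁺; ∈-concatMap⁺)
  open import Data.List.Relation.Unary.Any as Any using (Any; here; there)
  open import Data.List.Relation.Unary.All as All using ([]; _∷_)
  open import Data.Vec as Vec using (Vec; []; _∷_)
  open import Data.Vec.Relation.Binary.Pointwise.Inductive as PW using ([]; _∷_)
  open import Data.Product using (∃; _×_; _,_)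
  open import Function using (_∘_)
  open import Relation.Nullary using (¬_; yes; no; contradiction)
  open import Relation.Nullary.Decidable using (⌊_⌋)
  open import Relation.Binary.PropositionalEquality as ≡ using (_≡_; refl; cong; cong₂)
  open import Defs using (vecsOf; FiniteField)
  open Sums
  open ModularLaw using ([_]_)
  open ElementaryBasis using (∧-true; ⌊⌋-witness)
  open FieldVectors
  open SubspaceLists

  private variable A B : Set

  𝟙-mono : ∀ {a b} → (a ≡ true → b ≡ true) → 𝟙 a ℕ.≤ 𝟙 b
  𝟙-mono {true}  h rewrite h refl = ℕ.≤-refl
  𝟙-mono {false} h = ℕ.z≤n

  ∑-mono : ∀ (xs : List A) {f g : A → ℕ} → (∀ x → f x ℕ.≤ g x) → ∑ xs f ℕ.≤ ∑ xs g
  ∑-mono []       le = ℕ.z≤n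
  ∑-mono (x ∷ xs) le = ℕ.+-mono-≤ (le x) (∑-mono xs le)

  count-witness : ∀ xs (p p′ : A → Bool) → ∑ xs (𝟙 ∘ p) ℕ.< ∑ xs (𝟙 ∘ p′) → ∃ λ x → x ∈ xs × p′ x ≡ true × ¬ (p x ≡ true)
  count-witness (x ∷ xs) p p′ lt with p x in px | p′ x in p′x
  ... | false | true  = x , here refl , p′x , not-¬ px
  ... | true  | true  = let y , y∈ , r = count-witness xs p p′ (ℕ.s≤s⁻¹ lt) in y , there y∈ , r
  ... | false | false = let y , y∈ , r = count-witness xs p p′ lt in y , there y∈ , r
  ... | true  | false = let y , y∈ , r = count-witness xs p p′ (ℕ.<-trans (ℕ.n<1+n _) lt) in y , there y∈ , r

  count-strict : ∀ xs (p p′ : A → Bool) → (∀ x → p x ≡ true → p′ x ≡ true) → ∀ {x} → x ∈ xs → p′ x ≡ true → ¬ (p x ≡ true) →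
    ∑ xs (𝟙 ∘ p) ℕ.< ∑ xs (𝟙 ∘ p′)
  count-strict (x ∷ xs) p p′ sub (here refl) p′x npx rewrite ¬-not npx | p′x =
    ℕ.s≤s (∑-mono xs (λ y → 𝟙-mono (sub y)))
  count-strict (y ∷ xs) p p′ sub (there x∈) p′x npx =
    ℕ.+-mono-≤-< (𝟙-mono (sub y)) (count-strict xs p p′ sub x∈ p′x npx)

  -- The geometric sum q^k - 1 = (q - 1) [k], with r = q - 1 in place of a subtraction.
  power-[] : ∀ r k → suc r ^ k ≡ 1 ℕ.+ r ℕ.* [ k ] (suc r)
  power-[] r zero    = cong suc (≡.sym (ℕ.*-zeroʳ r))
  power-[] r (suc k) = ≡.trans (cong (λ z → suc r ^ k ℕ.+ r ℕ.* z) (refl {x = suc r ^ k}))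
    (≡.trans (cong (ℕ._+ r ℕ.* suc r ^ k) (power-[] r k)) (rearrange r ([ k ] (suc r)) (suc r ^ k)))
    where
    rearrange : ∀ r a b → 1 ℕ.+ r ℕ.* a ℕ.+ r ℕ.* b ≡ 1 ℕ.+ r ℕ.* (a ℕ.+ b)
    rearrange = solve-∀

  module Dimension (F : FiniteField) where
    open FiniteField F renaming (refl to ≈-refl; sym to ≈-sym; trans to ≈-trans)
    open Subspaces F public

    q≥2 : 2 ℕ.≤ q
    q≥2 = lem elems complete
      where
      lem : ∀ xs → (∀ x → Any (x ≈_) xs) → 2 ℕ.≤ length xs
      lem []           c with c 0#
      ... | ()
      lem (x ∷ [])     c with c 0# | c 1#
      ... | here e | here e′ = contradiction (≈-trans e (≈-sym e′)) 0≉1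
      lem (x ∷ y ∷ xs) c = ℕ.s≤s (ℕ.s≤s ℕ.z≤n)

    r : ℕ
    r = ℕ.pred q

    r≥1 : 1 ℕ.≤ r
    r≥1 = ℕ.pred-mono-≤ q≥2

    q≡1+r : q ≡ suc r
    q≡1+r = ≡.sym (ℕ.suc-pred q {{ℕ.>-nonZero (ℕ.<-≤-trans (ℕ.n<1+n 0) (ℕ.≤-trans (ℕ.n≤1+n 1) q≥2))}})

    q^-mono-< : ∀ {j k} → j ℕ.< k → q ^ j ℕ.< q ^ k
    q^-mono-< = ℕ.^-monoʳ-< q q≥2

    module _ {n : ℕ} where

      card-equal : ∀ {S S′ : Subset n} → S ⊆′ S′ → card S ≡ card S′ → S′ ⊆′ S
      card-equal {S} {S′} sub eq {v} v∈ with find (Enumerates.complete (vecs-enumerate n) v)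
      ... | x , x∈ , v≋x with (x ∈ₛ S) in e
      ... | true  = ∈-resp S (≋-sym v≋x) (member e)
      ... | false = contradiction eq (ℕ.<⇒≢ (count-strict (allVecs n) (_∈ₛ S) (_∈ₛ S′)
                      (λ x h → holds (sub {x} (member h))) x∈ (holds (∈-resp S′ v≋x v∈)) (not-¬ e)))

      Independent : ∀ {d} → Vec (Vec Carrier n) d → Set
      Independent {d} b = ∀ c → lincomb c b ≋ zeroV n → c ≋ zeroV d

      inSpan : ∀ {d} → Vec (Vec Carrier n) d → Vec Carrier n → Bool
      inSpan {d} b x = any (λ c → lincomb c b ≈ᵥ x) (vecsOf elems d)

      inSpan⁺ : ∀ {d} (b : Vec (Vec Carrier n) d) c {x} → lincomb c b ≋ x → inSpan b x ≡ true
      inSpan⁺ {d} b c e = let c′ , c′∈ , c≋c′ = find (Enumerates.complete (vecs-enumerate d) c) in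
        any⁺ c′∈ (≋⁺ (≋-trans (lincomb-cong b (≋-sym c≋c′)) e))

      inSpan⁻ : ∀ {d} (b : Vec (Vec Carrier n) d) {x} → inSpan b x ≡ true → ∃ λ c → c ∈ vecsOf elems d × lincomb c b ≋ x
      inSpan⁻ {d} b e = let c , c∈ , h = any⁻ (vecsOf elems d) e in c , c∈ , ≋⁻ h

      span-card : ∀ {d} (b : Vec (Vec Carrier n) d) → Independent b → ∑ (allVecs n) (𝟙 ∘ inSpan b) ≡ q ^ d
      span-card {d} b ind = begin
        ∑ vs (𝟙 ∘ inSpan b)                               ≡⟨ ∑-cong vs (λ x → split x (inSpan b x) refl) ⟩
        ∑ vs (λ x → ∑ cs (λ c → 𝟙 (lincomb c b ≈ᵥ x)))    ≡⟨ ∑-swap vs cs _ ⟩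
        ∑ cs (λ c → ∑ vs (λ x → 𝟙 (lincomb c b ≈ᵥ x)))
          ≡⟨ ∑-cong cs (λ c → ≡.trans (∑-cong vs (λ x → ≡.sym (ℕ.*-identityʳ _)))
               (∑-δᵥ (lincomb c b) (λ _ → 1) (λ _ → refl))) ⟩
        ∑ cs (λ _ → 1)                                    ≡⟨ ∑-1 cs ⟩
        length cs                                         ≡⟨ length-vecsOf elems d ⟩
        q ^ d                                             ∎
        where
        open ≡.≡-Reasoning
        vs = allVecs n
        cs = vecsOf elems d
        unique : ∀ {c d x} → lincomb c b ≋ x → lincomb d b ≋ x → c ≋ d
        unique {c} {d} {x} hc hd = -ᵥ-zero (ind (c -ᵥ d) (≋-trans (lincomb-+ c d (- 1#) b)
          (≋-trans (+ᵥ-cong hc (·ᵥ-cong ≈-refl hd)) (-ᵥ-self x))))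
        split : ∀ x t → inSpan b x ≡ t → 𝟙 t ≡ ∑ cs (λ c → 𝟙 (lincomb c b ≈ᵥ x))
        split x true  e = let c , c∈ , h = inSpan⁻ b e in
          ≡.sym (∑-unique _≋_ (λ c → lincomb c b ≈ᵥ x) (Enumerates.distinct (vecs-enumerate d))
            (λ {c} {d} _ _ hc hd → unique {c} {d} (≋⁻ hc) (≋⁻ hd)) c∈ (≋⁺ h))
        split x false e = ≡.sym (∑-0 cs (λ {c} c∈ → cong 𝟙 (¬-not (λ h → not-¬ e (any⁺ c∈ h)))))

      lincomb-∈ : ∀ {S} → S ∈ subspaces n → ∀ {d} c (b : Vec (Vec Carrier n) d) →
        (∀ {x} → x ∈ Vec.toList b → x ∈′ S) → lincomb c b ∈′ S
      lincomb-∈ S∈ []      []      _ = IsSubspace.zero-∈ (subspace S∈)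
      lincomb-∈ S∈ (a ∷ c) (x ∷ b) h = IsSubspace.add-∈ (subspace S∈)
        (IsSubspace.scale-∈ (subspace S∈) a (h (here refl))) (lincomb-∈ S∈ c b (h ∘ there))

      not-∨⁻ : ∀ {a b} → (not a ∨ b) ≡ true → a ≡ true → b ≡ true
      not-∨⁻ {true} h _ = h

      not-∨⁺ : ∀ {a b} → (a ≡ true → b ≡ true) → (not a ∨ b) ≡ true
      not-∨⁺ {true}  h = h refl
      not-∨⁺ {false} h = refl

      basis-card : ∀ {S} → S ∈ subspaces n → ∀ {d} (b : Vec (Vec Carrier n) d) → isBasisOf b S ≡ true → card S ≡ q ^ d
      basis-card {S} S∈ {d} b e with ∧-true {all (_∈ₛ S) (Vec.toList b)} e
      ... | b∈ , rest with ∧-true {all (λ c → not (lincomb c b ≈ᵥ zeroV n) ∨ (c ≈ᵥ zeroV d)) (vecsOf elems d)} rest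
      ... | indep , spans = ≡.trans
        (∑-cong (allVecs n) (λ x → cong 𝟙 (true-≡
          (λ x∈ → all-elems⁻ {p = inSpan b} S
            (λ e p → let c , _ , h = inSpan⁻ b p in inSpan⁺ b c (≋-trans h e)) spans (member x∈))
          (λ h → let c , _ , e = inSpan⁻ b h in holds (∈-resp S e (lincomb-∈ S∈ c b (λ x∈ → member (all⁻ b∈ x∈))))))))
        (span-card b (λ c h → let c′ , c′∈ , c≋c′ = find (Enumerates.complete (vecs-enumerate d) c) in
          ≋-trans c≋c′ (≋⁻ (not-∨⁻ (all⁻ indep c′∈) (≋⁺ (≋-trans (lincomb-cong b (≋-sym c≋c′)) h))))))

      independent-∷ : ∀ {d} (b : Vec (Vec Carrier n) d) x → Independent b → ¬ (inSpan b x ≡ true) → Independent (x ∷ b)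
      independent-∷ b x ind x∉ (a ∷ c) h with a ≟ 0#
      ... | yes a≈0 = a≈0 ∷ ind c (≋-trans (≋-sym (≋-trans (+ᵥ-cong (zero-·ᵥ x a≈0) ≋-refl) (+ᵥ-identityˡ _))) h)
      ... | no  a≉0 = let y , ay = inverse a a≉0 in contradiction
        (inSpan⁺ b (zeroV _ +ᵥ ((- y) ·ᵥ c)) (≋-trans (lincomb-+ (zeroV _) c (- y) b)
          (≋-trans (+ᵥ-cong (lincomb-zero b) ≋-refl) (≋-trans (+ᵥ-identityˡ _)
            (isolate a y x (lincomb c b) (≈-trans (*-comm y a) ay) h))))) x∉

      -- `j` counts the vectors still missing. While there are any, the span has fewer elements than
      -- `S`, which therefore contains a vector outside it; the enlarged list is independent. At
      -- `j = 0` the span has as many elements as `S`, hence is all of it.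
      grow : ∀ {S} → S ∈ subspaces n → ∀ j {d} → card S ≡ q ^ (j ℕ.+ d) → (b : Vec (Vec Carrier n) d) →
        b ∈ vecsOf (allVecs n) d → (∀ {x} → x ∈ Vec.toList b → x ∈′ S) → Independent b → hasDim S (j ℕ.+ d) ≡ true
      grow {S} S∈ zero {d} eq b b∈ b⊆ ind = any⁺ b∈ (cong₂ _∧_ (all⁺ (Vec.toList b) (holds ∘ b⊆)) (cong₂ _∧_
          (all⁺ (vecsOf elems d) (λ {c} _ → not-∨⁺ (λ h → ≋⁺ (ind c (≋⁻ h)))))
          (all-elems⁺ S (λ {v} v∈ → spans v v∈ (inSpan b v) refl))))
        where
        spans : ∀ v → v ∈′ S → ∀ t → inSpan b v ≡ t → inSpan b v ≡ true
        spans v v∈ true  e = e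
        spans v v∈ false e with find (Enumerates.complete (vecs-enumerate n) v)
        ... | x , x∈ , v≋x = contradiction (≡.trans (span-card b ind) (≡.sym eq))
          (ℕ.<⇒≢ (count-strict (allVecs n) (inSpan b) (_∈ₛ S)
            (λ x h → let c , _ , e = inSpan⁻ b h in holds (∈-resp S e (lincomb-∈ S∈ c b b⊆)))
            x∈ (holds (∈-resp S v≋x v∈))
            (λ h → let c , _ , e′ = inSpan⁻ b h in not-¬ e (inSpan⁺ b c (≋-trans e′ (≋-sym v≋x))))))
      grow {S} S∈ (suc j) {d} eq b b∈ b⊆ ind =
        let x , x∈ , x∈S , x∉ = count-witness (allVecs n) (inSpan b) (_∈ₛ S)
              (≡.subst₂ ℕ._<_ (≡.sym (span-card b ind)) (≡.sym eq) (q^-mono-< (ℕ.s≤s (ℕ.m≤n+m d j))))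
        in ≡.subst (λ k → hasDim S k ≡ true) (ℕ.+-suc j d)
             (grow S∈ j (≡.trans eq (cong (q ^_) (≡.sym (ℕ.+-suc j d)))) (x ∷ b)
               (∈-concatMap⁺ (λ y → map (y ∷_) (vecsOf (allVecs n) d)) (Any.map (λ { refl → ∈-map⁺ (x ∷_) b∈ }) x∈))
               (λ { (here refl) → member x∈S ; (there y∈) → b⊆ y∈ })
               (independent-∷ b x ind x∉))

      -- From here on a dimension is a cardinality, which counting arguments can compare without
      -- choosing bases.
      hasDim≡card : ∀ {S} → S ∈ subspaces n → ∀ d → hasDim S d ≡ ⌊ card S ℕ.≟ q ^ d ⌋
      hasDim≡card {S} S∈ d = true-≡
        (λ h → let b , _ , e = any⁻ (vecsOf (allVecs n) d) h in ⌊⌋-true (card S ℕ.≟ q ^ d) (basis-card S∈ b e))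
        (λ h → ≡.subst (λ k → hasDim S k ≡ true) (ℕ.+-identityʳ d)
          (grow S∈ d (≡.trans (⌊⌋-witness (card S ℕ.≟ q ^ d) h) (cong (q ^_) (≡.sym (ℕ.+-identityʳ d))))
            [] (here refl) (λ ()) (λ { [] _ → [] })))

-- Counting the subspaces between two given ones

module IntervalCounts where

  open import Data.Nat as ℕ using (ℕ; suc; _^_)
  import Data.Nat.Properties as ℕ
  open import Data.Nat.Tactic.RingSolver using (solve-∀)
  open import Data.Bool as Bool using (Bool; true; false; _∧_; not)
  open import Data.Bool.Properties using (∧-identityʳ; ∧-zeroʳ; ¬-not; not-¬; not-injective)
  open import Data.Bool.ListAction using (any)
  open import Data.List.Membership.Propositional using (_∈_)
  open import Data.Vec as Vec using (Vec)
  open import Data.Product using (∃; _×_; _,_; proj₁; proj₂)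
  open import Function using (_∘_)
  open import Relation.Nullary using (¬_; contradiction)
  open import Relation.Nullary.Decidable using (⌊_⌋)
  open import Relation.Binary.PropositionalEquality as ≡ using (_≡_; refl; cong; cong₂)
  open import Defs using (FiniteField)
  open Sums
  open ModularLaw using ([_]_)

  open ElementaryBasis using (∧-true; ⌊⌋-witness)
  open FieldVectors
  open SubspaceLists
  open DimensionCounts

  module Intervals (F : FiniteField) where
    open FiniteField F renaming (refl to ≈-refl; sym to ≈-sym; trans to ≈-trans)
    open Dimension F public

    module _ {n : ℕ} where

      -- card S = q ^ d, which by hasDim≡card means that the subspace S has dimension d.
      record Dim (S : Subset n) (d : ℕ) : Set where
        constructor dimension
        field size : card S ≡ q ^ d
      open Dim public

      record Between (A B : Subset n) (d : ℕ) (S : Subset n) : Set where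
        constructor between
        field
          lower : A ⊆′ S
          upper : S ⊆′ B
          dim   : Dim S d

      isBetween : Subset n → Subset n → ℕ → Subset n → Bool
      isBetween A B d S = (A ⊆ₛ S) ∧ (S ⊆ₛ B) ∧ ⌊ card S ℕ.≟ q ^ d ⌋

      isBetween⁻ : ∀ {A B d S} → isBetween A B d S ≡ true → Between A B d S
      isBetween⁻ {A} {B} {d} {S} e with ∧-true {A ⊆ₛ S} e
      ... | a , e′ with ∧-true {S ⊆ₛ B} e′
      ... | b , c = between (⊆ₛ⁻ a) (⊆ₛ⁻ b) (dimension (⌊⌋-witness (card S ℕ.≟ q ^ d) c))

      isBetween⁺ : ∀ {A B d S} → Between A B d S → isBetween A B d S ≡ true
      isBetween⁺ {A} {B} {d} {S} (between l u dm) =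
        cong₂ _∧_ (⊆ₛ⁺ {S = A} {S} l) (cong₂ _∧_ (⊆ₛ⁺ {S = S} {B} u) (⌊⌋-true (card S ℕ.≟ q ^ d) (size dm)))

      dim-extend : ∀ {S d} (S∈ : S ∈ subspaces n) v → ¬ (v ∈′ S) → Dim S d → Dim (extend S v) (suc d)
      dim-extend S∈ v v∉ dm = dimension (≡.trans (Extend.card-extend S∈ v v∉) (cong (q ℕ.*_) (size dm)))

      extend-all : ∀ {S W d} (S∈ : S ∈ subspaces n) → W ∈ subspaces n → ∀ v → ¬ (v ∈′ S) → S ⊆′ W → v ∈′ W →
        Dim S d → Dim W (suc d) → W ⊆′ extend S v
      extend-all {S} {W} S∈ W∈ v v∉ S⊆W v∈W dS dW {x} = card-equal
        (λ {y} → Extend.extend-least S∈ v W∈ S⊆W v∈W {y}) (≡.trans (size (dim-extend S∈ v v∉ dS)) (≡.sym (size dW))) {x}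

      count-unique : ∀ (p : Subset n → Bool) {S} → S ∈ subspaces n → p S ≡ true →
        (∀ {W} → W ∈ subspaces n → p W ≡ true → S ≡ W) → ∑ (subspaces n) (𝟙 ∘ p) ≡ 1
      count-unique p S∈ pS uniq = ∑-unique _≡_ p distinct-subspaces
        (λ W∈ W′∈ pW pW′ → ≡.trans (≡.sym (uniq W∈ pW)) (uniq W′∈ pW′)) S∈ pS

      -- The only candidate is `extend A v`: any subspace counted contains it and has the same
      -- number of elements.
      between-through : ∀ {A B d} → A ∈ subspaces n → B ∈ subspaces n → A ⊆′ B → Dim A d →
        ∀ {v} → v ∈′ B → ¬ (v ∈′ A) →
        ∑ (subspaces n) (λ S → 𝟙 (isBetween A B (suc d) S ∧ (v ∈ₛ S))) ≡ 1
      between-through {A} {B} {d} A∈ B∈ A⊆B dA {v} v∈B v∉A = count-unique _ E.extend-subspace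
        (cong₂ _∧_ (isBetween⁺ (between E.extend-⊇ (λ {x} → E.extend-least B∈ A⊆B v∈B {x}) dE)) (holds E.extend-∋))
        (λ {W} W∈ pW → let b , h = ∧-true {isBetween A B (suc d) W} pW
                           between l u dW = isBetween⁻ b
                       in ⊆-antisym E.extend-subspace W∈ (λ {x} → E.extend-least W∈ l (member h) {x})
                            (λ {x} → extend-all A∈ W∈ v v∉A l (member h) dA dW {x}))
        where
        module E = Extend {n} {A} A∈ v
        dE : Dim (extend A v) (suc d)
        dE = dim-extend A∈ v v∉A dA

      difference : Subset n → Subset n → ℕ
      difference A S = ∑ (allVecs n) (λ x → 𝟙 (x ∈ₛ S ∧ not (x ∈ₛ A)))

      card-difference : ∀ {A S} → A ⊆′ S → card S ≡ card A ℕ.+ difference A S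
      card-difference {A} {S} A⊆S = ≡.trans
        (∑-cong (allVecs n) (λ x → split (x ∈ₛ A) (x ∈ₛ S) (λ h → holds (A⊆S {x} (member h)))))
        (∑-+ (allVecs n) _ _)
        where
        split : ∀ a s → (a ≡ true → s ≡ true) → 𝟙 s ≡ 𝟙 a ℕ.+ 𝟙 (s ∧ not a)
        split true  s h rewrite h refl = refl
        split false true  _ = refl
        split false false _ = refl

      difference-dim : ∀ {A S d} k → A ⊆′ S → Dim A d → Dim S (k ℕ.+ d) → difference A S ≡ r ℕ.* q ^ d ℕ.* [ k ] q
      difference-dim {A} {S} {d} k A⊆S dA dS = ℕ.+-cancelˡ-≡ (q ^ d) _ _ (begin
        q ^ d ℕ.+ difference A S                  ≡⟨ cong (ℕ._+ difference A S) (size dA) ⟨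
        card A ℕ.+ difference A S                 ≡⟨ card-difference A⊆S ⟨
        card S                                    ≡⟨ size dS ⟩
        q ^ (k ℕ.+ d)                             ≡⟨ ℕ.^-distribˡ-+-* q k d ⟩
        q ^ k ℕ.* q ^ d                           ≡⟨ cong (ℕ._* q ^ d) power ⟩
        (1 ℕ.+ r ℕ.* [ k ] q) ℕ.* q ^ d           ≡⟨ rearrange r ([ k ] q) (q ^ d) ⟩
        q ^ d ℕ.+ r ℕ.* q ^ d ℕ.* [ k ] q         ∎)
        where
        open ≡.≡-Reasoning
        power : q ^ k ≡ 1 ℕ.+ r ℕ.* [ k ] q
        power = ≡.subst (λ z → z ^ k ≡ 1 ℕ.+ r ℕ.* [ k ] z) (≡.sym q≡1+r) (power-[] r k)
        rearrange : ∀ r b c → (1 ℕ.+ r ℕ.* b) ℕ.* c ≡ c ℕ.+ r ℕ.* c ℕ.* b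
        rearrange = solve-∀

      -- Both sides count the pairs of a subspace S and a vector of S outside A.
      between-count : ∀ {A B d} k → A ∈ subspaces n → B ∈ subspaces n → A ⊆′ B → Dim A d → Dim B (k ℕ.+ d) →
        ∑ (subspaces n) (𝟙 ∘ isBetween A B (suc d)) ≡ [ k ] q
      between-count {A} {B} {d} k A∈ B∈ A⊆B dA dB = ℕ.*-cancelˡ-≡ _ _ m {{m≢0}} (begin
        m ℕ.* ∑ Ss (𝟙 ∘ isBetween A B (suc d))                                            ≡⟨ ∑-*ˡ Ss m _ ⟨
        ∑ Ss (λ S → m ℕ.* 𝟙 (isBetween A B (suc d) S))
          ≡⟨ ∑-cong Ss (λ S → outer S (isBetween A B (suc d) S) refl) ⟩
        ∑ Ss (λ S → ∑ vs (λ x → 𝟙 (isBetween A B (suc d) S ∧ (x ∈ₛ S ∧ not (x ∈ₛ A)))))   ≡⟨ ∑-swap Ss vs _ ⟩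
        ∑ vs (λ x → ∑ Ss (λ S → 𝟙 (isBetween A B (suc d) S ∧ (x ∈ₛ S ∧ not (x ∈ₛ A)))))   ≡⟨ ∑-cong vs inner ⟩
        difference A B                                                                   ≡⟨ difference-dim k A⊆B dA dB ⟩
        m ℕ.* [ k ] q ∎)
        where
        open ≡.≡-Reasoning
        Ss = subspaces n
        vs = allVecs n
        -- Every `S` counted has q^(d+1) - q^d vectors outside `A`.
        m = r ℕ.* q ^ d
        m≢0 : ℕ.NonZero m
        m≢0 = ℕ.>-nonZero (ℕ.*-mono-≤ r≥1 (ℕ.m^n>0 q {{ℕ.>-nonZero (ℕ.≤-trans (ℕ.s≤s ℕ.z≤n) q≥2)}} d))
        outer : ∀ S b → isBetween A B (suc d) S ≡ b → m ℕ.* 𝟙 b ≡ ∑ vs (λ x → 𝟙 (b ∧ (x ∈ₛ S ∧ not (x ∈ₛ A))))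
        outer S false _ = ≡.trans (ℕ.*-zeroʳ m) (≡.sym (∑-0 vs (λ _ → refl)))
        outer S true  e = let between l _ dS = isBetween⁻ e in
          ≡.sym (≡.trans (difference-dim 1 l dA dS) refl)
        inner : ∀ x → ∑ Ss (λ S → 𝟙 (isBetween A B (suc d) S ∧ (x ∈ₛ S ∧ not (x ∈ₛ A)))) ≡ 𝟙 (x ∈ₛ B ∧ not (x ∈ₛ A))
        inner x with (x ∈ₛ A) in eA | (x ∈ₛ B) in eB
        ... | true  | b     = ≡.trans
            (∑-0 Ss (λ {S} _ → cong 𝟙 (≡.trans (cong (isBetween A B (suc d) S ∧_) (∧-zeroʳ (x ∈ₛ S))) (∧-zeroʳ _))))
            (≡.sym (cong 𝟙 (∧-zeroʳ b)))
        ... | false | true  = ≡.trans (∑-cong Ss (λ S → cong (λ b → 𝟙 (isBetween A B (suc d) S ∧ b)) (∧-identityʳ (x ∈ₛ S))))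
                                (between-through A∈ B∈ A⊆B dA {x} (member eB) (λ h → not-¬ eA (holds h)))
        ... | false | false = ∑-0 Ss (λ {S} _ → none S (isBetween A B (suc d) S) (x ∈ₛ S) refl refl)
          where
          none : ∀ S a b → isBetween A B (suc d) S ≡ a → (x ∈ₛ S) ≡ b → 𝟙 (a ∧ (b ∧ true)) ≡ 0
          none S false b     _ _ = refl
          none S true  false _ _ = refl
          none S true  true  e h = contradiction
            (holds (Between.upper (isBetween⁻ {A} {B} {suc d} e) {x} (member h))) (not-¬ eB)

      MapsInto : Matrix n → Subset n → Subset n → Set
      MapsInto T S W = ∀ {v} → v ∈′ S → apply T v ∈′ W

      mapsInto⁻ : ∀ {T S W} → mapsInto T S W ≡ true → MapsInto T S W
      mapsInto⁻ {T} {S} {W} e v∈ = member (all-elems⁻ S (λ u≋v h → holds (∈-resp W (apply-cong T u≋v) (member h))) e v∈)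

      mapsInto⁺ : ∀ {T S W} → MapsInto T S W → mapsInto T S W ≡ true
      mapsInto⁺ {S = S} h = all-elems⁺ S (λ v∈ → holds (h v∈))

      not-mapsInto : ∀ {T : Matrix n} {S W : Subset n} → ¬ (mapsInto T S W ≡ true) → ∃ λ v → v ∈′ S × ¬ (apply T v ∈′ W)
      not-mapsInto {T} {S} {W} ne with any (λ v → not (apply T v ∈ₛ W)) (elemsOf S) in e
      ... | true  = let v , v∈ , h = any⁻ {p = λ v → not (apply T v ∈ₛ W)} (elemsOf S) e in
        v , ∈-elems⁺ {v = v} {S} v∈ , λ w∈ → not-¬ h (cong not (holds w∈))
      ... | false = contradiction (all⁺ (elemsOf S) (λ {v} v∈ → not-injective {apply T v ∈ₛ W} {true}
        (¬-not (λ h → not-¬ e (any⁺ {p = λ v → not (apply T v ∈ₛ W)} v∈ h))))) ne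

      apply-addScaled : ∀ (T : Matrix n) {W} → ∀ {w v} c → (apply T w +ᵥ (c ·ᵥ apply T v)) ∈′ W → apply T (w +ᵥ (c ·ᵥ v)) ∈′ W
      apply-addScaled T {W} {w} {v} c = ∈-resp W (≋-sym (apply-+ T w v c))

      -- A = V_p, B = V_{p+2}, P = V_i and Q = V_{i+1}: if T Q is not contained in A, then it is
      -- spanned modulo A by the image of a single vector.
      between-row : ∀ {A B P Q d e} (T : Matrix n) → A ∈ subspaces n → B ∈ subspaces n → P ∈ subspaces n → Q ∈ subspaces n →
        A ⊆′ B → Dim A d → P ⊆′ Q → Dim P e → Dim Q (suc e) → MapsInto T P A → MapsInto T Q B → ¬ (mapsInto T Q A ≡ true) →
        ∑ (subspaces n) (λ S → 𝟙 (isBetween A B (suc d) S ∧ mapsInto T Q S)) ≡ 1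
      between-row {A} {B} {P} {Q} {d} T A∈ B∈ P∈ Q∈ A⊆B dA P⊆Q dP dQ TP TQ ne with not-mapsInto {T} {Q} {A} ne
      ... | v , v∈Q , Tv∉A = ≡.trans (∑-cong∈ (subspaces n) (λ {S} S∈ → same S S∈ (isBetween A B (suc d) S) refl))
                               (between-through A∈ B∈ A⊆B dA (TQ v∈Q) Tv∉A)
        where
        v∉P : ¬ (v ∈′ P)
        v∉P v∈P = Tv∉A (TP v∈P)
        same : ∀ S → S ∈ subspaces n → ∀ b → isBetween A B (suc d) S ≡ b → 𝟙 (b ∧ mapsInto T Q S) ≡ 𝟙 (b ∧ (apply T v ∈ₛ S))
        same S S∈ false _ = refl
        same S S∈ true  e = cong 𝟙 (true-≡ (λ h → holds (mapsInto⁻ {T} {Q} {S} h v∈Q))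
          (λ h → mapsInto⁺ {T} {Q} {S} (λ {w} → image (member h) {w})))
          where
          A⊆S : A ⊆′ S
          A⊆S {x} = Between.lower (isBetween⁻ {A} {B} {suc d} e) {x}
          image : apply T v ∈′ S → MapsInto T Q S
          -- As Q = P + ⟨v⟩, some w + c v lies in P and is mapped into A ⊆ S. So T w lies in S as
          -- soon as T v does.
          image Tv∈ {w} w∈ =
            let c , h = Extend.∈-extend⁻ P∈ v (extend-all P∈ Q∈ v v∉P P⊆Q v∈Q dP dQ {w} w∈)
            in ∈-resp S (shift-back c (apply T w) (apply T v))
                 (IsSubspace.addScaled-∈ (subspace S∈) (- c)
                   (∈-resp S (apply-+ T w v c) (A⊆S (TP h))) Tv∈)

      -- A = V_i, B = V_{i+2}, C = V_c and D = V_{c+1}: if T B is not contained in C, then the vectors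
      -- of B mapped into C form a hyperplane of B.
      between-col : ∀ {A B C D d e} (T : Matrix n) → A ∈ subspaces n → B ∈ subspaces n → C ∈ subspaces n → D ∈ subspaces n →
        A ⊆′ B → Dim A d → Dim B (suc (suc d)) → C ⊆′ D → Dim C e → Dim D (suc e) →
        MapsInto T A C → MapsInto T B D → ¬ (mapsInto T B C ≡ true) →
        ∑ (subspaces n) (λ S → 𝟙 (isBetween A B (suc d) S ∧ mapsInto T S C)) ≡ 1
      between-col {A} {B} {C} {D} {d} T A∈ B∈ C∈ D∈ A⊆B dA dB C⊆D dC dD TA TB ne with not-mapsInto {T} {B} {C} ne
      ... | v , v∈B , Tv∉C = count-unique _ K∈
          (cong₂ _∧_ (isBetween⁺ (between (λ x∈ → inK (A⊆B x∈) (TA x∈)) (λ x∈ → proj₁ (outK x∈)) dK))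
                     (mapsInto⁺ {T} {K} {C} (λ x∈ → proj₂ (outK x∈))))
          (λ {W} W∈ pW → let b , h = ∧-true {isBetween A B (suc d) W} pW
                             between l u dW = isBetween⁻ {A} {B} {suc d} b
                             W⊆K : W ⊆′ K
                             W⊆K = λ x∈ → inK (u x∈) (mapsInto⁻ {T} {W} {C} h x∈)
                         in ⊆-antisym K∈ W∈ (λ {x} → card-equal W⊆K (≡.trans (size dW) (≡.sym (size dK))) {x}) W⊆K)
        where
        p : Vec Carrier n → Bool
        p x = (x ∈ₛ B) ∧ (apply T x ∈ₛ C)
        p⁻ : ∀ {x} → p x ≡ true → x ∈′ B × apply T x ∈′ C
        p⁻ {x} e = let a , b = ∧-true {x ∈ₛ B} e in member a , member b
        p⁺ : ∀ {x} → x ∈′ B → apply T x ∈′ C → p x ≡ true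
        p⁺ a b = cong₂ _∧_ (holds a) (holds b)
        resp : ∀ {u v} → u ≋ v → p u ≡ true → p v ≡ true
        resp {u} e h = let a , b = p⁻ {u} h in p⁺ (∈-resp B e a) (∈-resp C (apply-cong T e) b)
        K : Subset n
        K = fromPred p
        inK : ∀ {x} → x ∈′ B → apply T x ∈′ C → x ∈′ K
        inK a b = ∈-fromPred⁺ resp (p⁺ a b)
        outK : ∀ {x} → x ∈′ K → x ∈′ B × apply T x ∈′ C
        outK {x} h = p⁻ {x} (∈-fromPred⁻ resp h)
        module B = IsSubspace (subspace B∈)
        module C = IsSubspace (subspace C∈)
        closed : ∀ {x y} c → x ∈′ K → y ∈′ K → x +ᵥ (c ·ᵥ y) ∈′ K
        closed {x} {y} c hx hy = let bx , cx = outK hx ; by , cy = outK hy in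
          inK (B.addScaled-∈ c bx by) (apply-addScaled T {C} {x} {y} c (C.addScaled-∈ c cx cy))
        zeroK : zeroV n ∈′ K
        zeroK = inK B.zero-∈ (TA (IsSubspace.zero-∈ (subspace A∈)))
        K∈ : K ∈ subspaces n
        K∈ = fromPred-subspace p record
          { zero-∈  = zeroK
          ; add-∈   = λ {x} {y} hx hy → ∈-resp K (+ᵥ-cong ≋-refl (one-·ᵥ y ≈-refl)) (closed 1# hx hy)
          ; scale-∈ = λ {x} c hx → ∈-resp K (+ᵥ-identityˡ _) (closed c zeroK hx) }
        v∉K : ¬ (v ∈′ K)
        v∉K h = Tv∉C (proj₂ (outK h))
        -- As D = C + ⟨T v⟩, for `w` in `B` some T w + c T v lies in C, which puts w + c v into K.
        -- Hence B = K + ⟨v⟩, and the size of K follows from that of B.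
        B⊆E : B ⊆′ extend K v
        B⊆E {w} w∈ =
          let c , h = Extend.∈-extend⁻ C∈ (apply T v) (extend-all C∈ D∈ (apply T v) Tv∉C C⊆D (TB v∈B) dC dD (TB w∈))
          in Extend.∈-extend⁺ K∈ v c (inK (B.addScaled-∈ c w∈ v∈B) (apply-addScaled T {C} {w} {v} c h))
        dK : Dim K (suc d)
        dK = dimension (ℕ.*-cancelˡ-≡ _ _ q {{ℕ.>-nonZero (ℕ.≤-trans (ℕ.s≤s ℕ.z≤n) q≥2)}} (begin
          q ℕ.* card K         ≡⟨ Extend.card-extend K∈ v v∉K ⟨
          card (extend K v)
            ≡⟨ cong (λ S → card S) (⊆-antisym (Extend.extend-subspace K∈ v) B∈
                 (λ {x} → Extend.extend-least K∈ v B∈ (λ h → proj₁ (outK h)) v∈B {x}) B⊆E) ⟩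
          card B               ≡⟨ size dB ⟩
          q ^ suc (suc d)      ∎))
          where open ≡.≡-Reasoning

-- The modular law for numbers of flags

module FlagLaw where

  open import Data.Nat
  open import Data.Nat.Properties
  open import Data.Nat.Tactic.RingSolver using (solve-∀)
  open import Data.Bool as Bool using (Bool; true; false; _∧_; _∨_; not)
  open import Data.Bool.Properties using (∧-identityʳ; ∧-zeroʳ; ¬-not; not-¬)
  open import Data.Bool.ListAction using (all; any)
  open import Data.Fin as Fin using (Fin; toℕ; fromℕ<)
  import Data.Fin.Properties as Fin
  open import Data.List as List using (List; []; _∷_; upTo; allFin)
  open import Data.List.Membership.Propositional using (_∈_)
  open import Data.List.Membership.Propositional.Properties using (∈-upTo⁺; ∈-upTo⁻; ∈-allFin)
  open import Data.Vec as Vec using (Vec; []; _∷_; lookup)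
  open import Data.Vec.Relation.Unary.All as VAll using ([]; _∷_)
  open import Data.Product using (_×_; _,_; proj₁; proj₂)
  open import Data.Sum using (inj₁; inj₂)
  open import Function using (_∘_)
  open import Relation.Nullary using (¬_; yes; no; contradiction)
  open import Relation.Nullary.Decidable using (⌊_⌋)
  open import Relation.Binary.Definitions using (tri<; tri≈; tri>)
  open import Relation.Binary.PropositionalEquality hiding ([_])
  open import Defs using (vecsOf; FiniteField)
  open Sums
  open ModularLaw
  open ColouringCoefficients using (rowEnds; rowEnds-toℕ)
  open CliqueColourings using (∈-vecsOf⁻)
  open ElementaryBasis using (∧-true; ⌊⌋-witness)
  open FieldVectors
  open SubspaceLists
  open DimensionCounts
  open IntervalCounts

  private variable Elt : Set

  set : ∀ {k} → ℕ → Elt → Vec Elt k → Vec Elt k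
  set _       _ []      = []
  set zero    y (x ∷ v) = y ∷ v
  set (suc p) y (x ∷ v) = x ∷ set p y v

  -- The i-th entry of z ∷ V, and its last entry if i is too large.
  at : ∀ {k} → Elt → Vec Elt k → ℕ → Elt
  at z v       zero    = z
  at z []      (suc i) = z
  at z (x ∷ v) (suc i) = at x v i

  at-set : ∀ {k} z p (y : Elt) (v : Vec Elt k) → p < k → at z (set p y v) (suc p) ≡ y
  at-set z zero    y (x ∷ v) _         = refl
  at-set z (suc p) y (x ∷ v) (s≤s p<k) = at-set x p y v p<k

  at-set-other : ∀ {k} z p (y : Elt) (v : Vec Elt k) j → p < k → j ≤ k → j ≢ suc p → at z (set p y v) j ≡ at z v j
  at-set-other z p       y v             zero          _ _ _ = refl
  at-set-other z zero    y (x ∷ v)       (suc zero)    _ _ ne = contradiction refl ne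
  at-set-other z zero    y (x ∷ w ∷ v)   (suc (suc j)) _ _ ne = refl
  at-set-other z zero    y (x ∷ [])      (suc (suc j)) _ (s≤s ()) ne
  at-set-other z (suc p) y (x ∷ v)       (suc j)       (s≤s p<k) (s≤s j≤k) ne = at-set-other x p y v j p<k j≤k (ne ∘ cong suc)

  set-set : ∀ {k} p (y y′ : Elt) (v : Vec Elt k) → set p y (set p y′ v) ≡ set p y v
  set-set p       y y′ []      = refl
  set-set zero    y y′ (x ∷ v) = refl
  set-set (suc p) y y′ (x ∷ v) = cong (x ∷_) (set-set p y y′ v)

  all-set : ∀ {k} {P : Elt → Set} p {y} {v : Vec Elt k} → P y → VAll.All P v → VAll.All P (set p y v)
  all-set p       py []         = []
  all-set zero    py (px ∷ pxs) = py ∷ pxs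
  all-set (suc p) py (px ∷ pxs) = px ∷ all-set p py pxs

  all-at : ∀ {k} {P : Elt → Set} {z} {v : Vec Elt k} → P z → VAll.All P v → ∀ j → P (at z v j)
  all-at pz pv         zero    = pz
  all-at pz []         (suc j) = pz
  all-at pz (px ∷ pxs) (suc j) = all-at px pxs j

  lookup-at : ∀ {k} (z : Elt) (v : Vec Elt k) i → lookup v i ≡ at z v (suc (toℕ i))
  lookup-at z (x ∷ v) Fin.zero    = refl
  lookup-at z (x ∷ v) (Fin.suc i) = lookup-at x v i

  -- Two sums over flags agree if they agree on each family of flags that differ in a single entry.
  -- `z` is a placeholder for that entry, so that a family can be given by a full vector.
  ∑-local : ∀ {xs : List Elt} k p (a b : Vec Elt k → ℕ) → ∀ {z} → z ∈ xs → p < k →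
    (∀ v → VAll.All (_∈ xs) v → ∑ xs (λ y → a (set p y v)) ≡ ∑ xs (λ y → b (set p y v))) →
    ∑ (vecsOf xs k) a ≡ ∑ (vecsOf xs k) b
  ∑-local {xs = xs} (suc k) zero a b {z} z∈ _ eq = begin
    ∑ (vecsOf xs (suc k)) a                              ≡⟨ ∑-vecs xs k a ⟩
    ∑ xs (λ x → ∑ (vecsOf xs k) (λ v → a (x ∷ v)))       ≡⟨ ∑-swap xs (vecsOf xs k) _ ⟩
    ∑ (vecsOf xs k) (λ v → ∑ xs (λ x → a (x ∷ v)))       ≡⟨ ∑-cong∈ (vecsOf xs k) (λ {v} v∈ → eq (z ∷ v) (z∈ ∷ ∈-vecsOf⁻ v∈)) ⟩
    ∑ (vecsOf xs k) (λ v → ∑ xs (λ x → b (x ∷ v)))       ≡⟨ ∑-swap xs (vecsOf xs k) _ ⟨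
    ∑ xs (λ x → ∑ (vecsOf xs k) (λ v → b (x ∷ v)))       ≡⟨ ∑-vecs xs k b ⟨
    ∑ (vecsOf xs (suc k)) b                              ∎
    where open ≡-Reasoning
  ∑-local {xs = xs} (suc k) (suc p) a b z∈ (s≤s p<k) eq = begin
    ∑ (vecsOf xs (suc k)) a                              ≡⟨ ∑-vecs xs k a ⟩
    ∑ xs (λ x → ∑ (vecsOf xs k) (λ v → a (x ∷ v)))
      ≡⟨ ∑-cong∈ xs (λ {x} x∈ → ∑-local k p _ _ z∈ p<k (λ v v∈ → eq (x ∷ v) (x∈ ∷ v∈))) ⟩
    ∑ xs (λ x → ∑ (vecsOf xs k) (λ v → b (x ∷ v)))       ≡⟨ ∑-vecs xs k b ⟨
    ∑ (vecsOf xs (suc k)) b                              ∎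
    where open ≡-Reasoning

  module Flags (F : FiniteField) (n : ℕ) (T : FiniteField.Matrix F n) where
    open FiniteField F using (Carrier; q; -_; 1#; Subset; Matrix; zeroV; zeroSub; allVecs; subspaces; _≈ᵥ_; _+ᵥ_; _·ᵥ_; apply;
      _∈ₛ_; _⊆ₛ_; hasDim; mapsInto; isHessFlag; hessCount; chainsFrom; fl) renaming (refl to ≈-refl)
    open Intervals F public

    private
      O : Subset n
      O = zeroSub n

      Ss : List (Subset n)
      Ss = subspaces n

    Flag : Set
    Flag = Vec (Subset n) n

    zero-resp : ∀ {u v : Vec Carrier n} → u ≋ v → (u ≈ᵥ zeroV n) ≡ true → (v ≈ᵥ zeroV n) ≡ true
    zero-resp e h = ≋⁺ (≋-trans (≋-sym e) (≋⁻ h))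

    ∈-zero⁻ : ∀ {v : Vec Carrier n} → v ∈′ O → v ≋ zeroV n
    ∈-zero⁻ h = ≋⁻ (∈-fromPred⁻ zero-resp h)

    ∈-zero⁺ : ∀ {v : Vec Carrier n} → v ≋ zeroV n → v ∈′ O
    ∈-zero⁺ e = ∈-fromPred⁺ zero-resp (≋⁺ e)

    zero-subspace : O ∈ Ss
    zero-subspace = fromPred-subspace (_≈ᵥ zeroV n) record
      { zero-∈  = ∈-zero⁺ ≋-refl
      ; add-∈   = λ hu hv → ∈-zero⁺ (≋-trans (+ᵥ-cong (∈-zero⁻ hu) (∈-zero⁻ hv)) (+ᵥ-identityʳ _))
      ; scale-∈ = λ c hu → ∈-zero⁺ (≋-trans (·ᵥ-cong ≈-refl (∈-zero⁻ hu)) (·ᵥ-zero c)) }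

    zero-⊆ : ∀ {S} → S ∈ Ss → O ⊆′ S
    zero-⊆ {S} S∈ h = ∈-resp S (≋-sym (∈-zero⁻ h)) (IsSubspace.zero-∈ (subspace S∈))

    zero-dim : Dim O 0
    zero-dim = dimension (trans
      (∑-cong (allVecs n) (λ v → trans (cong 𝟙 (trans (∈ₛ-fromPred zero-resp v)
         (true-≡ {v ≈ᵥ zeroV n} {zeroV n ≈ᵥ v} (λ e → ≋⁺ (≋-sym (≋⁻ {u = v} {zeroV n} e))) (λ e → ≋⁺ (≋-sym (≋⁻ {u = zeroV n} {v} e))))))
         (sym (*-identityʳ (𝟙 (zeroV n ≈ᵥ v))))))
      (∑-δᵥ (zeroV n) (λ _ → 1) (λ _ → refl)))

    apply-zero : apply T (zeroV n) ≋ zeroV n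
    apply-zero = ≋-trans (apply-cong T (≋-sym (≋-trans (+ᵥ-cong ≋-refl (·ᵥ-zero (- 1#))) (+ᵥ-identityʳ _))))
      (≋-trans (apply-+ T (zeroV n) (zeroV n) (- 1#)) (-ᵥ-self _))

    zero-maps : ∀ {S} → S ∈ Ss → MapsInto T O S
    zero-maps {S} S∈ h = ∈-resp S (≋-sym (≋-trans (apply-cong T (∈-zero⁻ h)) apply-zero)) (IsSubspace.zero-∈ (subspace S∈))

    -- Positions in `at O V` are dimensions: `at O V i` is V_i, with V_0 = 0 put in front so that
    -- the first step of the flag is like the others.
    record Good (h : ℕ → ℕ) (V : Flag) : Set where
      field
        chain : ∀ i → i < n → at O V i ⊆′ at O V (suc i)
        dims  : ∀ i → i < n → Dim (at O V (suc i)) (suc i)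
        maps  : ∀ i → i < n → MapsInto T (at O V (suc i)) (at O V (h i))

      dims₀ : ∀ i → i ≤ n → Dim (at O V i) i
      dims₀ zero    _   = zero-dim
      dims₀ (suc i) i<n = dims i i<n

      ascend : ∀ i j → i ≤ j → j ≤ n → at O V i ⊆′ at O V j
      ascend i j i≤j j≤n with m≤n⇒m<n∨m≡n i≤j
      ... | inj₂ refl = λ h → h
      ascend i (suc j) i≤j j≤n | inj₁ (s≤s i≤j′) =
        λ h → chain j j≤n (ascend i j i≤j′ (≤-trans (n≤1+n j) j≤n) h)

    good : (ℕ → ℕ) → Flag → Bool
    good h V = all (λ i → (at O V i ⊆ₛ at O V (suc i)) ∧ ⌊ card (at O V (suc i)) ≟ q ^ suc i ⌋ ∧
      mapsInto T (at O V (suc i)) (at O V (h i))) (upTo n)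

    good⁻ : ∀ {h V} → good h V ≡ true → Good h V
    good⁻ {h} {V} e = record
      { chain = λ i i<n → ⊆ₛ⁻ (proj₁ (parts i i<n))
      ; dims  = λ i i<n → dimension (⌊⌋-witness (card (at O V (suc i)) ≟ q ^ suc i) (proj₁ (proj₂ (parts i i<n))))
      ; maps  = λ i i<n → mapsInto⁻ {T = T} {at O V (suc i)} {at O V (h i)} (proj₂ (proj₂ (parts i i<n))) }
      where
      parts : ∀ i → i < n → (at O V i ⊆ₛ at O V (suc i)) ≡ true × ⌊ card (at O V (suc i)) ≟ q ^ suc i ⌋ ≡ true ×
        mapsInto T (at O V (suc i)) (at O V (h i)) ≡ true
      parts i i<n = let a , bc = ∧-true {at O V i ⊆ₛ at O V (suc i)} (all⁻ e (∈-upTo⁺ i<n)) in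
        a , ∧-true {⌊ card (at O V (suc i)) ≟ q ^ suc i ⌋} bc

    good⁺ : ∀ {h V} → Good h V → good h V ≡ true
    good⁺ {h} {V} G = all⁺ (upTo n) λ {i} i∈ → let i<n = ∈-upTo⁻ i∈ in
      cong₂ _∧_ (⊆ₛ⁺ {S = at O V i} {at O V (suc i)} (chain i i<n))
        (cong₂ _∧_ (⌊⌋-true (card (at O V (suc i)) ≟ q ^ suc i) (size (dims i i<n)))
          (mapsInto⁺ {T = T} {at O V (suc i)} {at O V (h i)} (maps i i<n)))
      where open Good G

    N : (ℕ → ℕ) → ℕ
    N h = ∑ (vecsOf Ss n) (𝟙 ∘ good h)

    N-ext : ∀ {h h′} → h ≗[ n ] h′ → N h ≡ N h′
    N-ext {h} {h′} eq = ∑-cong (vecsOf Ss n) (λ V → cong 𝟙 (true-≡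
      (λ g → let module G = Good (good⁻ {h} {V} g) in good⁺ {h′} {V} record { chain = G.chain ; dims = G.dims
        ; maps = λ i i<n → subst (λ j → MapsInto T _ (at O V j)) (eq i i<n) (G.maps i i<n) })
      (λ g → let module G = Good (good⁻ {h′} {V} g) in good⁺ {h} {V} record { chain = G.chain ; dims = G.dims
        ; maps = λ i i<n → subst (λ j → MapsInto T _ (at O V j)) (sym (eq i i<n)) (G.maps i i<n) })))

    -- The inclusions between all pairs demanded by `isHessFlag` follow from the consecutive ones,
    -- and dimensions translate into cardinalities.
    hessCount≡N : ∀ m → hessCount m T ≡ N (rowEnds m)
    hessCount≡N m = trans (count≡∑ (isHessFlag m T) (vecsOf Ss n))
      (∑-cong∈ (vecsOf Ss n) (λ {V} V∈ → cong 𝟙 (true-≡ (good⁺ ∘ to V (∈-vecsOf⁻ V∈)) (from V (∈-vecsOf⁻ V∈) ∘ good⁻))))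
      where
      h = rowEnds m
      member-at : ∀ {V : Flag} → VAll.All (_∈ Ss) V → ∀ j → at O V j ∈ Ss
      member-at = all-at zero-subspace
      isDim : ∀ {S} → S ∈ Ss → ∀ {d} → hasDim S d ≡ true → Dim S d
      isDim {S} S∈ {d} e = dimension (⌊⌋-witness (card S ≟ q ^ d) (trans (sym (hasDim≡card S∈ d)) e))
      hasDim⁺ : ∀ {S} → S ∈ Ss → ∀ {d} → Dim S d → hasDim S d ≡ true
      hasDim⁺ {S} S∈ {d} dm = trans (hasDim≡card S∈ d) (⌊⌋-true (card S ≟ q ^ d) (size dm))
      image : ∀ (V : Flag) i → lookup V (m i) ≡ at O V (h (toℕ i))
      image V i = trans (lookup-at O V (m i)) (cong (at O V) (sym (rowEnds-toℕ m i)))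
      to : ∀ V → VAll.All (_∈ Ss) V → isHessFlag m T V ≡ true → Good h V
      to V V∈ e with ∧-true {all (λ k → hasDim (lookup V k) (suc (toℕ k))) (allFin n)} e
      ... | ds , rest with ∧-true
        {all (λ k → all (λ l → not ⌊ toℕ k <? toℕ l ⌋ ∨ (lookup V k ⊆ₛ lookup V l)) (allFin n)) (allFin n)} rest
      ... | cs , ms = record { chain = chain ; dims = dims ; maps = maps }
        where
        lookup-< : ∀ {i} (i<n : i < n) → lookup V (fromℕ< i<n) ≡ at O V (suc i)
        lookup-< i<n = trans (lookup-at O V (fromℕ< i<n)) (cong (at O V ∘ suc) (Fin.toℕ-fromℕ< i<n))
        chain : ∀ i → i < n → at O V i ⊆′ at O V (suc i)
        chain zero    i<n = zero-⊆ (member-at V∈ 1)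
        chain (suc i) i<n = subst₂ _⊆′_ (lookup-< j<n) (lookup-< i<n)
          (⊆ₛ⁻ (not-∨⁻ {n} (all⁻ (all⁻ cs (∈-allFin (fromℕ< j<n))) (∈-allFin (fromℕ< i<n)))
            (⌊⌋-true (toℕ (fromℕ< j<n) <? toℕ (fromℕ< i<n))
              (subst₂ _<_ (sym (Fin.toℕ-fromℕ< j<n)) (sym (Fin.toℕ-fromℕ< i<n)) ≤-refl))))
          where
          j<n : i < n
          j<n = <-trans (n<1+n i) i<n
        dims : ∀ i → i < n → Dim (at O V (suc i)) (suc i)
        dims i i<n = isDim (member-at V∈ (suc i))
          (subst₂ (λ S k → hasDim S (suc k) ≡ true) (lookup-< i<n) (Fin.toℕ-fromℕ< i<n) (all⁻ ds (∈-allFin (fromℕ< i<n))))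
        maps : ∀ i → i < n → MapsInto T (at O V (suc i)) (at O V (h i))
        maps i i<n = subst₂ (MapsInto T) (lookup-< i<n)
          (trans (image V (fromℕ< i<n)) (cong (at O V ∘ h) (Fin.toℕ-fromℕ< i<n)))
          (mapsInto⁻ {T = T} {lookup V (fromℕ< i<n)} {lookup V (m (fromℕ< i<n))} (all⁻ ms (∈-allFin (fromℕ< i<n))))
      from : ∀ V → VAll.All (_∈ Ss) V → Good h V → isHessFlag m T V ≡ true
      from V V∈ G = cong₂ _∧_
        (all⁺ (allFin n) (λ {k} _ → subst (λ S → hasDim S (suc (toℕ k)) ≡ true) (sym (lookup-at O V k))
          (hasDim⁺ (member-at V∈ (suc (toℕ k))) (G.dims (toℕ k) (Fin.toℕ<n k)))))
        (cong₂ _∧_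
          (all⁺ (allFin n) (λ {k} _ → all⁺ (allFin n) (λ {l} _ → not-∨⁺ {n} (λ k<l →
            ⊆ₛ⁺ {S = lookup V k} {lookup V l} (subst₂ _⊆′_ (sym (lookup-at O V k)) (sym (lookup-at O V l))
              (G.ascend (suc (toℕ k)) (suc (toℕ l)) (s≤s (<⇒≤ (⌊⌋-witness (toℕ k <? toℕ l) k<l))) (Fin.toℕ<n l)))))))
          (all⁺ (allFin n) (λ {k} _ → mapsInto⁺ {T = T} {lookup V k} {lookup V (m k)}
            (subst₂ (MapsInto T) (sym (lookup-at O V k)) (sym (image V k)) (G.maps (toℕ k) (Fin.toℕ<n k))))))
        where module G = Good G

    local : ∀ (g₀ g₁ g₂ mid through : Subset n → Bool) (x : Bool) →
      (∀ {S} → S ∈ Ss → g₂ S ≡ mid S) → (∀ {S} → S ∈ Ss → g₁ S ≡ mid S ∧ through S) → (∀ {S} → S ∈ Ss → g₀ S ≡ mid S ∧ x) →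
      ∑ Ss (𝟙 ∘ mid) ≡ [ 2 ] q → (x ≡ true → ∀ {S} → S ∈ Ss → mid S ≡ true → through S ≡ true) →
      (¬ (x ≡ true) → ∑ Ss (λ S → 𝟙 (mid S ∧ through S)) ≡ 1) →
      ∑ Ss (λ S → (1 + q) * 𝟙 (g₁ S)) ≡ ∑ Ss (λ S → q * 𝟙 (g₀ S) + 𝟙 (g₂ S))
    local g₀ g₁ g₂ mid through x e₂ e₁ e₀ two all-through one-through = begin
      ∑ Ss (λ S → (1 + q) * 𝟙 (g₁ S))                              ≡⟨ ∑-*ˡ Ss (1 + q) _ ⟩
      (1 + q) * ∑ Ss (𝟙 ∘ g₁)                                      ≡⟨ arithmetic x refl ⟩
      q * ∑ Ss (𝟙 ∘ g₀) + ∑ Ss (𝟙 ∘ g₂)                            ≡⟨ cong (_+ ∑ Ss (𝟙 ∘ g₂)) (∑-*ˡ Ss q _) ⟨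
      ∑ Ss (λ S → q * 𝟙 (g₀ S)) + ∑ Ss (𝟙 ∘ g₂)                    ≡⟨ ∑-+ Ss _ _ ⟨
      ∑ Ss (λ S → q * 𝟙 (g₀ S) + 𝟙 (g₂ S))                         ∎
      where
      open ≡-Reasoning
      s₂ : ∑ Ss (𝟙 ∘ g₂) ≡ [ 2 ] q
      s₂ = trans (∑-cong∈ Ss (cong 𝟙 ∘ e₂)) two
      absorb : ∀ b c → (b ≡ true → c ≡ true) → b ∧ c ≡ b
      absorb true  c f = f refl
      absorb false c f = refl
      yes-sum : ∀ q → (1 + q) * (0 + 1 + q * 1) ≡ q * (0 + 1 + q * 1) + (0 + 1 + q * 1)
      yes-sum = solve-∀
      no-sum : ∀ q → (1 + q) * 1 ≡ q * 0 + (0 + 1 + q * 1)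
      no-sum = solve-∀
      arithmetic : ∀ b → x ≡ b → (1 + q) * ∑ Ss (𝟙 ∘ g₁) ≡ q * ∑ Ss (𝟙 ∘ g₀) + ∑ Ss (𝟙 ∘ g₂)
      arithmetic true refl = subst₂ (λ a b → (1 + q) * a ≡ q * b + ∑ Ss (𝟙 ∘ g₂)) (sym s₁) (sym s₀)
        (subst (λ c → (1 + q) * [ 2 ] q ≡ q * [ 2 ] q + c) (sym s₂) (yes-sum q))
        where
        s₁ : ∑ Ss (𝟙 ∘ g₁) ≡ [ 2 ] q
        s₁ = trans (∑-cong∈ Ss (λ {S} S∈ → cong 𝟙 (trans (e₁ S∈) (absorb (mid S) (through S) (all-through refl S∈))))) two
        s₀ : ∑ Ss (𝟙 ∘ g₀) ≡ [ 2 ] q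
        s₀ = trans (∑-cong∈ Ss (λ {S} S∈ → cong 𝟙 (trans (e₀ S∈) (∧-identityʳ (mid S))))) two
      arithmetic false refl = subst₂ (λ a b → (1 + q) * a ≡ q * b + ∑ Ss (𝟙 ∘ g₂)) (sym s₁) (sym s₀)
        (subst (λ c → (1 + q) * 1 ≡ q * 0 + c) (sym s₂) (no-sum q))
        where
        s₁ : ∑ Ss (𝟙 ∘ g₁) ≡ 1
        s₁ = trans (∑-cong∈ Ss (cong 𝟙 ∘ e₁)) (one-through λ ())
        s₀ : ∑ Ss (𝟙 ∘ g₀) ≡ 0
        s₀ = ∑-0 Ss (λ {S} S∈ → cong 𝟙 (trans (e₀ S∈) (∧-zeroʳ (mid S))))

    -- If some choice of the p-th subspace makes a flag good for h₂, then the others which do so are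
    -- the intermediate subspaces.
    move-by : ∀ {h₀ h₁ h₂} p → p < n →
      (∀ {V} → VAll.All (_∈ Ss) V → Good h₁ V → Good h₂ V) → (∀ {V} → VAll.All (_∈ Ss) V → Good h₀ V → Good h₂ V) →
      (∀ W → VAll.All (_∈ Ss) W → Good h₂ W →
        ∑ Ss (λ S → (1 + q) * 𝟙 (good h₁ (set p S W))) ≡
        ∑ Ss (λ S → q * 𝟙 (good h₀ (set p S W)) + 𝟙 (good h₂ (set p S W)))) →
      (1 + q) * N h₁ ≡ q * N h₀ + N h₂
    move-by {h₀} {h₁} {h₂} p p<n g₁⇒g₂ g₀⇒g₂ fibre = begin
      (1 + q) * N h₁                                               ≡⟨ ∑-*ˡ Vs (1 + q) _ ⟨
      ∑ Vs (λ V → (1 + q) * 𝟙 (good h₁ V))                         ≡⟨ ∑-local n p _ _ zero-subspace p<n each ⟩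
      ∑ Vs (λ V → q * 𝟙 (good h₀ V) + 𝟙 (good h₂ V))               ≡⟨ ∑-+ Vs _ _ ⟩
      ∑ Vs (λ V → q * 𝟙 (good h₀ V)) + N h₂                        ≡⟨ cong (_+ N h₂) (∑-*ˡ Vs q _) ⟩
      q * N h₀ + N h₂                                              ∎
      where
      open ≡-Reasoning
      Vs = vecsOf Ss n
      each : ∀ V → VAll.All (_∈ Ss) V → ∑ Ss (λ S → (1 + q) * 𝟙 (good h₁ (set p S V))) ≡
        ∑ Ss (λ S → q * 𝟙 (good h₀ (set p S V)) + 𝟙 (good h₂ (set p S V)))
      each V V∈ with any (λ S → good h₂ (set p S V)) Ss in e
      ... | true  = let S₀ , S₀∈ , g = any⁻ {p = λ S → good h₂ (set p S V)} Ss e in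
        trans (∑-cong Ss (λ S → cong (λ W → (1 + q) * 𝟙 (good h₁ W)) (sym (set-set p S S₀ V))))
          (trans (fibre (set p S₀ V) (all-set p S₀∈ V∈) (good⁻ {h₂} {set p S₀ V} g))
            (∑-cong Ss (λ S → cong (λ W → q * 𝟙 (good h₀ W) + 𝟙 (good h₂ W)) (set-set p S S₀ V))))
      ... | false = trans (∑-0 Ss (λ {S} S∈ → trans (cong ((1 + q) *_) (none₁ S∈)) (*-zeroʳ (1 + q))))
          (sym (∑-0 Ss (λ {S} S∈ → cong₂ _+_ (trans (cong (q *_) (none₀ S∈)) (*-zeroʳ q)) (none₂ S∈))))
        where
        absent : ∀ {S} → S ∈ Ss → ¬ (good h₂ (set p S V) ≡ true)
        absent S∈ g = not-¬ e (any⁺ {p = λ S → good h₂ (set p S V)} S∈ g)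
        none₂ : ∀ {S} → S ∈ Ss → 𝟙 (good h₂ (set p S V)) ≡ 0
        none₂ S∈ = cong 𝟙 (¬-not (absent S∈))
        none₁ : ∀ {S} → S ∈ Ss → 𝟙 (good h₁ (set p S V)) ≡ 0
        none₁ {S} S∈ = cong 𝟙 (¬-not (λ g → absent S∈
          (good⁺ {h₂} {set p S V} (g₁⇒g₂ (all-set p S∈ V∈) (good⁻ {h₁} {set p S V} g)))))
        none₀ : ∀ {S} → S ∈ Ss → 𝟙 (good h₀ (set p S V)) ≡ 0
        none₀ {S} S∈ = cong 𝟙 (¬-not (λ g → absent S∈
          (good⁺ {h₂} {set p S V} (g₀⇒g₂ (all-set p S∈ V∈) (good⁻ {h₀} {set p S V} g)))))

    -- The flag W with its subspace of dimension p + 1 replaced by S.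
    module Replace {W : Flag} (W∈ : VAll.All (_∈ Ss) W) {h : ℕ → ℕ} (G : Good h W) {p : ℕ} (p+1<n : suc p < n) where
      open Good G

      p<n : p < n
      p<n = <-trans (n<1+n p) p+1<n

      at-∈ : ∀ j → at O W j ∈ Ss
      at-∈ = all-at zero-subspace W∈

      A B : Subset n
      A = at O W p
      B = at O W (suc (suc p))

      A⊆B : A ⊆′ B
      A⊆B x∈ = chain (suc p) p+1<n (chain p p<n x∈)

      A-dim : Dim A p
      A-dim = dims₀ p (<⇒≤ p<n)

      B-dim : Dim B (2 + p)
      B-dim = dims (suc p) p+1<n

      module _ (S : Subset n) where

        U : Flag
        U = set p S W

        at-p : at O U (suc p) ≡ S
        at-p = at-set O p S W p<n

        at-≢ : ∀ j → j ≤ n → j ≢ suc p → at O U j ≡ at O W j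
        at-≢ j = at-set-other O p S W j p<n

        good⇒between : ∀ {h′} → Good h′ U → Between A B (suc p) S
        good⇒between G′ = between
          (subst₂ _⊆′_ (at-≢ p (<⇒≤ p<n) (<⇒≢ (n<1+n p))) at-p (Good.chain G′ p p<n))
          (subst₂ _⊆′_ at-p (at-≢ (suc (suc p)) p+1<n (>⇒≢ (n<1+n (suc p)))) (Good.chain G′ (suc p) p+1<n))
          (subst (λ X → Dim X (suc p)) at-p (Good.dims G′ p p<n))

        -- By `targets` the replaced subspace is the target of no condition. Only the condition on
        -- its own image changes, and it holds because S ⊆ B and `B` is mapped far enough.
        between⇒good : Between A B (suc p) S → (∀ k → k < n → h k ≤ n × h k ≢ suc p) →
          MapsInto T B (at O W (h p)) → Good h U
        between⇒good (between l u dS) targets TB = record { chain = chain′ ; dims = dims′ ; maps = maps′ }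
          where
          chain′ : ∀ i → i < n → at O U i ⊆′ at O U (suc i)
          chain′ i i<n with i ≟ p | i ≟ suc p
          ... | yes refl | _ = subst₂ _⊆′_ (sym (at-≢ p (<⇒≤ p<n) (<⇒≢ (n<1+n p)))) (sym at-p) l
          ... | no _     | yes refl = subst₂ _⊆′_ (sym at-p) (sym (at-≢ (suc (suc p)) p+1<n (>⇒≢ (n<1+n (suc p))))) u
          ... | no i≢p   | no i≢p+1 = subst₂ _⊆′_ (sym (at-≢ i (<⇒≤ i<n) i≢p+1))
            (sym (at-≢ (suc i) i<n (i≢p ∘ suc-injective))) (chain i i<n)
          dims′ : ∀ i → i < n → Dim (at O U (suc i)) (suc i)
          dims′ i i<n with i ≟ p
          ... | yes refl = subst (λ X → Dim X (suc p)) (sym at-p) dS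
          ... | no i≢p   = subst (λ X → Dim X (suc i)) (sym (at-≢ (suc i) i<n (i≢p ∘ suc-injective))) (dims i i<n)
          maps′ : ∀ i → i < n → MapsInto T (at O U (suc i)) (at O U (h i))
          maps′ i i<n with i ≟ p
          ... | yes refl = subst₂ (MapsInto T) (sym at-p) (sym (at-≢ (h p) (proj₁ (targets p p<n)) (proj₂ (targets p p<n))))
                             (λ x∈ → TB (u x∈))
          ... | no i≢p   = subst₂ (MapsInto T) (sym (at-≢ (suc i) i<n (i≢p ∘ suc-injective)))
                             (sym (at-≢ (h i) (proj₁ (targets i i<n)) (proj₂ (targets i i<n)))) (maps i i<n)

        good-≡ : (∀ k → k < n → h k ≤ n × h k ≢ suc p) → MapsInto T B (at O W (h p)) → good h U ≡ isBetween A B (suc p) S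
        good-≡ targets TB = true-≡
          (λ g → isBetween⁺ (good⇒between (good⁻ {h} {U} g)))
          (λ b → good⁺ {h} {U} (between⇒good (isBetween⁻ b) targets TB))

    remap : ∀ {h h′ V} → (∀ k → k < n → h′ k ≢ h k → MapsInto T (at O V (suc k)) (at O V (h′ k))) → Good h V → Good h′ V
    remap {h} {h′} {V} new G = record { chain = chain ; dims = dims ; maps = maps′ }
      where
      open Good G
      maps′ : ∀ k → k < n → MapsInto T (at O V (suc k)) (at O V (h′ k))
      maps′ k k<n with h′ k ≟ h k
      ... | yes e = subst (λ j → MapsInto T (at O V (suc k)) (at O V j)) (sym e) (maps k k<n)
      ... | no ne = new k k<n ne

    raise : ∀ {h h′ V} → (∀ k → k < n → h k ≤ h′ k) → (∀ k → k < n → h′ k ≤ n) → Good h V → Good h′ V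
    raise {h} {h′} le bound G = remap (λ k k<n _ x∈ → ascend (h k) (h′ k) (le k k<n) (bound k k<n) (maps k k<n x∈)) G
      where open Good G

    module Row {h₀ h₁ h₂ : ℕ → ℕ} {i p} (M : RowMove n h₀ h₁ h₂ i p) where
      open RowMove M

      i<n : i < n
      i<n = <-trans i<p (<-trans (n<1+n p) p+1<n)

      step : ∀ {h h′ : ℕ → ℕ} {v w} → (∀ k → k < n → k ≢ i → h′ k ≡ h k) →
        h i ≡ v → h′ i ≡ w → v ≤ w → ∀ k → k < n → h k ≤ h′ k
      step off refl refl v≤w k k<n with k ≟ i
      ... | yes refl = v≤w
      ... | no k≢i   = ≤-reflexive (sym (off k k<n k≢i))

      bounded : ∀ {h : ℕ → ℕ} → (∀ k → k < n → k ≢ i → h k ≡ h₀ k) → ∀ {w} → h i ≡ w → w ≤ n → ∀ k → k < n → h k ≤ n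
      bounded off refl w≤n k k<n with k ≟ i
      ... | yes refl = w≤n
      ... | no k≢i   = subst (_≤ n) (sym (off k k<n k≢i)) (bound k k<n)

      bound₂ : ∀ k → k < n → h₂ k ≤ n
      bound₂ = bounded {h₂} off₂ at₂ p+1<n

      targets : ∀ k → k < n → h₂ k ≤ n × h₂ k ≢ suc p
      targets k k<n = bound₂ k k<n , ne
        where
        ne : h₂ k ≢ suc p
        ne with <-cmp k i
        ... | tri< k<i k≢i _  = <⇒≢ (s≤s (subst (_≤ p) (sym (off₂ k k<n k≢i)) (before k k<i)))
        ... | tri≈ _ refl _   = >⇒≢ (subst (suc p <_) (sym at₂) (n<1+n (suc p)))
        ... | tri> _ k≢i i<k  = >⇒≢ (subst (suc p <_) (sym (off₂ k k<n k≢i)) (after k i<k k<n))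

      module _ (W : Flag) (W∈ : VAll.All (_∈ Ss) W) (G : Good h₂ W) where
        open Good G
        open Replace W∈ G p+1<n

        P Q : Subset n
        P = at O W i
        Q = at O W (suc i)

        p≢i : p ≢ i
        p≢i = >⇒≢ i<p

        TB : MapsInto T B (at O W (h₂ p))
        -- By `level`, row `suc p`, which governs T B, ends where row `p` does.
        TB = subst (λ j → MapsInto T B (at O W j))
          (trans (off₂ (suc p) p+1<n (>⇒≢ (m<n⇒m<1+n i<p))) (trans (sym level) (sym (off₂ p p<n p≢i))))
          (maps (suc p) p+1<n)

        TP : MapsInto T P A
        -- The image of V_i is governed by row i - 1, which ends at `p` at the latest; for i = 0 the
        -- subspace is zero. The helper `go` exposes `i` as a successor.
        TP = go i refl
          where
          go : ∀ j → j ≡ i → MapsInto T (at O W j) A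
          go zero    _    = zero-maps (at-∈ p)
          go (suc j) refl x∈ = ascend (h₂ j) p
            (subst (_≤ p) (sym (off₂ j j<n (<⇒≢ (n<1+n j)))) (before j (n<1+n j))) (<⇒≤ p<n) (maps j j<n x∈)
            where
            j<n : j < n
            j<n = <-trans (n<1+n j) i<n

        TQ : MapsInto T Q B
        TQ = subst (λ j → MapsInto T Q (at O W j)) at₂ (maps i i<n)

        Q-at : ∀ S → at O (set p S W) (suc i) ≡ Q
        Q-at S = at-≢ S (suc i) i<n (≢-sym (p≢i ∘ suc-injective))

        -- In h₁ row `i` ends at `suc p`, the position of the varying subspace, so its condition
        -- becomes T Q ⊆ S; all other conditions are those of h₂.
        mid₁ : ∀ S → good h₁ (set p S W) ≡ isBetween A B (suc p) S ∧ mapsInto T Q S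
        mid₁ S = true-≡
          (λ g → let G₁ = good⁻ {h₁} {set p S W} g in cong₂ _∧_ (isBetween⁺ (good⇒between S G₁))
            (mapsInto⁺ {T = T} {Q} {S} (subst₂ (MapsInto T) (Q-at S)
              (trans (cong (at O (set p S W)) at₁) (at-p S)) (Good.maps G₁ i i<n))))
          (λ e → let b , m = ∧-true {isBetween A B (suc p) S} e in good⁺ {h₁} {set p S W}
            (remap (λ k k<n ne → new k k<n ne (mapsInto⁻ {T = T} {Q} {S} m)) (between⇒good S (isBetween⁻ b) targets TB)))
          where
          new : ∀ k → k < n → h₁ k ≢ h₂ k → MapsInto T Q S → MapsInto T (at O (set p S W) (suc k)) (at O (set p S W) (h₁ k))
          new k k<n ne m with k ≟ i
          ... | yes refl = subst₂ (MapsInto T) (sym (Q-at S)) (trans (sym (at-p S)) (cong (at O (set p S W)) (sym at₁))) m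
          ... | no k≢i   = contradiction (trans (off₁ k k<n k≢i) (sym (off₂ k k<n k≢i))) ne

        mid₀ : ∀ S → good h₀ (set p S W) ≡ isBetween A B (suc p) S ∧ mapsInto T Q A
        mid₀ S = true-≡
          (λ g → let G₀ = good⁻ {h₀} {set p S W} g in cong₂ _∧_ (isBetween⁺ (good⇒between S G₀))
            (mapsInto⁺ {T = T} {Q} {A} (subst₂ (MapsInto T) (Q-at S)
              (trans (cong (at O (set p S W)) at₀) A-at) (Good.maps G₀ i i<n))))
          (λ e → let b , m = ∧-true {isBetween A B (suc p) S} e in good⁺ {h₀} {set p S W}
            (remap (λ k k<n ne → new k k<n ne (mapsInto⁻ {T = T} {Q} {A} m)) (between⇒good S (isBetween⁻ b) targets TB)))
          where
          A-at : at O (set p S W) p ≡ A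
          A-at = at-≢ S p (<⇒≤ p<n) (<⇒≢ (n<1+n p))
          new : ∀ k → k < n → h₀ k ≢ h₂ k → MapsInto T Q A → MapsInto T (at O (set p S W) (suc k)) (at O (set p S W) (h₀ k))
          new k k<n ne m with k ≟ i
          ... | yes refl = subst₂ (MapsInto T) (sym (Q-at S)) (trans (sym A-at) (cong (at O (set p S W)) (sym at₀))) m
          ... | no k≢i   = contradiction (sym (off₂ k k<n k≢i)) ne

        fibre : ∑ Ss (λ S → (1 + q) * 𝟙 (good h₁ (set p S W))) ≡
                ∑ Ss (λ S → q * 𝟙 (good h₀ (set p S W)) + 𝟙 (good h₂ (set p S W)))
        fibre = local (λ S → good h₀ (set p S W)) (λ S → good h₁ (set p S W)) (λ S → good h₂ (set p S W))
          (isBetween A B (suc p)) (mapsInto T Q) (mapsInto T Q A)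
          (λ {S} _ → good-≡ S targets TB) (λ {S} _ → mid₁ S) (λ {S} _ → mid₀ S)
          (between-count 2 (at-∈ p) (at-∈ (suc (suc p))) A⊆B A-dim B-dim)
          (λ m {S} _ b → mapsInto⁺ {T = T} {Q} {S} (λ x∈ →
            Between.lower (isBetween⁻ {A = A} {B} {suc p} b) (mapsInto⁻ {T = T} {Q} {A} m x∈)))
          (between-row T (at-∈ p) (at-∈ (suc (suc p))) (at-∈ i) (at-∈ (suc i)) A⊆B A-dim
            (chain i i<n) (dims₀ i (<⇒≤ i<n)) (dims i i<n) TP TQ)

      N-row : (1 + q) * N h₁ ≡ q * N h₀ + N h₂
      N-row = move-by {h₀} {h₁} {h₂} p (<-trans (n<1+n p) p+1<n)
        (λ _ → raise {h₁} {h₂} (step {h₁} {h₂} (λ k k<n k≢i →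
          trans (off₂ k k<n k≢i) (sym (off₁ k k<n k≢i))) at₁ at₂ (n≤1+n _)) bound₂)
        (λ _ → raise {h₀} {h₂} (step {h₀} {h₂} off₂ at₀ at₂ (m≤n⇒m≤1+n (n≤1+n _))) bound₂) fibre

    module Col {h₀ h₁ h₂ : ℕ → ℕ} {i c} (M : ColMove n h₀ h₁ h₂ i c) where
      open ColMove M

      i+1<n : suc i < n
      i+1<n = <-trans i+1<c c<n

      i<n : i < n
      i<n = <-trans (n<1+n i) i+1<n

      Off : (h h′ : ℕ → ℕ) → Set
      Off h h′ = ∀ k → k < n → k ≢ i → k ≢ suc i → h′ k ≡ h k

      step : ∀ {h h′ : ℕ → ℕ} → Off h h′ → h i ≤ h′ i → h (suc i) ≤ h′ (suc i) → ∀ k → k < n → h k ≤ h′ k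
      step off a b k k<n with k ≟ i | k ≟ suc i
      ... | yes refl | _        = a
      ... | no _     | yes refl = b
      ... | no k≢i   | no k≢i+1 = ≤-reflexive (sym (off k k<n k≢i k≢i+1))

      bound₂ : ∀ k → k < n → h₂ k ≤ n
      bound₂ k k<n with k ≟ i | k ≟ suc i
      ... | yes refl | _        = subst (_≤ n) (sym (proj₁ at₂)) c<n
      ... | no _     | yes refl = subst (_≤ n) (sym (proj₂ at₂)) c<n
      ... | no k≢i   | no k≢i+1 = subst (_≤ n) (sym (off₂ k k<n k≢i k≢i+1)) (bound k k<n)

      targets : ∀ k → k < n → h₂ k ≤ n × h₂ k ≢ suc i
      targets k k<n = bound₂ k k<n , ne
        where
        big : suc c ≢ suc i
        big = >⇒≢ (<-trans i+1<c (n<1+n c))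
        ne : h₂ k ≢ suc i
        ne with k ≟ i | k ≟ suc i
        ... | yes refl | _        = λ e → big (trans (sym (proj₁ at₂)) e)
        ... | no _     | yes refl = λ e → big (trans (sym (proj₂ at₂)) e)
        ... | no k≢i   | no k≢i+1 with <-cmp k i
        ...   | tri< k<i _ _ = λ e → proj₂ (before k k<i) (trans (sym (off₂ k k<n k≢i k≢i+1)) e)
        ...   | tri≈ _ k≡i _ = contradiction k≡i k≢i
        ...   | tri> _ _ i<k = λ e → <⇒≱ (<-trans i+1<c (n<1+n c))
                  (subst (suc c ≤_) (trans (sym (off₂ k k<n k≢i k≢i+1)) e) (after k (≤∧≢⇒< i<k (k≢i+1 ∘ sym)) k<n))

      module _ (W : Flag) (W∈ : VAll.All (_∈ Ss) W) (G : Good h₂ W) where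
        open Good G
        open Replace W∈ G i+1<n

        C D : Subset n
        C = at O W c
        D = at O W (suc c)

        TB : MapsInto T B D
        TB = subst (λ j → MapsInto T B (at O W j)) (proj₂ at₂) (maps (suc i) i+1<n)

        TB′ : MapsInto T B (at O W (h₂ i))
        TB′ = subst (λ j → MapsInto T B (at O W j)) (sym (proj₁ at₂)) TB

        TA : MapsInto T A C
        TA = go i refl
          where
          go : ∀ j → j ≡ i → MapsInto T (at O W j) C
          go zero    _    = zero-maps (at-∈ c)
          go (suc j) refl x∈ = ascend (h₂ j) c
            (subst (_≤ c) (sym (off₂ j j<n (<⇒≢ (n<1+n j)) (<⇒≢ (m<n⇒m<1+n (n<1+n j)))))
              (proj₁ (before j (n<1+n j))))
            (<⇒≤ c<n) (maps j j<n x∈)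
            where
            j<n : j < n
            j<n = <-trans (n<1+n j) i<n

        C-at : ∀ S → at O (set i S W) c ≡ C
        C-at S = at-≢ S c (<⇒≤ c<n) (>⇒≢ i+1<c)

        B-at : ∀ S → at O (set i S W) (suc (suc i)) ≡ B
        B-at S = at-≢ S (suc (suc i)) i+1<n (>⇒≢ (n<1+n (suc i)))

        -- Here the varying subspace is the source: in h₁ row `i` asks for T S ⊆ C, while row
        -- `suc i` ends where it does in h₂.
        mid₁ : ∀ S → good h₁ (set i S W) ≡ isBetween A B (suc i) S ∧ mapsInto T S C
        mid₁ S = true-≡
          (λ g → let G₁ = good⁻ {h₁} {set i S W} g in cong₂ _∧_ (isBetween⁺ (good⇒between S G₁))
            (mapsInto⁺ {T = T} {S} {C} (subst₂ (MapsInto T) (at-p S)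
              (trans (cong (at O (set i S W)) (proj₁ at₁)) (C-at S)) (Good.maps G₁ i i<n))))
          (λ e → let b , m = ∧-true {isBetween A B (suc i) S} e in good⁺ {h₁} {set i S W}
            (remap (λ k k<n ne → new k k<n ne (mapsInto⁻ {T = T} {S} {C} m)) (between⇒good S (isBetween⁻ b) targets TB′)))
          where
          new : ∀ k → k < n → h₁ k ≢ h₂ k → MapsInto T S C → MapsInto T (at O (set i S W) (suc k)) (at O (set i S W) (h₁ k))
          new k k<n ne m with k ≟ i | k ≟ suc i
          ... | yes refl | _ = subst₂ (MapsInto T) (sym (at-p S))
            (trans (sym (C-at S)) (cong (at O (set i S W)) (sym (proj₁ at₁)))) m
          ... | no _ | yes refl = contradiction (trans (proj₂ at₁) (sym (proj₂ at₂))) ne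
          ... | no k≢i | no k≢i+1 = contradiction (trans (off₁ k k<n k≢i k≢i+1) (sym (off₂ k k<n k≢i k≢i+1))) ne

        mid₀ : ∀ S → good h₀ (set i S W) ≡ isBetween A B (suc i) S ∧ mapsInto T B C
        -- In h₀ row `suc i` asks for T B ⊆ C, which implies the demand T S ⊆ C of row `i` because S
        -- ⊆ B. What remains does not depend on S.
        mid₀ S = true-≡
          (λ g → let G₀ = good⁻ {h₀} {set i S W} g in cong₂ _∧_ (isBetween⁺ (good⇒between S G₀))
            (mapsInto⁺ {T = T} {B} {C} (subst₂ (MapsInto T) (B-at S)
              (trans (cong (at O (set i S W)) (proj₂ at₀)) (C-at S)) (Good.maps G₀ (suc i) i+1<n))))
          (λ e → let b , m = ∧-true {isBetween A B (suc i) S} e in good⁺ {h₀} {set i S W}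
            (remap (λ k k<n ne → new k k<n ne (Between.upper (isBetween⁻ {A = A} {B} {suc i} b)) (mapsInto⁻ {T = T} {B} {C} m))
              (between⇒good S (isBetween⁻ b) targets TB′)))
          where
          new : ∀ k → k < n → h₀ k ≢ h₂ k → S ⊆′ B → MapsInto T B C →
            MapsInto T (at O (set i S W) (suc k)) (at O (set i S W) (h₀ k))
          new k k<n ne u m with k ≟ i | k ≟ suc i
          ... | yes refl | _ = subst₂ (MapsInto T) (sym (at-p S))
            (trans (sym (C-at S)) (cong (at O (set i S W)) (sym (proj₁ at₀)))) (λ x∈ → m (u x∈))
          ... | no _ | yes refl = subst₂ (MapsInto T) (sym (B-at S))
            (trans (sym (C-at S)) (cong (at O (set i S W)) (sym (proj₂ at₀)))) m
          ... | no k≢i | no k≢i+1 = contradiction (sym (off₂ k k<n k≢i k≢i+1)) ne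

        fibre : ∑ Ss (λ S → (1 + q) * 𝟙 (good h₁ (set i S W))) ≡
                ∑ Ss (λ S → q * 𝟙 (good h₀ (set i S W)) + 𝟙 (good h₂ (set i S W)))
        fibre = local (λ S → good h₀ (set i S W)) (λ S → good h₁ (set i S W)) (λ S → good h₂ (set i S W))
          (isBetween A B (suc i)) (λ S → mapsInto T S C) (mapsInto T B C)
          (λ {S} _ → good-≡ S targets TB′) (λ {S} _ → mid₁ S) (λ {S} _ → mid₀ S)
          (between-count 2 (at-∈ i) (at-∈ (suc (suc i))) A⊆B A-dim B-dim)
          (λ m {S} _ b → mapsInto⁺ {T = T} {S} {C} (λ x∈ →
            mapsInto⁻ {T = T} {B} {C} m (Between.upper (isBetween⁻ {A = A} {B} {suc i} b) x∈)))
          (between-col T (at-∈ i) (at-∈ (suc (suc i))) (at-∈ c) (at-∈ (suc c)) A⊆B A-dim B-dim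
            (chain c c<n) (dims₀ c (<⇒≤ c<n)) (dims c c<n) TA TB)

      N-col : (1 + q) * N h₁ ≡ q * N h₀ + N h₂
      N-col = move-by {h₀} {h₁} {h₂} i i<n
        (λ _ → raise {h₁} {h₂} (step {h₁} {h₂} (λ k k<n a b → trans (off₂ k k<n a b) (sym (off₁ k k<n a b)))
          (subst₂ _≤_ (sym (proj₁ at₁)) (sym (proj₁ at₂)) (n≤1+n c))
          (subst₂ _≤_ (sym (proj₂ at₁)) (sym (proj₂ at₂)) ≤-refl)) bound₂)
        (λ _ → raise {h₀} {h₂} (step {h₀} {h₂} off₂
          (subst₂ _≤_ (sym (proj₁ at₀)) (sym (proj₁ at₂)) (n≤1+n c))
          (subst₂ _≤_ (sym (proj₂ at₀)) (sym (proj₂ at₂)) (n≤1+n c))) bound₂) fibre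

    N-move : ∀ {h₀ h₁ h₂} → Move n h₀ h₁ h₂ → (1 + q) * N h₁ ≡ q * N h₀ + N h₂
    N-move (row M) = Row.N-row M
    N-move (col M) = Col.N-col M

-- The number of flags at disjoint unions of cliques

module FlagCliques where

  open import Data.Nat
  open import Data.Nat.Properties
  open import Data.Nat.Tactic.RingSolver using (solve-∀)
  open import Data.Nat.ListAction using (sum)
  open import Data.Bool.Properties using (¬-not; not-¬)
  open import Data.Bool as Bool using (Bool; true; false; if_then_else_; _∧_)
  open import Data.List as List using (List; []; _∷_)
  open import Data.List.Membership.Propositional using (_∈_)
  open import Data.List.Relation.Unary.All as All using (All; []; _∷_)
  open import Data.Vec as Vec using (Vec; []; _∷_; take; drop)
  open import Data.Vec.Properties using (take++drop≡id)
  open import Data.Vec.Relation.Unary.All as VAll using ([]; _∷_)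
  open import Data.Product using (_×_; _,_; proj₁; proj₂)
  open import Data.Sum using (inj₁; inj₂)
  open import Function using (_∘_)
  open import Relation.Nullary using (¬_)
  open import Relation.Nullary.Decidable using (⌊_⌋)
  open import Relation.Binary.PropositionalEquality hiding ([_])
  open import Defs using (vecsOf; FiniteField)
  open Sums
  open ModularLaw
  open CliqueColourings using ([_]!_; factorials)
  open ElementaryBasis using (∧-true; ⌊⌋-witness)
  open FieldVectors
  open SubspaceLists
  open DimensionCounts
  open IntervalCounts
  open FlagLaw

  last : ∀ {A : Set} {k} → A → Vec A k → A
  last z []      = z
  last z (x ∷ v) = last x v

  at-length : ∀ {A : Set} {k} (z : A) (v : Vec A k) → at z v k ≡ last z v
  at-length z []      = refl
  at-length z (x ∷ v) = at-length x v

  at-++ˡ : ∀ {A : Set} {j k} (z : A) (u : Vec A j) (v : Vec A k) i → i ≤ j → at z (u Vec.++ v) i ≡ at z u i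
  at-++ˡ z u       v zero    _         = refl
  at-++ˡ z (x ∷ u) v (suc i) (s≤s i≤j) = at-++ˡ x u v i i≤j

  at-++ʳ : ∀ {A : Set} {j k} (z : A) (u : Vec A j) (v : Vec A k) i → at z (u Vec.++ v) (j + i) ≡ at (last z u) v i
  at-++ʳ z []      v i = refl
  at-++ʳ z (x ∷ u) v i = at-++ʳ x u v i

  module CliqueFlags (F : FiniteField) (n : ℕ) (T : FiniteField.Matrix F n) where
    open FiniteField F using (Carrier; q; -_; 1#; Subset; Matrix; zeroV; zeroSub; allVecs; subspaces; _≈ᵥ_; _+ᵥ_; _·ᵥ_; apply;
      _∈ₛ_; _⊆ₛ_; hasDim; mapsInto; isHessFlag; hessCount; chainsFrom; fl) renaming (refl to ≈-refl)
    open Flags F n T public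

    private
      Ss : List (Subset n)
      Ss = subspaces n

    above : Subset n → ℕ → Subset n → Bool
    above W d S = (W ⊆ₛ S) ∧ ⌊ card S ≟ q ^ d ⌋

    above⁻ : ∀ {W d S} → above W d S ≡ true → W ⊆′ S × Dim S d
    above⁻ {W} {d} {S} e = let a , b = ∧-true {W ⊆ₛ S} e in ⊆ₛ⁻ a , dimension (⌊⌋-witness (card S ≟ q ^ d) b)

    above⁺ : ∀ {W d S} → W ⊆′ S → Dim S d → above W d S ≡ true
    above⁺ {W} {d} {S} a b = cong₂ _∧_ (⊆ₛ⁺ {S = W} {S} a) (⌊⌋-true (card S ≟ q ^ d) (size b))

    ascending : ∀ {k} → Subset n → ℕ → Vec (Subset n) k → Bool
    ascending W d []      = true
    ascending W d (S ∷ U) = above W (suc d) S ∧ ascending S (suc d) U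

    -- The flags are sorted by their last subspace W′. In a flag of suc x steps the first one has
    -- [suc x] possible values between W and W′ by `between-count`, and induction gives [x]! for the
    -- rest. The function `g` carries whatever is built on top of W′.
    flags-sum : ∀ x W d → W ∈ Ss → Dim W d → (g : Subset n → ℕ) →
      ∑ (vecsOf Ss x) (λ U → 𝟙 (ascending W d U) * g (last W U)) ≡
      [ x ]! q * ∑ Ss (λ W′ → 𝟙 (above W (x + d) W′) * g W′)
    flags-sum zero W d W∈ dW g = cong (_+ 0) (trans (+-identityʳ (g W)) (sym (begin
      ∑ Ss (λ W′ → 𝟙 (above W d W′) * g W′)     ≡⟨ ∑-cong∈ Ss (λ {W′} W′∈ → collapse W′ W′∈ (above W d W′) refl) ⟩
      ∑ Ss (λ W′ → 𝟙 (above W d W′) * g W)      ≡⟨ ∑-*ʳ Ss (g W) _ ⟩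
      ∑ Ss (𝟙 ∘ above W d) * g W
        ≡⟨ cong (_* g W) (count-unique (above W d) W∈ (above⁺ {W} {d} {W} (λ h → h) dW) same) ⟩
      1 * g W                                   ≡⟨ *-identityˡ (g W) ⟩
      g W                                         ∎)))
      where
      open ≡-Reasoning
      same : ∀ {S} → S ∈ Ss → above W d S ≡ true → W ≡ S
      same {S} S∈ e = let W⊆S , dS = above⁻ {W} {d} {S} e in
        ⊆-antisym W∈ S∈ W⊆S (λ {x} → card-equal W⊆S (trans (size dW) (sym (size dS))) {x})
      collapse : ∀ W′ → W′ ∈ Ss → ∀ b → above W d W′ ≡ b → 𝟙 b * g W′ ≡ 𝟙 b * g W
      collapse W′ W′∈ true  e = cong (λ S → 1 * g S) (sym (same W′∈ e))
      collapse W′ W′∈ false e = refl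
    flags-sum (suc x) W d W∈ dW g = begin
      ∑ (vecsOf Ss (suc x)) (λ U → 𝟙 (ascending W d U) * g (last W U))
        ≡⟨ ∑-vecs Ss x _ ⟩
      ∑ Ss (λ S → ∑ (vecsOf Ss x) (λ U → 𝟙 (above W (suc d) S ∧ ascending S (suc d) U) * g (last S U)))
        ≡⟨ ∑-cong∈ Ss (λ {S} S∈ → inner S S∈ (above W (suc d) S) refl) ⟩
      ∑ Ss (λ S → ∑ Ss (λ W′ → [ x ]! q * (g W′ * 𝟙 (above W (suc d) S ∧ above S (x + suc d) W′))))
        ≡⟨ ∑-swap Ss Ss _ ⟩
      ∑ Ss (λ W′ → ∑ Ss (λ S → [ x ]! q * (g W′ * 𝟙 (above W (suc d) S ∧ above S (x + suc d) W′))))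
        ≡⟨ ∑-cong∈ Ss (λ {W′} W′∈ → trans (∑-*ˡ Ss ([ x ]! q) _) (cong ([ x ]! q *_)
             (trans (∑-*ˡ Ss (g W′) _) (cong (g W′ *_) (outer W′ W′∈ (above W (suc x + d) W′) refl))))) ⟩
      ∑ Ss (λ W′ → [ x ]! q * (g W′ * (𝟙 (above W (suc x + d) W′) * [ suc x ] q)))
        ≡⟨ ∑-cong Ss (λ W′ → shuffle ([ x ]! q) (g W′) (𝟙 (above W (suc x + d) W′)) ([ suc x ] q)) ⟩
      ∑ Ss (λ W′ → [ suc x ]! q * (𝟙 (above W (suc x + d) W′) * g W′))
        ≡⟨ ∑-*ˡ Ss ([ suc x ]! q) _ ⟩
      [ suc x ]! q * ∑ Ss (λ W′ → 𝟙 (above W (suc x + d) W′) * g W′) ∎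
      where
      open ≡-Reasoning
      shuffle : ∀ a b c d → a * (b * (c * d)) ≡ d * a * (c * b)
      shuffle = solve-∀
      inner : ∀ S → S ∈ Ss → ∀ b → above W (suc d) S ≡ b →
        ∑ (vecsOf Ss x) (λ U → 𝟙 (b ∧ ascending S (suc d) U) * g (last S U)) ≡
        ∑ Ss (λ W′ → [ x ]! q * (g W′ * 𝟙 (b ∧ above S (x + suc d) W′)))
      inner S S∈ false _ = trans (∑-0 (vecsOf Ss x) (λ _ → refl))
        (sym (∑-0 Ss (λ {W′} _ → trans (cong ([ x ]! q *_) (*-zeroʳ (g W′))) (*-zeroʳ ([ x ]! q)))))
      inner S S∈ true  e = trans (flags-sum x S (suc d) S∈ (proj₂ (above⁻ {W} {suc d} {S} e)) g)
        (trans (sym (∑-*ˡ Ss ([ x ]! q) _))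
          (∑-cong Ss (λ W′ → cong ([ x ]! q *_) (*-comm (𝟙 (above S (x + suc d) W′)) (g W′)))))
      outer : ∀ W′ → W′ ∈ Ss → ∀ b → above W (suc x + d) W′ ≡ b →
        ∑ Ss (λ S → 𝟙 (above W (suc d) S ∧ above S (x + suc d) W′)) ≡ 𝟙 b * [ suc x ] q
      outer W′ W′∈ true e = let W⊆W′ , dW′ = above⁻ {W} {suc x + d} {W′} e in
        trans (∑-cong Ss (λ S → cong 𝟙 (true-≡ (to S) (from S dW′))))
          (trans (between-count (suc x) W∈ W′∈ W⊆W′ dW dW′) (sym (*-identityˡ _)))
        where
        to : ∀ S → above W (suc d) S ∧ above S (x + suc d) W′ ≡ true → isBetween W W′ (suc d) S ≡ true
        to S e = let a , b = ∧-true {above W (suc d) S} e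
                     l , dS = above⁻ {W} {suc d} {S} a
                     u , _ = above⁻ {S} {x + suc d} {W′} b
                 in isBetween⁺ (between l u dS)
        from : ∀ S → Dim W′ (suc x + d) → isBetween W W′ (suc d) S ≡ true →
          above W (suc d) S ∧ above S (x + suc d) W′ ≡ true
        from S dW′ e = let between l u dS = isBetween⁻ {A = W} {W′} {suc d} e in
          cong₂ _∧_ (above⁺ {W} {suc d} {S} l dS) (above⁺ {S} {x + suc d} {W′} u (subst (Dim W′) (sym (+-suc x d)) dW′))
      outer W′ W′∈ false e = ∑-0 Ss (λ {S} _ → cong 𝟙 (¬-not (none S)))
        where
        none : ∀ S → ¬ (above W (suc d) S ∧ above S (x + suc d) W′ ≡ true)
        none S h = let a , b = ∧-true {above W (suc d) S} h
                       l , _ = above⁻ {W} {suc d} {S} a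
                       u , dW′ = above⁻ {S} {x + suc d} {W′} b
                   in not-¬ e (above⁺ {W} {suc x + d} {W′} (λ h → u (l h)) (subst (Dim W′) (+-suc x d) dW′))

    -- All rows of a clique have the same target `L`, the last subspace of the block. The earlier
    -- subspaces lie in `L`, so the conditions of the whole block amount to T L ⊆ L; this is the
    -- form in which `chainsFrom` counts.
    cliqueGood : Subset n → ℕ → (α : List ℕ) → Vec (Subset n) (sum α) → Bool
    cliqueGood W d []      V = true
    cliqueGood W d (x ∷ α) V = let L = last W (take x V) in
      ascending W d (take x V) ∧ mapsInto T L L ∧ cliqueGood L (x + d) α (drop x V)

    -- `Good` for the part of a flag above a subspace W of dimension d. Positions now start at W, so
    -- row numbers and row ends are shifted by d.
    record From (W : Subset n) (d : ℕ) (h : ℕ → ℕ) {k} (V : Vec (Subset n) k) : Set where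
      field
        chain : ∀ i → i < k → at W V i ⊆′ at W V (suc i)
        dims  : ∀ i → i < k → Dim (at W V (suc i)) (suc (i + d))
        maps  : ∀ i → i < k → MapsInto T (at W V (suc i)) (at W V (h (i + d) ∸ d))

    ascending⁻ : ∀ {k} W d (U : Vec (Subset n) k) → ascending W d U ≡ true → ∀ i → i < k →
      at W U i ⊆′ at W U (suc i) × Dim (at W U (suc i)) (suc (i + d))
    ascending⁻ W d (S ∷ U) e i i<k with ∧-true {above W (suc d) S} e
    ascending⁻ W d (S ∷ U) e zero    i<k       | a , b = above⁻ {W} {suc d} {S} a
    ascending⁻ W d (S ∷ U) e (suc i) (s≤s i<k) | a , b = let l , dm = ascending⁻ S (suc d) U b i i<k in
      l , subst (λ k → Dim (at S U (suc i)) (suc k)) (+-suc i d) dm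

    ascending⁺ : ∀ {k} W d (U : Vec (Subset n) k) →
      (∀ i → i < k → at W U i ⊆′ at W U (suc i) × Dim (at W U (suc i)) (suc (i + d))) → ascending W d U ≡ true
    ascending⁺ W d []      f = refl
    ascending⁺ W d (S ∷ U) f = cong₂ _∧_ (let l , dm = f 0 (s≤s z≤n) in above⁺ {W} {suc d} {S} l dm)
      (ascending⁺ S (suc d) U (λ i i<k → let l , dm = f (suc i) (s≤s i<k) in
        l , subst (λ k → Dim (at S U (suc i)) (suc k)) (sym (+-suc i d)) dm))

    climb : ∀ {k} W (U : Vec (Subset n) k) → (∀ i → i < k → at W U i ⊆′ at W U (suc i)) →
      ∀ i → i ≤ k → at W U i ⊆′ last W U
    climb W []      f zero    _         h = h
    climb W (S ∷ U) f zero    _         h = climb S U (λ i i<k → f (suc i) (s≤s i<k)) 0 z≤n (f 0 (s≤s z≤n) h)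
    climb W (S ∷ U) f (suc i) (s≤s i≤k) h = climb S U (λ i i<k → f (suc i) (s≤s i<k)) i i≤k h

    module Split {x k} (W : Subset n) (d : ℕ) (h : ℕ → ℕ) (U : Vec (Subset n) x) (V : Vec (Subset n) k) (1≤x : 1 ≤ x)
        (block : ∀ i → i < x → h (i + d) ≡ x + d) (later : ∀ i → i < k → x + d ≤ h (i + (x + d))) where

      L : Subset n
      L = last W U

      blockEnd : ∀ i → i < x → at W (U Vec.++ V) (h (i + d) ∸ d) ≡ L
      blockEnd i i<x = trans (cong (at W (U Vec.++ V)) (trans (cong (_∸ d) (block i i<x)) (m+n∸n≡m x d)))
        (trans (at-++ˡ W U V x ≤-refl) (at-length W U))

      laterIndex : ∀ i → i < k → h (x + i + d) ∸ d ≡ x + (h (i + (x + d)) ∸ (x + d))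
      laterIndex i i<k = begin
        h (x + i + d) ∸ d                                       ≡⟨ cong (λ z → h z ∸ d) (rearrange x i d) ⟩
        e ∸ d                                                       ≡⟨ cong (_∸ d) (m∸n+n≡m (later i i<k)) ⟨
        (e ∸ (x + d) + (x + d)) ∸ d                         ≡⟨ cong (_∸ d) (reassoc (e ∸ (x + d)) x d) ⟩
        (x + (e ∸ (x + d)) + d) ∸ d                         ≡⟨ m+n∸n≡m _ d ⟩
        x + (e ∸ (x + d))                                       ∎
        where
        open ≡-Reasoning
        e = h (i + (x + d))
        rearrange : ∀ x i d → x + i + d ≡ i + (x + d)
        rearrange = solve-∀
        reassoc : ∀ a x d → a + (x + d) ≡ x + a + d
        reassoc = solve-∀

      next-at : ∀ i → at W (U Vec.++ V) (suc (x + i)) ≡ at L V (suc i)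
      next-at i = trans (cong (at W (U Vec.++ V)) (sym (+-suc x i))) (at-++ʳ W U V (suc i))

      later-at : ∀ i → i < k → at W (U Vec.++ V) (h (x + i + d) ∸ d) ≡ at L V (h (i + (x + d)) ∸ (x + d))
      later-at i i<k = trans (cong (at W (U Vec.++ V)) (laterIndex i i<k)) (at-++ʳ W U V _)

      dim-shift : ∀ i → suc (x + i + d) ≡ suc (i + (x + d))
      dim-shift i = lem x i d
        where
        lem : ∀ x i d → suc (x + i + d) ≡ suc (i + (x + d))
        lem = solve-∀

      split⁻ : From W d h (U Vec.++ V) → ascending W d U ≡ true × MapsInto T L L × From L (x + d) h V
      split⁻ G = ascending⁺ W d U initial , invariant , record { chain = chain′ ; dims = dims′ ; maps = maps′ }
        where
        open From G
        <x⇒< : ∀ {i} → i < x → i < x + k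
        <x⇒< i<x = <-≤-trans i<x (m≤m+n x k)
        initial : ∀ i → i < x → at W U i ⊆′ at W U (suc i) × Dim (at W U (suc i)) (suc (i + d))
        initial i i<x = subst₂ _⊆′_ (at-++ˡ W U V i (<⇒≤ i<x)) (at-++ˡ W U V (suc i) i<x) (chain i (<x⇒< i<x)) ,
          subst (λ S → Dim S (suc (i + d))) (at-++ˡ W U V (suc i) i<x) (dims i (<x⇒< i<x))
        -- The last row of the block concerns `L` itself; it exists because 1 ≤ x.
        invariant : MapsInto T L L
        invariant = subst₂ (MapsInto T)
          (trans (at-++ˡ W U V (suc (pred x)) (≤-reflexive last-row)) (trans (cong (at W U) last-row) (at-length W U)))
          (blockEnd (pred x) pred<x) (maps (pred x) (<x⇒< pred<x))
          where
          last-row : suc (pred x) ≡ x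
          last-row = suc-pred x {{>-nonZero 1≤x}}
          pred<x : pred x < x
          pred<x = ≤-reflexive last-row
        <k⇒< : ∀ {i} → i < k → x + i < x + k
        <k⇒< = +-monoʳ-< x
        chain′ : ∀ i → i < k → at L V i ⊆′ at L V (suc i)
        chain′ i i<k = subst₂ _⊆′_ (at-++ʳ W U V i) (next-at i) (chain (x + i) (<k⇒< i<k))
        dims′ : ∀ i → i < k → Dim (at L V (suc i)) (suc (i + (x + d)))
        dims′ i i<k = subst₂ Dim (next-at i) (dim-shift i) (dims (x + i) (<k⇒< i<k))
        maps′ : ∀ i → i < k → MapsInto T (at L V (suc i)) (at L V (h (i + (x + d)) ∸ (x + d)))
        maps′ i i<k = subst₂ (MapsInto T) (next-at i) (later-at i i<k) (maps (x + i) (<k⇒< i<k))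

      split⁺ : ascending W d U ≡ true → MapsInto T L L → From L (x + d) h V → From W d h (U Vec.++ V)
      split⁺ asc inv G = record
        { chain = λ i i<xk → by i i<xk (λ i → at W (U Vec.++ V) i ⊆′ at W (U Vec.++ V) (suc i))
            (λ i i<x → subst₂ _⊆′_ (sym (at-++ˡ W U V i (<⇒≤ i<x))) (sym (at-++ˡ W U V (suc i) i<x)) (proj₁ (initial i i<x)))
            (λ i i<k → subst₂ _⊆′_ (sym (at-++ʳ W U V i)) (sym (next-at i)) (chain i i<k))
        ; dims = λ i i<xk → by i i<xk (λ i → Dim (at W (U Vec.++ V) (suc i)) (suc (i + d)))
            (λ i i<x → subst (λ S → Dim S (suc (i + d))) (sym (at-++ˡ W U V (suc i) i<x)) (proj₂ (initial i i<x)))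
            (λ i i<k → subst₂ Dim (sym (next-at i)) (sym (dim-shift i)) (dims i i<k))
        ; maps = λ i i<xk → by i i<xk (λ i → MapsInto T (at W (U Vec.++ V) (suc i)) (at W (U Vec.++ V) (h (i + d) ∸ d)))
            (λ i i<x → subst₂ (MapsInto T) (sym (at-++ˡ W U V (suc i) i<x)) (sym (blockEnd i i<x))
              (λ {v} v∈ → inv (climb W U (λ j j<x → proj₁ (initial j j<x)) (suc i) i<x v∈)))
            (λ i i<k → subst₂ (MapsInto T) (sym (next-at i)) (sym (later-at i i<k)) (maps i i<k)) }
        where
        open From G
        initial : ∀ i → i < x → at W U i ⊆′ at W U (suc i) × Dim (at W U (suc i)) (suc (i + d))
        initial = ascending⁻ W d U asc
        by : ∀ i → i < x + k → (P : ℕ → Set) → (∀ i → i < x → P i) → (∀ i → i < k → P (x + i)) → P i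
        by i i<xk P f g with <-≤-connex i x
        ... | inj₁ i<x = f i i<x
        ... | inj₂ x≤i = subst P (m+[n∸m]≡n x≤i)
          (g (i ∸ x) (+-cancelˡ-< x _ _ (subst (_< x + k) (sym (m+[n∸m]≡n x≤i)) i<xk)))

    module Block {g : ℕ → ℕ} {d x : ℕ} {α : List ℕ} (L : Low g d) where

      h : ℕ → ℕ
      h = cliques g d (x ∷ α)

      block : ∀ i → i < x → h (i + d) ≡ x + d
      block i i<x = trans (cliques-below α i+d<) (trans (put-in (m≤n+m d i) i+d<) (+-comm d x))
        where
        i+d< : i + d < d + x
        i+d< = subst (_< d + x) (+-comm d i) (+-monoʳ-< d i<x)

      later : ∀ i → i < sum α → x + d ≤ h (i + (x + d))
      later i i<s = ≤-trans (m≤n+m (x + d) i) (<⇒≤ (Low.above (low-cliques (x ∷ α) L)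
        (subst (i + (x + d) <_) (rearrange (sum α) x d) (+-monoˡ-< (x + d) i<s))))
        where
        rearrange : ∀ s x d → s + (x + d) ≡ d + (x + s)
        rearrange = solve-∀

    cliqueGood⁻ : ∀ {g} W d α V → Low g d → All (1 ≤_) α → From W d (cliques g d α) V → cliqueGood W d α V ≡ true
    cliqueGood⁻ W d []      V low pos       G = refl
    cliqueGood⁻ {g} W d (x ∷ α) V low (1≤x ∷ pos) G =
      let a , m , G′ = Split.split⁻ W d h (take x V) (drop x V) 1≤x (Block.block {α = α} low) (Block.later {α = α} low)
                         (subst (From W d h) (sym (take++drop≡id x V)) G)
      in cong₂ _∧_ a (cong₂ _∧_ (mapsInto⁺ {T = T} {last W (take x V)} {last W (take x V)} m)
           (cliqueGood⁻ (last W (take x V)) (x + d) α (drop x V) (subst (Low _) (+-comm d x) (low-put x low)) pos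
             (subst (λ e → From (last W (take x V)) (x + d)
               (cliques (put g d (d + x) (d + x)) e α) (drop x V)) (+-comm d x) G′)))
      where h = cliques g d (x ∷ α)

    cliqueGood⁺ : ∀ {g} W d α V → Low g d → All (1 ≤_) α → cliqueGood W d α V ≡ true → From W d (cliques g d α) V
    cliqueGood⁺ W d []      [] low pos       e = record { chain = λ _ () ; dims = λ _ () ; maps = λ _ () }
    cliqueGood⁺ {g} W d (x ∷ α) V low (1≤x ∷ pos) e with ∧-true {ascending W d (take x V)} e
    ... | a , e′ with ∧-true {mapsInto T (last W (take x V)) (last W (take x V))} e′
    ... | m , e″ = subst (From W d h) (take++drop≡id x V)
      (Split.split⁺ W d h (take x V) (drop x V) 1≤x (Block.block {α = α} low) (Block.later {α = α} low) a
        (mapsInto⁻ {T = T} {last W (take x V)} {last W (take x V)} m)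
        (subst (λ e → From (last W (take x V)) (x + d) (cliques (put g d (d + x) (d + x)) e α) (drop x V))
          (sym (+-comm d x))
          (cliqueGood⁺ (last W (take x V)) (x + d) α (drop x V) (subst (Low _) (+-comm d x) (low-put x low)) pos e″)))
      where h = cliques g d (x ∷ α)

    take-++ : ∀ {A : Set} {j k} (u : Vec A j) (v : Vec A k) → take j (u Vec.++ v) ≡ u
    take-++ []      v = refl
    take-++ (x ∷ u) v = cong (x ∷_) (take-++ u v)

    drop-++ : ∀ {A : Set} {j k} (u : Vec A j) (v : Vec A k) → drop j (u Vec.++ v) ≡ v
    drop-++ []      v = refl
    drop-++ (x ∷ u) v = drop-++ u v

    𝟙-∧₃ : ∀ a b c → 𝟙 (a ∧ b ∧ c) ≡ 𝟙 a * (𝟙 b * 𝟙 c)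
    𝟙-∧₃ false b     c     = refl
    𝟙-∧₃ true  false c     = refl
    𝟙-∧₃ true  true  false = refl
    𝟙-∧₃ true  true  true  = refl

    -- The ends of the blocks form a chain of invariant subspaces, and a step of dimension x of such
    -- a chain can be refined to a flag in [x]! ways. The recursion on the blocks is that of
    -- `chainsFrom`.
    cliqueGood-sum : ∀ α W d → W ∈ Ss → Dim W d →
      ∑ (vecsOf Ss (sum α)) (𝟙 ∘ cliqueGood W d α) ≡ factorials q α * chainsFrom T α W d
    cliqueGood-sum []      W d W∈ dW = refl
    cliqueGood-sum (x ∷ α) W d W∈ dW = begin
      ∑ (vecsOf Ss (x + sum α)) (𝟙 ∘ cliqueGood W d (x ∷ α))
        ≡⟨ ∑-vecs-++ Ss x (sum α) _ ⟩
      ∑ (vecsOf Ss x) (λ U → ∑ (vecsOf Ss (sum α)) (λ V → 𝟙 (cliqueGood W d (x ∷ α) (U Vec.++ V))))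
        ≡⟨ ∑-cong (vecsOf Ss x) (λ U → trans (∑-cong (vecsOf Ss (sum α)) (factor U)) (pull U)) ⟩
      ∑ (vecsOf Ss x) (λ U → 𝟙 (ascending W d U) * G (last W U))
        ≡⟨ flags-sum x W d W∈ dW G ⟩
      [ x ]! q * ∑ Ss (λ W′ → 𝟙 (above W (x + d) W′) * G W′)
        ≡⟨ cong ([ x ]! q *_) (trans (∑-cong∈ Ss (λ {W′} W′∈ → term W′ W′∈)) (∑-*ˡ Ss (factorials q α) _)) ⟩
      [ x ]! q * (factorials q α * chainsFrom T (x ∷ α) W d)
        ≡⟨ *-assoc ([ x ]! q) (factorials q α) _ ⟨
      factorials q (x ∷ α) * chainsFrom T (x ∷ α) W d ∎
      where
      open ≡-Reasoning
      G : Subset n → ℕ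
      G S = 𝟙 (mapsInto T S S) * ∑ (vecsOf Ss (sum α)) (𝟙 ∘ cliqueGood S (x + d) α)
      factor : ∀ U V → 𝟙 (cliqueGood W d (x ∷ α) (U Vec.++ V)) ≡
        𝟙 (ascending W d U) * (𝟙 (mapsInto T (last W U) (last W U)) * 𝟙 (cliqueGood (last W U) (x + d) α V))
      factor U V rewrite take-++ U V | drop-++ U V =
        𝟙-∧₃ (ascending W d U) (mapsInto T (last W U) (last W U)) (cliqueGood (last W U) (x + d) α V)
      pull : ∀ U → ∑ (vecsOf Ss (sum α)) (λ V → 𝟙 (ascending W d U) *
          (𝟙 (mapsInto T (last W U) (last W U)) * 𝟙 (cliqueGood (last W U) (x + d) α V))) ≡ 𝟙 (ascending W d U) * G (last W U)
      pull U = trans (∑-*ˡ (vecsOf Ss (sum α)) (𝟙 (ascending W d U)) _)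
        (cong (𝟙 (ascending W d U) *_) (∑-*ˡ (vecsOf Ss (sum α)) (𝟙 (mapsInto T (last W U) (last W U))) _))
      term : ∀ W′ → W′ ∈ Ss → 𝟙 (above W (x + d) W′) * G W′ ≡
        factorials q α * (if mapsInto T W′ W′ ∧ (W ⊆ₛ W′) ∧ hasDim W′ (d + x) then chainsFrom T α W′ (d + x) else 0)
      term W′ W′∈ rewrite hasDim≡card W′∈ (d + x) | +-comm d x =
        by (mapsInto T W′ W′) (above W (x + d) W′) refl
        where
        by : ∀ m a → above W (x + d) W′ ≡ a → 𝟙 a * (𝟙 m * ∑ (vecsOf Ss (sum α)) (𝟙 ∘ cliqueGood W′ (x + d) α)) ≡
          factorials q α * (if m ∧ a then chainsFrom T α W′ (x + d) else 0)
        by true  true  e = trans (*-identityˡ _) (trans (*-identityˡ _)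
          (cliqueGood-sum α W′ (x + d) W′∈ (proj₂ (above⁻ {W} {x + d} {W′} e))))
        by true  false e = sym (*-zeroʳ (factorials q α))
        by false true  e = sym (*-zeroʳ (factorials q α))
        by false false e = sym (*-zeroʳ (factorials q α))

    N-cliques : ∀ α → All (1 ≤_) α → sum α ≡ n → N (cliques suc 0 α) ≡ factorials q α * fl T α
    N-cliques α pos refl = trans (∑-cong (vecsOf Ss n) (λ V → cong 𝟙 (true-≡ (to V) (from V))))
      (cliqueGood-sum α (zeroSub n) 0 zero-subspace zero-dim)
      where
      h = cliques suc 0 α
      to : ∀ V → good h V ≡ true → cliqueGood (zeroSub n) 0 α V ≡ true
      to V e = cliqueGood⁻ (zeroSub n) 0 α V low-suc pos record
        { chain = chain
        ; dims  = λ i i<n → subst (λ k → Dim (at (zeroSub n) V (suc i)) (suc k)) (sym (+-identityʳ i)) (dims i i<n)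
        ; maps  = λ i i<n → subst (λ k → MapsInto T (at (zeroSub n) V (suc i)) (at (zeroSub n) V (h k)))
            (sym (+-identityʳ i)) (maps i i<n) }
        where open Good (good⁻ {h} {V} e)
      from : ∀ V → cliqueGood (zeroSub n) 0 α V ≡ true → good h V ≡ true
      from V e = good⁺ {h} {V} record
        { chain = chain
        ; dims  = λ i i<n → subst (λ k → Dim (at (zeroSub n) V (suc i)) (suc k)) (+-identityʳ i) (dims i i<n)
        ; maps  = λ i i<n → subst (λ k → MapsInto T (at (zeroSub n) V (suc i)) (at (zeroSub n) V (h k)))
            (+-identityʳ i) (maps i i<n) }
        where open From (cliqueGood⁺ (zeroSub n) 0 α V low-suc pos e)

-- Comparison of the two sides

module Assembly where

  open import Data.Nat as ℕ using (ℕ; suc; z≤n; s≤s)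
  import Data.Nat.Properties as ℕ
  open import Data.Nat.ListAction.Properties using (sum-↭)
  open import Data.Integer as ℤ using (ℤ; +_; 0ℤ; 1ℤ)
  import Data.Integer.Properties as ℤ
  open import Data.Integer.Tactic.RingSolver using (solve-∀)
  open import Data.Fin using (Fin)
  open import Data.List as List using (List; []; _∷_; foldr)
  open import Data.List.Membership.Propositional using (_∈_)
  open import Data.List.Relation.Unary.Any using (here; there)
  open import Data.List.Relation.Unary.All as All using (All; []; _∷_)
  open import Data.List.Relation.Binary.Permutation.Propositional using (↭-sym)
  open import Data.List.Relation.Binary.Permutation.Propositional.Properties using (All-resp-↭)
  open import Relation.Binary.Construct.Flip.EqAndOrd using (decTotalOrder)
  open import Data.List.Sort (decTotalOrder ℕ.≤-decTotalOrder) using (sort-↭; sort-↗)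
  open import Data.Product using (_,_; proj₁; proj₂)
  open import Function using (_∘_)
  open import Relation.Binary.PropositionalEquality hiding ([_])
  open import Defs
  open ModularLaw
  open ColouringLaw using (module Chromatic)
  open ColouringCoefficients using (Xcoef≡X; rowEnds; rowEnds-isHess)
  open CliqueColourings using (factorials; module CliqueSum)
  open ElementaryBasis
  open FlagCliques using (module CliqueFlags)

  ∑ℤ : List (List ℕ) → (List ℕ → ℤ) → ℤ
  ∑ℤ Λ f = foldr (λ μ acc → f μ ℤ.+ acc) 0ℤ Λ

  ∑ℤ-cong : ∀ Λ {f g} → (∀ {μ} → μ ∈ Λ → f μ ≡ g μ) → ∑ℤ Λ f ≡ ∑ℤ Λ g
  ∑ℤ-cong []      eq = refl
  ∑ℤ-cong (μ ∷ Λ) eq = cong₂ ℤ._+_ (eq (here refl)) (∑ℤ-cong Λ (eq ∘ there))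

  combine-cong : ∀ b {φ ψ : List ℕ → ℤ} → All (λ t → φ (proj₂ t) ≡ ψ (proj₂ t)) b → combine b φ ≡ combine b ψ
  combine-cong []            []       = refl
  combine-cong ((z , ν) ∷ b) (e ∷ es) = cong₂ (λ x y → z ℤ.* x ℤ.+ y) e (combine-cong b es)

  combine-scale : ∀ b k φ → combine b (λ μ → k ℤ.* φ μ) ≡ k ℤ.* combine b φ
  combine-scale []            k φ = sym (ℤ.*-zeroʳ k)
  combine-scale ((z , ν) ∷ b) k φ = trans (cong (λ y → z ℤ.* (k ℤ.* φ ν) ℤ.+ y) (combine-scale b k φ)) (lem z k (φ ν) _)
    where
    lem : ∀ z k x y → z ℤ.* (k ℤ.* x) ℤ.+ k ℤ.* y ≡ k ℤ.* (z ℤ.* x ℤ.+ y)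
    lem = solve-∀

  combine-+ : ∀ b φ ψ → combine b (λ μ → φ μ ℤ.+ ψ μ) ≡ combine b φ ℤ.+ combine b ψ
  combine-+ []            φ ψ = refl
  combine-+ ((z , ν) ∷ b) φ ψ = trans (cong (λ y → z ℤ.* (φ ν ℤ.+ ψ ν) ℤ.+ y) (combine-+ b φ ψ)) (lem z (φ ν) (ψ ν) _ _)
    where
    lem : ∀ z x y s t → z ℤ.* (x ℤ.+ y) ℤ.+ (s ℤ.+ t) ≡ (z ℤ.* x ℤ.+ s) ℤ.+ (z ℤ.* y ℤ.+ t)
    lem = solve-∀

  -- Linearity of the functional `b`, in the form needed to apply it to the expansion of X in the
  -- e_ρ.
  combine-∑ : ∀ b Λ (c : List ℕ → ℤ) (e : List ℕ → List ℕ → ℤ) →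
    combine b (λ μ → ∑ℤ Λ (λ ρ → c ρ ℤ.* e ρ μ)) ≡ ∑ℤ Λ (λ ρ → c ρ ℤ.* combine b (e ρ))
  combine-∑ b []      c e = trans (combine-scale b 0ℤ (λ _ → 0ℤ)) (ℤ.*-zeroˡ (combine b (λ _ → 0ℤ)))
  combine-∑ b (ρ ∷ Λ) c e = trans (combine-+ b _ _) (cong₂ ℤ._+_ (combine-scale b (c ρ) (e ρ)) (combine-∑ b Λ c e))

  module Main (F : FiniteField) (n : ℕ) (T : FiniteField.Matrix F n) where
    open FiniteField F using (q; fl; hessCount)
    open CliqueFlags F n T using (N; N-ext; N-move; N-cliques; hessCount≡N; q≥2)

    X : List ℕ → (ℕ → ℕ) → ℕ
    X μ = Chromatic.X q n μ

    functional = monomialFunctional n (λ μ → + fl T μ)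
    b = proj₁ functional

    f : (ℕ → ℕ) → ℤ
    f h = + N h ℤ.- combine b (λ μ → + X μ h)

    lift : ∀ {x₀ x₁ x₂} → (1 ℕ.+ q) ℕ.* x₁ ≡ q ℕ.* x₀ ℕ.+ x₂ → (1ℤ ℤ.+ + q) ℤ.* + x₁ ≡ + q ℤ.* + x₀ ℤ.+ + x₂
    lift {x₀} {x₁} {x₂} eq = trans (sym (ℤ.pos-* (1 ℕ.+ q) x₁)) (trans (cong +_ eq) (cong (ℤ._+ + x₂) (ℤ.pos-* q x₀)))

    f-modular : Modular n q f
    f-modular = record
      { ext  = λ {h} {h′} eq → cong₂ ℤ._-_ (cong +_ (N-ext {h} {h′} eq))
          (combine-cong b (All.universal (λ t → cong +_ (Chromatic.X-ext q n (proj₂ t) {h} {h′} eq)) b))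
      ; move = λ {h₀} {h₁} {h₂} M → begin
          (1ℤ ℤ.+ + q) ℤ.* (+ N h₁ ℤ.- Y h₁)                              ≡⟨ distrib (+ q) (+ N h₁) (Y h₁) ⟩
          (1ℤ ℤ.+ + q) ℤ.* + N h₁ ℤ.- (1ℤ ℤ.+ + q) ℤ.* Y h₁
            ≡⟨ cong₂ ℤ._-_ (lift {N h₀} {N h₁} (N-move M)) (Y-move M) ⟩
          (+ q ℤ.* + N h₀ ℤ.+ + N h₂) ℤ.- (+ q ℤ.* Y h₀ ℤ.+ Y h₂)         ≡⟨ collect (+ q) (+ N h₀) (+ N h₂) (Y h₀) (Y h₂) ⟩
          + q ℤ.* (+ N h₀ ℤ.- Y h₀) ℤ.+ (+ N h₂ ℤ.- Y h₂)                 ∎ }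
      where
      open ≡-Reasoning
      Y : (ℕ → ℕ) → ℤ
      Y h = combine b (λ μ → + X μ h)
      distrib : ∀ x a y → (1ℤ ℤ.+ x) ℤ.* (a ℤ.- y) ≡ (1ℤ ℤ.+ x) ℤ.* a ℤ.- (1ℤ ℤ.+ x) ℤ.* y
      distrib = solve-∀
      collect : ∀ x a c y z → (x ℤ.* a ℤ.+ c) ℤ.- (x ℤ.* y ℤ.+ z) ≡ x ℤ.* (a ℤ.- y) ℤ.+ (c ℤ.- z)
      collect = solve-∀
      Y-move : ∀ {h₀ h₁ h₂} → Move n h₀ h₁ h₂ → (1ℤ ℤ.+ + q) ℤ.* Y h₁ ≡ + q ℤ.* Y h₀ ℤ.+ Y h₂
      Y-move {h₀} {h₁} {h₂} M = begin
        (1ℤ ℤ.+ + q) ℤ.* Y h₁                                     ≡⟨ combine-scale b (1ℤ ℤ.+ + q) _ ⟨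
        combine b (λ μ → (1ℤ ℤ.+ + q) ℤ.* + X μ h₁)
          ≡⟨ combine-cong b (All.universal (λ t →
               lift {X (proj₂ t) h₀} {X (proj₂ t) h₁} (Chromatic.X-move q n (proj₂ t) M)) b) ⟩
        combine b (λ μ → + q ℤ.* + X μ h₀ ℤ.+ + X μ h₂)           ≡⟨ combine-+ b _ _ ⟩
        combine b (λ μ → + q ℤ.* + X μ h₀) ℤ.+ Y h₂               ≡⟨ cong (ℤ._+ Y h₂) (combine-scale b (+ q) _) ⟩
        + q ℤ.* Y h₀ ℤ.+ Y h₂                                     ∎

    instance
      q-nonZero : ℕ.NonZero q
      -- The reduction cancels q-integers, which are nonzero only because q is.
      q-nonZero = ℕ.>-nonZero (ℕ.≤-trans (s≤s z≤n) q≥2)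

    -- Both terms carry the same product of q-factorials; it multiplies fl_μ(T) - b(e_μ), which is
    -- zero by the choice of `b`.
    f-partition : ∀ {μ} → Partition n μ → f (cliques suc 0 μ) ≡ 0ℤ
    f-partition {μ} P@(partition total positive _) = begin
      + N h ℤ.- combine b (λ ν → + X ν h)
        ≡⟨ cong₂ ℤ._-_ (trans (cong +_ (N-cliques μ positive total)) (ℤ.pos-* φ (fl T μ)))
             (combine-cong b (All.universal (λ t → trans (cong +_ (X-value (proj₂ t))) (ℤ.pos-* φ (ecoefAux μ (proj₂ t)))) b)) ⟩
      + φ ℤ.* + fl T μ ℤ.- combine b (λ ν → + φ ℤ.* ecoef μ ν)
        ≡⟨ cong (λ z → + φ ℤ.* + fl T μ ℤ.- z) (combine-scale b (+ φ) (ecoef μ)) ⟩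
      + φ ℤ.* + fl T μ ℤ.- + φ ℤ.* combine b (ecoef μ)
        ≡⟨ ℤ.i≡j⇒i-j≡0 (cong (+ φ ℤ.*_) (proj₂ (proj₂ functional) (∈-partitions⁺ P))) ⟩
      0ℤ ∎
      where
      open ≡-Reasoning
      h = cliques suc 0 μ
      φ = factorials q μ
      X-value : ∀ ν → X ν h ≡ φ ℕ.* ecoefAux μ ν
      X-value ν = trans (cong (λ k → Chromatic.X q k ν h) (sym total)) (CliqueSum.X-cliques q μ ν)

    f-vanishes : ∀ {h} → IsHess n h → f h ≡ 0ℤ
    f-vanishes = Reduction.Vanish.vanish f-modular λ α pos total →
      -- The values of `b` are prescribed at partitions only, so the clique sizes are first sorted
      -- into descending order.
      trans (Reduction.cliques-↭ f-modular (↭-sym (sort-↭ α)) low-suc total)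
        (f-partition (partition (trans (sum-↭ (sort-↭ α)) total) (All-resp-↭ (↭-sym (sort-↭ α)) pos) (sort-↗ α)))

    theorem : (m : Fin n → Fin n) → IsHessenberg m → (c : List ℕ → ℤ) →
      (∀ μ → μ ∈ partitions n → Xcoef q m μ ≡ sumPartitions n (λ ρ → c ρ ℤ.* ecoef ρ μ)) →
      + hessCount m T ≡ sumPartitions n (λ ρ → + fl T ρ ℤ.* c ρ)
    theorem m H c expansion = begin
      + hessCount m T                                     ≡⟨ cong +_ (hessCount≡N m) ⟩
      + N (rowEnds m)                                     ≡⟨ ℤ.i-j≡0⇒i≡j _ _ (f-vanishes (rowEnds-isHess H)) ⟩
      combine b (λ μ → + X μ (rowEnds m))
        -- The expansion is assumed at partitions only; this is why `monomialFunctional` records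
        -- that `b` extracts coefficients at partitions.
        ≡⟨ combine-cong b (All.map (λ {t} μ∈ →
             trans (sym (Xcoef≡X q m (proj₂ t))) (expansion (proj₂ t) μ∈)) (proj₁ (proj₂ functional))) ⟩
      combine b (λ μ → sumPartitions n (λ ρ → c ρ ℤ.* ecoef ρ μ))
        ≡⟨ combine-∑ b (partitions n) c ecoef ⟩
      sumPartitions n (λ ρ → c ρ ℤ.* combine b (ecoef ρ))
        ≡⟨ ∑ℤ-cong (partitions n) (λ {ρ} ρ∈ →
             trans (cong (c ρ ℤ.*_) (sym (proj₂ (proj₂ functional) ρ∈))) (ℤ.*-comm (c ρ) (+ fl T ρ))) ⟩
      sumPartitions n (λ ρ → + fl T ρ ℤ.* c ρ)            ∎
      where open ≡-Reasoning

open import Defs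
open import Data.Nat using (ℕ; _≤_)
open import Data.Fin using (Fin)
open import Data.List using (List)
open import Data.List.Membership.Propositional using (_∈_)
open import Data.Integer using (ℤ; +_; _*_)
open import Relation.Binary.PropositionalEquality using (_≡_)

theorem1p1 : (F : FiniteField) (n : ℕ) → 1 ≤ n →
    (m : Fin n → Fin n) → IsHessenberg m →
    (T : FiniteField.Matrix F n) →
    -- c λ = coefficient of e_λ in X_{G(m)}(x;q), i.e. of h_λ in ω X_{G(m)}(x;q)
    (c : List ℕ → ℤ) →
    (∀ μ → μ ∈ partitions n →
      Xcoef (FiniteField.q F) m μ ≡ sumPartitions n (λ λs → c λs * ecoef λs μ)) →
    -- |H(m,T)| = ⟨F_T , ω X_{G(m)}(x;q)⟩ = Σ_λ fl_λ(T) · c λ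
    + FiniteField.hessCount F m T ≡ sumPartitions n (λ λs → + FiniteField.fl F T λs * c λs)
theorem1p1 F n _ m H T c = Assembly.Main.theorem F n T m H c
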